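{- Let $n\geq 3$. There exist $q_0$ and a constant $C>0$, both depending only on $n$, such that for every prime power $q\geq q_0$ every maximal coclique $\mathcal{F}$ of $\Gamma_{2n}$ falls into exactly one of the following categories. (a) $|\mathcal{F}|=\begin{bmatrix}2n\\ n-1\end{bmatrix}_q\begin{bmatrix}n+1\\ 1\end{bmatrix}_q+\begin{bmatrix}2n-1\\ n-1\end{bmatrix}_q q^n$ and $\mathcal{F}$ is one of the following structures: (a1) for a hyperplane $H$ and an object $X$ which is either a point of $H$ or a $(2n-2)$-space contained in $H$, $\mathcal{F}$ is the set of all $(n-1,n)$-flags $(A,B)$ such that $B\subseteq H$, or $A$ is incident with both $X$ and $H$ (i.e. $A\subseteq H$ and $A$ is incident with $X$); (a2) for a point $P$ and an object $X$ which is either a hyperplane containing $P$ or a line containing $P$, $\mathcal{F}$ is the set of all $(n-1,n)$-flags $(A,B)$ such that $P\in A$, or $B$ is incident with both $X$ and $P$. (b) $|\mathcal{F}|\leq \begin{bmatrix}2n\\ n-1\end{bmatrix}_q\begin{bmatrix}n+1\\ 1\end{bmatrix}_q+f(n,q)\, q^n$, and either there is a hyperplane $H$ such that $\mathcal{F}$ contains all $(n-1,n)$-flags $(A,B)$ with $B\subseteq H$, or there is a point $P$ such that $\mathcal{F}$ contains all $(n-1,n)$-flags $(A,B)$ with $P\in A$. (c) $|\mathcal{F}|\leq C q^{n^2+n-2}$.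
   Context: $\mathrm{PG}(2n,q)$ is the projective space of projective dimension $2n$ over $\mathbb{F}_q$; an $i$-space is a subspace of projective dimension $i$. An $(n-1,n)$-flag is a pair $(A,B)$ with $A$ an $(n-1)$-space, $B$ an $n$-space and $A\subseteq B$. Two such flags $(A_1,B_1),(A_2,B_2)$ are opposite if $A_1\cap B_2=A_2\cap B_1=\emptyset$. $\Gamma_{2n}$ is the graph whose vertices are the $(n-1,n)$-flags of $\mathrm{PG}(2n,q)$, two being adjacent iff they are opposite. A coclique is a set of pairwise non-adjacent vertices; a maximal coclique is one not properly contained in another coclique. The Gaussian coefficient is $\begin{bmatrix}b\\ a\end{bmatrix}_q=\prod_{i=1}^a\frac{q^{b-a+i}-1}{q^i-1}$ for $0\le a\le b$ and $0$ otherwise. Define $f(n,q)=3\begin{bmatrix}n\\ 1\end{bmatrix}_q\begin{bmatrix}2n-2\\ n-2\end{bmatrix}_q$ if $n\geq 4$ (and $q\ge 4$), and $f(3,q)=q^5+2q^4+3q^3+2q^2+q+1$. -}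

module Defs where

open import Data.Nat using (ℕ; zero; suc; _+_; _*_; _∸_; _^_; _≤_; _<_; _≤?_)
open import Data.Nat.DivMod using (_/_)
open import Data.Fin using (Fin)
open import Data.Vec using (Vec; []; _∷_; replicate; zipWith; map)
open import Data.List using (List; length; lookup)
open import Data.List.Membership.Propositional using (_∈_)
open import Data.List.Relation.Unary.Any using (Any)
open import Data.Product using (Σ; ∃; _×_; _,_)
open import Data.Sum using (_⊎_)
open import Relation.Nullary using (¬_; yes; no)
open import Relation.Binary.PropositionalEquality using (_≡_)
open import Algebra.Structures using (IsCommutativeRing)

-- Gaussian coefficients  [b a]_q = ∏_{i=1}^a (q^{b-a+i}-1)/(q^i-1)
-- (0 if a > b).  The quotient is exact for q ≥ 2.

prodRange : (ℕ → ℕ) → ℕ → ℕ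
prodRange f zero    = 1
prodRange f (suc a) = prodRange f a * f (suc a)

-- division (only used when exact); 0 for a zero divisor
divExact : ℕ → ℕ → ℕ
divExact m zero    = 0
divExact m (suc k) = m / suc k

gauss : ℕ → ℕ → ℕ → ℕ
gauss q b a with a ≤? b
... | yes _ = divExact (prodRange (λ i → q ^ (b ∸ a + i) ∸ 1) a)
                       (prodRange (λ i → q ^ i ∸ 1) a)
... | no _  = 0

-- f(n,q) of the paper (only used for n ≥ 3)
fnq : ℕ → ℕ → ℕ
fnq 3 q = q ^ 5 + 2 * q ^ 4 + 3 * q ^ 3 + 2 * q ^ 2 + q + 1
fnq n q = 3 * gauss q n 1 * gauss q (2 * n ∸ 2) (n ∸ 2)

record FiniteField (q : ℕ) : Set where
  field
    _+F_ _*F_  : Fin q → Fin q → Fin q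
    -F_        : Fin q → Fin q
    0F 1F      : Fin q
    isCommRing : IsCommutativeRing _≡_ _+F_ _*F_ -F_ 0F 1F
    0≢1        : ¬ (0F ≡ 1F)
    inverse    : ∀ x → ¬ (x ≡ 0F) → ∃ λ y → x *F y ≡ 1F

-- Projective geometry PG(2n,q) = subspaces of F^(2n+1).

module Geometry {q : ℕ} (F : FiniteField q) (n : ℕ) where
  open FiniteField F

  d : ℕ
  d = 2 * n + 1

  V : Set
  V = Vec (Fin q) d

  zeroV : V
  zeroV = replicate d 0F

  _+V_ : V → V → V
  _+V_ = zipWith _+F_

  _·V_ : Fin q → V → V
  c ·V v = map (c *F_) v

  lincomb : ∀ {k} → Vec (Fin q) k → Vec V k → V
  lincomb []       []       = zeroV
  lincomb (c ∷ cs) (b ∷ bs) = (c ·V b) +V lincomb cs bs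

  InSpan : ∀ {k} → V → Vec V k → Set
  InSpan {k} v bs = Σ (Vec (Fin q) k) λ c → lincomb c bs ≡ v

  LinIndep : ∀ {k} → Vec V k → Set
  LinIndep {k} bs = ∀ c → lincomb c bs ≡ zeroV → c ≡ replicate k 0F

  -- a projective i-space: the span of i+1 linearly independent vectors
  record Sub (i : ℕ) : Set where
    constructor sub
    field
      basis : Vec V (suc i)
      indep : LinIndep basis

  open Sub public

  _∈S_ : ∀ {i} → V → Sub i → Set
  v ∈S S = InSpan v (basis S)

  _⊆S_ : ∀ {i j} → Sub i → Sub j → Set
  S ⊆S T = ∀ v → v ∈S S → v ∈S T

  _≈S_ : ∀ {i} → Sub i → Sub i → Set
  S ≈S T = (S ⊆S T) × (T ⊆S S)

  Disjoint : ∀ {i j} → Sub i → Sub j → Set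
  Disjoint S T = ∀ v → v ∈S S → v ∈S T → v ≡ zeroV

  Incident : ∀ {i j} → Sub i → Sub j → Set
  Incident S T = (S ⊆S T) ⊎ (T ⊆S S)

  Point Line Hyperplane Space2n-2 : Set
  Point      = Sub 0
  Line       = Sub 1
  Hyperplane = Sub (2 * n ∸ 1)
  Space2n-2  = Sub (2 * n ∸ 2)

  record Flag : Set where
    constructor flag
    field
      fA  : Sub (n ∸ 1)
      fB  : Sub n
      A⊆B : fA ⊆S fB

  open Flag public

  FlagEq : Flag → Flag → Set
  FlagEq φ ψ = (fA φ ≈S fA ψ) × (fB φ ≈S fB ψ)

  Opposite : Flag → Flag → Set
  Opposite φ ψ = Disjoint (fA φ) (fB ψ) × Disjoint (fA ψ) (fB φ)

  -- a finite set of flags, represented by a list without repetitions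
  -- (up to equality of flags); its cardinality is the length.
  _∈F_ : Flag → List Flag → Set
  φ ∈F L = Any (FlagEq φ) L

  NoDup : List Flag → Set
  NoDup L = ∀ i j → FlagEq (lookup L i) (lookup L j) → i ≡ j

  Coclique : List Flag → Set
  Coclique L = NoDup L × (∀ φ ψ → φ ∈ L → ψ ∈ L → ¬ Opposite φ ψ)

  MaximalCoclique : List Flag → Set
  MaximalCoclique L =
    Coclique L × (∀ φ → (∀ ψ → ψ ∈ L → ¬ Opposite φ ψ) → φ ∈F L)

  IsSetOf : List Flag → (Flag → Set) → Set
  IsSetOf L P = ∀ φ → ((φ ∈F L → P φ) × (P φ → φ ∈F L))

  ContainsAll : List Flag → (Flag → Set) → Set
  ContainsAll L P = ∀ φ → P φ → φ ∈F L

  StructA1 : List Flag → Set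
  StructA1 L = Σ Hyperplane λ H →
      (Σ Point λ X → (X ⊆S H) ×
         IsSetOf L (λ φ → (fB φ ⊆S H) ⊎ ((fA φ ⊆S H) × Incident X (fA φ))))
    ⊎ (Σ Space2n-2 λ X → (X ⊆S H) ×
         IsSetOf L (λ φ → (fB φ ⊆S H) ⊎ ((fA φ ⊆S H) × Incident X (fA φ))))

  StructA2 : List Flag → Set
  StructA2 L = Σ Point λ P →
      (Σ Hyperplane λ X → (P ⊆S X) ×
         IsSetOf L (λ φ → (P ⊆S fA φ) ⊎ (Incident X (fB φ) × (P ⊆S fB φ))))
    ⊎ (Σ Line λ X → (P ⊆S X) ×
         IsSetOf L (λ φ → (P ⊆S fA φ) ⊎ (Incident X (fB φ) × (P ⊆S fB φ))))

  CatA : List Flag → Set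
  CatA L = (length L ≡ gauss q (2 * n) (n ∸ 1) * gauss q (n + 1) 1
                       + gauss q (2 * n ∸ 1) (n ∸ 1) * q ^ n)
           × (StructA1 L ⊎ StructA2 L)

  CatB : List Flag → Set
  CatB L = (length L ≤ gauss q (2 * n) (n ∸ 1) * gauss q (n + 1) 1
                       + fnq n q * q ^ n)
           × ((Σ Hyperplane λ H → ContainsAll L (λ φ → fB φ ⊆S H))
              ⊎ (Σ Point λ P → ContainsAll L (λ φ → P ⊆S fA φ)))

  CatC : ℕ → List Flag → Set
  CatC C L = length L ≤ C * q ^ (n * n + n ∸ 2)

ExactlyOne : Set → Set → Set → Set
ExactlyOne X Y Z = (X × ¬ Y × ¬ Z) ⊎ (¬ X × Y × ¬ Z) ⊎ (¬ X × ¬ Y × Z)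

{-# OPTIONS --safe #-}
-- Both parts of the argument take place in a finite modular lattice with the numerical regularity
-- of PG(d,q), where the hyperplane case is the dual of the point case.
--
-- Branching: a state records what is known about a member (A , B) of the coclique F, namely a
-- subspace U ≤ A and possibly a point P of B outside A.  A member (A₀ , B₀) not meeting the state
-- forces a point of B₀ or of A₀ (of P + A₀ when P is known) into A or B, and each such step
-- gains a factor q against the trivial count, so n + 2 steps bring F down to O(q^(n²+n-2)).
-- The process stops early only at states met by all of F.  If many children of one state are such
-- covers, then every member missing the state has A in one hyperplane; members with A ≤ H, B ≰ H
-- are few, because the A's form an intersecting family in a space of rank 2n.  Hence a large F is,
-- up to few exceptions, concentrated on {P ∈ A} or on {B ≤ H}, and by maximality contains that set.
-- The remaining members through P are governed by an intersecting family of n-spaces in V/P, of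
-- rank 2n, which is a point pencil, lies in a hyperplane, or obeys a Hilton–Milner type bound.
module Submission where

open import Defs
open import Algebra.Structures using (IsCommutativeRing)
open import Data.Bool using (Bool; true; false)
open import Data.Bool.Properties using (T-irrelevant)
open import Data.Empty using (⊥-elim) renaming (⊥ to Empty)
open import Data.Fin using (Fin; zero; suc)
open import Data.List using (List; []; _∷_; _++_; length)
open import Data.List.Membership.Propositional using (_∈_; find; lose)
open import Data.List.Relation.Unary.Any as Any using (Any; here; there)
open import Data.Nat hiding (_≟_; _≤?_; _⊔_; _⊓_)
open import Data.Nat.Properties
  hiding (_≟_; _≤?_; ≤-irrelevant; _<?_; ⊓-glb; ⊔-lub; ⊔-mono-≤)
open import Data.Nat.Tactic.RingSolver using (solve-∀)
open import Data.Product using (Σ; _×_; _,_; proj₁; proj₂)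
open import Data.Sum using (_⊎_; inj₁; inj₂; [_,_])
open import Data.Vec using (Vec; []; _∷_)
open import Function using (_∘_; case_of_)
open import Relation.Binary.PropositionalEquality
  using (_≡_; _≢_; refl; sym; trans; cong; cong₂; subst; subst₂; module ≡-Reasoning)
open import Relation.Nullary using (¬_; Dec; yes; no; does)
open import Relation.Nullary.Decidable using (True; toWitness; fromWitness; T?)
import Data.Bool
import Data.Fin
import Data.Fin.Properties
import Data.List
import Data.Nat
import Data.Nat.DivMod
import Data.Vec
import Data.Vec.Properties
import Relation.Nullary.Decidable

-- The delicate point is the last factor q. Let K be the least rank of a subspace W that almost all
-- A's meet. A point can be extended through K - 1 steps, each gaining q, before rank K is reached;
-- but W has about q^(K-1) points, and summing over them down to q^(n²+n-2) takes a gain of q^K at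
-- each. The missing factor comes from the final step. By minimality of K, a state below rank K is
-- missed not just by one member but by too many to fit into a set known to be small, so one of them
-- can be chosen outside a prescribed subspace. This second member lets all but O(1/q) of the
-- children gain once more. For this reason covers are taken up to O(q^(n²+n-2)) exceptional
-- members. The choice can fail only for a hyperplane, and that failure is what produces the
-- hyperplane case.
--
-- The planes of PG(5,q) are treated separately because f(3,q) is the exact Hilton-Milner number,
-- with leading term q^5, whereas the asymptotic bound has leading term 2q^5.

instance
  dec-× : {A B : Set} {{_ : Dec A}} {{_ : Dec B}} → Dec (A × B)
  dec-× {{yes a}} {{yes b}} = yes (a , b)
  dec-× {{yes a}} {{no ¬b}} = no λ p → ¬b (proj₂ p)
  dec-× {{no ¬a}} = no λ p → ¬a (proj₁ p)

  dec-⊎ : {A B : Set} {{_ : Dec A}} {{_ : Dec B}} → Dec (A ⊎ B)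
  dec-⊎ {{yes a}} = yes (inj₁ a)
  dec-⊎ {{no ¬a}} {{yes b}} = yes (inj₂ b)
  dec-⊎ {{no ¬a}} {{no ¬b}} = no λ { (inj₁ a) → ¬a a ; (inj₂ b) → ¬b b }

  dec-¬ : {A : Set} {{_ : Dec A}} → Dec (¬ A)
  dec-¬ {{yes a}} = no λ f → f a
  dec-¬ {{no ¬a}} = yes ¬a

  dec-ℕ≡ : {m n : ℕ} → Dec (m ≡ n)
  dec-ℕ≡ {m} {n} = Data.Nat._≟_ m n

  dec-ℕ≤ : {m n : ℕ} → Dec (m ≤ n)
  dec-ℕ≤ {m} {n} = Data.Nat._≤?_ m n

decide : (A : Set) {{_ : Dec A}} → A ⊎ ¬ A
decide A {{yes a}} = inj₁ a
decide A {{no ¬a}} = inj₂ ¬a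

stable : {A : Set} {{_ : Dec A}} → ¬ ¬ A → A
stable {{yes a}} _ = a
stable {{no ¬a}} f = ⊥-elim (f ¬a)

ind : {A : Set} → Dec A → ℕ
ind (yes _) = 1
ind (no _)  = 0

ind-mono : {A B : Set} (a : Dec A) (b : Dec B) → (A → B) → ind a ≤ ind b
ind-mono (yes a) (yes b) f = ≤-refl
ind-mono (yes a) (no ¬b) f = ⊥-elim (¬b (f a))
ind-mono (no ¬a) b f = z≤n

ind-yes : {A : Set} (a : Dec A) → A → ind a ≡ 1
ind-yes (yes _) _ = refl
ind-yes (no ¬a) a = ⊥-elim (¬a a)

ind-no : {A : Set} (a : Dec A) → ¬ A → ind a ≡ 0
ind-no (yes a) ¬a = ⊥-elim (¬a a)
ind-no (no _)  _ = refl

ind-* : {A B C : Set} (a : Dec A) (b : Dec B) (c : Dec C) →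
  (A × B → C) → (C → A × B) → ind c ≡ ind a * ind b
ind-* (yes a) (yes b) c f g = ind-yes c (f (a , b))
ind-* (yes a) (no ¬b) c f g = ind-no c λ x → ¬b (proj₂ (g x))
ind-* (no ¬a) b c f g = ind-no c λ x → ¬a (proj₁ (g x))

-- Finite types, sums and counting.

sumL : {Y : Set} → List Y → (Y → ℕ) → ℕ
sumL [] f = 0
sumL (y ∷ ys) f = f y + sumL ys f

module _ {Y : Set} where
  sumL-cong : (ys : List Y) {f g : Y → ℕ} → (∀ y → f y ≡ g y) → sumL ys f ≡ sumL ys g
  sumL-cong [] e = refl
  sumL-cong (y ∷ ys) e = cong₂ _+_ (e y) (sumL-cong ys e)

  sumL-mono : (ys : List Y) {f g : Y → ℕ} → (∀ y → f y ≤ g y) → sumL ys f ≤ sumL ys g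
  sumL-mono [] e = z≤n
  sumL-mono (y ∷ ys) e = +-mono-≤ (e y) (sumL-mono ys e)

  sumL-+ : (ys : List Y) (f g : Y → ℕ) → sumL ys (λ y → f y + g y) ≡ sumL ys f + sumL ys g
  sumL-+ [] f g = refl
  sumL-+ (y ∷ ys) f g rewrite sumL-+ ys f g = lem (f y) (g y) (sumL ys f) (sumL ys g)
    where lem : ∀ a b c d → a + b + (c + d) ≡ a + c + (b + d)
          lem = solve-∀

  sumL-* : (ys : List Y) (f : Y → ℕ) (c : ℕ) → sumL ys (λ y → f y * c) ≡ sumL ys f * c
  sumL-* [] f c = refl
  sumL-* (y ∷ ys) f c rewrite sumL-* ys f c = sym (*-distribʳ-+ c (f y) (sumL ys f))

  sumL-0 : (ys : List Y) → sumL ys (λ _ → 0) ≡ 0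
  sumL-0 [] = refl
  sumL-0 (y ∷ ys) = sumL-0 ys

  sumL-++ : (xs ys : List Y) (f : Y → ℕ) → sumL (xs ++ ys) f ≡ sumL xs f + sumL ys f
  sumL-++ [] ys f = refl
  sumL-++ (x ∷ xs) ys f rewrite sumL-++ xs ys f = sym (+-assoc (f x) (sumL xs f) (sumL ys f))

sumL-map : {Y Z : Set} (g : Y → Z) (ys : List Y) (f : Z → ℕ) →
  sumL (Data.List.map g ys) f ≡ sumL ys (f ∘ g)
sumL-map g [] f = refl
sumL-map g (y ∷ ys) f = cong (f (g y) +_) (sumL-map g ys f)

sumL-swap : {Y Z : Set} (ys : List Y) (zs : List Z) (f : Y → Z → ℕ) →
  sumL ys (λ y → sumL zs (f y)) ≡ sumL zs (λ z → sumL ys (λ y → f y z))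
sumL-swap [] zs f = sym (sumL-0 zs)
sumL-swap (y ∷ ys) zs f rewrite sumL-swap ys zs f =
  sym (sumL-+ zs (f y) (λ z → sumL ys (λ y → f y z)))

-- `once` says that the list of elements is complete and free of repetitions.
record Finite (Y : Set) : Set where
  field
    elems : List Y
    _≟_   : (x y : Y) → Dec (x ≡ y)
    once  : ∀ y → sumL elems (λ x → ind (x ≟ y)) ≡ 1

open Finite {{...}} public

∑ : {Y : Set} {{_ : Finite Y}} → (Y → ℕ) → ℕ
∑ f = sumL elems f

-- Opaque, so that the predicate can be inferred from a cardinality.
opaque
  count : {Y : Set} {{_ : Finite Y}} (P : Y → Set) {{P? : ∀ {y} → Dec (P y)}} → ℕ
  count P {{P?}} = ∑ (λ y → ind (P? {y}))

module _ {Y : Set} {{fy : Finite Y}} where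

  ∑-pick : (f : Y → ℕ) (y₀ : Y) → ∑ (λ y → ind (y ≟ y₀) * f y) ≡ f y₀
  ∑-pick f y₀ = trans (sumL-cong elems h)
      (trans (sumL-* elems (λ y → ind (y ≟ y₀)) (f y₀))
        (trans (cong (_* f y₀) (once y₀)) (*-identityˡ (f y₀))))
    where
      h : ∀ y → ind (y ≟ y₀) * f y ≡ ind (y ≟ y₀) * f y₀
      h y with y ≟ y₀
      ... | yes refl = refl
      ... | no _ = refl

  ∑-single : (f : Y → ℕ) (y₀ : Y) → f y₀ ≤ ∑ f
  ∑-single f y₀ = ≤-trans (≤-reflexive (sym (∑-pick f y₀))) (sumL-mono elems h)
    where
      h : ∀ y → ind (y ≟ y₀) * f y ≤ f y
      h y with y ≟ y₀
      ... | yes _ = ≤-reflexive (+-identityʳ (f y))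
      ... | no _ = z≤n

  module _ {P : Y → Set} {{P? : ∀ {y} → Dec (P y)}} where

    opaque
      unfolding count

      count-pos : ∀ y → P y → 1 ≤ count P
      count-pos y p = ≤-trans (≤-reflexive (sym (ind-yes P? p))) (∑-single (λ y → ind (P? {y})) y)

    opaque
      unfolding count

      count-none : (∀ y → ¬ P y) → count P ≡ 0
      count-none h = trans (sumL-cong elems λ y → ind-no P? (h y)) (sumL-0 elems)

    opaque
      unfolding count

      findL : (ys : List Y) → 1 ≤ sumL ys (λ y → ind (P? {y})) → Σ Y P
      findL (y ∷ ys) h with P? {y}
      ... | yes p = y , p
      ... | no _ = findL ys h

    opaque
      unfolding count

      count-find : 1 ≤ count P → Σ Y P
      count-find = findL elems

    opaque
      unfolding count

      count-all : (∀ y → P y) → count P ≡ ∑ {{fy}} (λ _ → 1)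
      count-all h = sumL-cong elems λ y → ind-yes P? (h y)

  search : (P : Y → Set) {{P? : ∀ {y} → Dec (P y)}} → (Σ Y P) ⊎ (∀ y → ¬ P y)
  search P with decide (1 ≤ count P)
  ... | inj₁ h = inj₁ (count-find h)
  ... | inj₂ h = inj₂ λ y p → h (count-pos y p)

  forall? : (P : Y → Set) {{P? : ∀ {y} → Dec (P y)}} → (∀ y → P y) ⊎ (Σ Y λ y → ¬ P y)
  forall? P with search (λ y → ¬ P y)
  ... | inj₁ x = inj₂ x
  ... | inj₂ f = inj₁ λ y → stable (f y)

  dec-∃ : {P : Y → Set} {{P? : ∀ {y} → Dec (P y)}} → Dec (Σ Y P)
  dec-∃ {P} with search P
  ... | inj₁ x = yes x
  ... | inj₂ f = no λ { (y , p) → f y p }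

  dec-∀ : {P : Y → Set} {{P? : ∀ {y} → Dec (P y)}} → Dec (∀ y → P y)
  dec-∀ {P} with forall? P
  ... | inj₁ x = yes x
  ... | inj₂ (y , n) = no λ f → n (f y)

  module _ {P Q : Y → Set} {{P? : ∀ {y} → Dec (P y)}} {{Q? : ∀ {y} → Dec (Q y)}} where

    opaque
      unfolding count

      count-mono : (∀ y → P y → Q y) → count P ≤ count Q
      count-mono h = sumL-mono elems λ y → ind-mono P? Q? (h y)

    opaque
      unfolding count

      count-cong : (∀ y → P y → Q y) → (∀ y → Q y → P y) → count P ≡ count Q
      count-cong h k = ≤-antisym (count-mono h) (sumL-mono elems λ y → ind-mono Q? P? (k y))

    opaque
      unfolding count

      count-∪ : {R : Y → Set} {{R? : ∀ {y} → Dec (R y)}} →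
        (∀ y → R y → P y ⊎ Q y) → count R ≤ count P + count Q
      count-∪ {{R?}} h = ≤-trans (sumL-mono elems e) (≤-reflexive (sumL-+ elems _ _))
        where
          e : ∀ y → ind (R? {y}) ≤ ind (P? {y}) + ind (Q? {y})
          e y with R? {y}
          ... | no _ = z≤n
          ... | yes r with h y r
          ... | inj₁ p = ≤-trans (≤-reflexive (sym (ind-yes P? p))) (m≤m+n _ _)
          ... | inj₂ p = ≤-trans (≤-reflexive (sym (ind-yes Q? p))) (m≤n+m _ _)

    opaque
      unfolding count

      count-⊎ : {R : Y → Set} {{R? : ∀ {y} → Dec (R y)}} →
        (∀ y → R y → P y ⊎ Q y) → (∀ y → P y → R y) → (∀ y → Q y → R y) →
        (∀ y → P y → ¬ Q y) → count R ≡ count P + count Q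
      count-⊎ {{R?}} h f g n = trans (sumL-cong elems e) (sumL-+ elems _ _)
        where
          e : ∀ y → ind (R? {y}) ≡ ind (P? {y}) + ind (Q? {y})
          e y with P? {y} | Q? {y}
          ... | yes p | yes q = ⊥-elim (n y p q)
          ... | yes p | no _ = ind-yes R? (f y p)
          ... | no _ | yes q = ind-yes R? (g y q)
          ... | no p | no q = ind-no R? λ r → [ p , q ] (h y r)

module _ {Y Z : Set} {{fy : Finite Y}} {{fz : Finite Z}} where

  module _ {P : Y → Set} {{P? : ∀ {y} → Dec (P y)}} {D : Z → Set} {{D? : ∀ {z} → Dec (D z)}}
           {Q : Z → Y → Set} {{Q? : ∀ {z y} → Dec (Q z y)}} where

    opaque
      unfolding count

      branch-∑ : (∀ y → P y → Σ Z λ z → D z × Q z y) →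
        count P ≤ ∑ (λ z → ind (D? {z}) * count (Q z))
      branch-∑ h = ≤-trans (sumL-mono elems e)
          (≤-reflexive (trans (sumL-swap (elems {Y}) (elems {Z}) _)
            (sumL-cong (elems {Z}) λ z → trans (sumL-cong (elems {Y}) λ y → *-comm (ind (D? {z})) (ind (Q? {z} {y})))
              (trans (sumL-* (elems {Y}) (λ y → ind (Q? {z} {y})) (ind (D? {z}))) (*-comm _ (ind (D? {z})))))))
        where
          e : ∀ y → ind (P? {y}) ≤ ∑ (λ z → ind (D? {z}) * ind (Q? {z} {y}))
          e y with P? {y}
          ... | no _ = z≤n
          ... | yes p with h y p
          ... | z , d , q = ≤-trans (≤-reflexive (sym (cong₂ _*_ (ind-yes D? d) (ind-yes Q? q))))
                  (∑-single (λ z → ind (D? {z}) * ind (Q? {z} {y})) z)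

    opaque
      unfolding count

      -- Union bound over the children z of a branching step. The factor `a` keeps the bounds free
      -- of division: it carries the powers of q and p gained further down.
      branch : (∀ y → P y → Σ Z λ z → D z × Q z y) → (a b : ℕ) →
        (∀ z → D z → count (Q z) * a ≤ b) → count P * a ≤ count D * b
      branch h a b k = ≤-trans (*-monoˡ-≤ a (branch-∑ h))
        (≤-trans (≤-reflexive (sym (sumL-* (elems {Z}) _ a)))
          (≤-trans (sumL-mono (elems {Z}) e) (≤-reflexive (sumL-* (elems {Z}) (λ z → ind (D? {z})) b))))
        where
          e : ∀ z → ind (D? {z}) * count (Q z) * a ≤ ind (D? {z}) * b
          e z with D? {z}
          ... | no _ = z≤n
          ... | yes d rewrite +-identityʳ (count (Q z)) | +-identityʳ b = k z d

  module _ {P : Y → Set} {{P? : ∀ {y} → Dec (P y)}} {Q : Z → Set} {{Q? : ∀ {z} → Dec (Q z)}}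
           {R : Y → Z → Set} {{R? : ∀ {y z} → Dec (R y z)}} where

    -- Both sides count the pairs (y , z) in R.
    opaque
      unfolding count

      double-count : (a b : ℕ) → (∀ y z → R y z → P y × Q z) →
        (∀ y → P y → count (λ z → R y z) ≡ a) → (∀ z → Q z → count (λ y → R y z) ≡ b) →
        count P * a ≡ count Q * b
      double-count a b pq f g = trans (sym (trans (sumL-cong (elems {Y}) ey) (sumL-* (elems {Y}) (λ y → ind (P? {y})) a)))
          (trans (sumL-swap (elems {Y}) (elems {Z}) _) (trans (sumL-cong (elems {Z}) ez) (sumL-* (elems {Z}) (λ z → ind (Q? {z})) b)))
        where
          ey : ∀ y → ∑ (λ z → ind (R? {y} {z})) ≡ ind (P? {y}) * a
          ey y with P? {y}
          ... | yes p = trans (f y p) (sym (+-identityʳ a))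
          ... | no p = count-none λ z r → p (proj₁ (pq y z r))
          ez : ∀ z → ∑ (λ y → ind (R? {y} {z})) ≡ ind (Q? {z}) * b
          ez z with Q? {z}
          ... | yes p = trans (g z p) (sym (+-identityʳ b))
          ... | no p = count-none λ y r → p (proj₂ (pq y z r))

opaque
  unfolding count

  count-≡ : {Y : Set} {{_ : Finite Y}} (y₀ : Y) → count (λ y → y ≡ y₀) {{λ {y} → y ≟ y₀}} ≡ 1
  count-≡ y₀ = once y₀

module _ {Y Z : Set} {{fy : Finite Y}} {{fz : Finite Z}}
         {P : Y → Set} {{P? : ∀ {y} → Dec (P y)}} {Q : Z → Set} {{Q? : ∀ {z} → Dec (Q z)}} where

  count-bij : (f : Y → Z) (g : Z → Y) → (∀ y → P y → Q (f y)) → (∀ z → Q z → P (g z)) →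
    (∀ y → P y → g (f y) ≡ y) → (∀ z → Q z → f (g z) ≡ z) → count P ≡ count Q
  count-bij f g pf qg gf fg = trans (sym (*-identityʳ _)) (trans
      (double-count {R = λ y z → P y × (f y ≡ z)} {{eqR}} 1 1 (λ y z r → proj₁ r , subst Q (proj₂ r) (pf y (proj₁ r))) ey ez)
      (*-identityʳ _))
    where
      instance
        eqY : {x y : Y} → Dec (x ≡ y)
        eqY {x} {y} = x ≟ y
        eqZ : {x y : Z} → Dec (x ≡ y)
        eqZ {x} {y} = x ≟ y
      eqR : ∀ {y z} → Dec (P y × (f y ≡ z))
      eqR = dec-×
      ey : ∀ y → P y → count (λ z → P y × (f y ≡ z)) ≡ 1
      ey y p = trans (count-cong {P = λ z → P y × (f y ≡ z)} {Q = λ z → z ≡ f y}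
                       (λ z r → sym (proj₂ r)) (λ z e → p , sym e)) (count-≡ (f y))
      ez : ∀ z → Q z → count (λ y → P y × (f y ≡ z)) ≡ 1
      ez z q = trans (count-cong {P = λ y → P y × (f y ≡ z)} {Q = λ y → y ≡ g z}
                       (λ y r → trans (sym (gf y (proj₁ r))) (cong g (proj₂ r)))
                       (λ { y refl → qg z q , fg z q })) (count-≡ (g z))

  count-inj : (f : Y → Z) → (∀ y → P y → Q (f y)) →
    (∀ y y′ → P y → P y′ → f y ≡ f y′ → y ≡ y′) → count P ≤ count Q
  count-inj f pf inj = ≤-trans (≤-reflexive (sym (*-identityʳ _)))
      (≤-trans (branch {D = Q} {Q = λ z y → P y × (f y ≡ z)}
          {{λ {z} {y} → dec-× {{P?}} {{f y ≟ z}}}}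
          (λ y p → f y , pf y p , p , refl) 1 1 ez) (≤-reflexive (*-identityʳ _)))
    where
      instance
        eqY : {x y : Y} → Dec (x ≡ y)
        eqY {x} {y} = x ≟ y
        eqZ : {x y : Z} → Dec (x ≡ y)
        eqZ {x} {y} = x ≟ y
      ez : ∀ z → Q z → count (λ y → P y × (f y ≡ z)) * 1 ≤ 1
      ez z _ with search (λ y → P y × (f y ≡ z))
      ... | inj₂ h = ≤-trans (≤-reflexive (cong (_* 1)
                (count-none {P = λ y → P y × (f y ≡ z)} h))) z≤n
      ... | inj₁ (y₀ , p₀ , e₀) = ≤-trans (≤-reflexive (*-identityʳ _)) (≤-trans
              (count-mono {P = λ y → P y × (f y ≡ z)} {Q = λ y → y ≡ y₀}
                (λ y r → inj y y₀ (proj₁ r) p₀ (trans (proj₂ r) (sym e₀))))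
              (≤-reflexive (count-≡ y₀)))

transport-Finite : {Y Z : Set} → Finite Y → (f : Y → Z) (g : Z → Y) →
  (∀ y → g (f y) ≡ y) → (∀ z → f (g z) ≡ z) → Finite Z
transport-Finite {Y} {Z} fy f g gf fg = record
  { elems = Data.List.map f (Finite.elems fy)
  ; _≟_ = eq
  ; once = λ z → trans (sumL-map f (Finite.elems fy) _)
             (trans (sumL-cong (Finite.elems fy) (h z)) (Finite.once fy (g z))) }
  where
    eq : (x y : Z) → Dec (x ≡ y)
    eq x y with Finite._≟_ fy (g x) (g y)
    ... | yes e = yes (trans (sym (fg x)) (trans (cong f e) (fg y)))
    ... | no n = no λ e → n (cong g e)
    h : ∀ z y → ind (eq (f y) z) ≡ ind (Finite._≟_ fy y (g z))
    h z y = ≤-antisym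
      (ind-mono (eq (f y) z) (Finite._≟_ fy y (g z)) λ e → trans (sym (gf y)) (cong g e))
      (ind-mono (Finite._≟_ fy y (g z)) (eq (f y) z) λ e → trans (cong f e) (fg z))

pairs : {Y Z : Set} → List Y → List Z → List (Y × Z)
pairs [] zs = []
pairs (y ∷ ys) zs = Data.List.map (y ,_) zs ++ pairs ys zs

sumL-pairs : {Y Z : Set} (ys : List Y) (zs : List Z) (f : Y × Z → ℕ) →
  sumL (pairs ys zs) f ≡ sumL ys (λ y → sumL zs (λ z → f (y , z)))
sumL-pairs [] zs f = refl
sumL-pairs (y ∷ ys) zs f = trans (sumL-++ (Data.List.map (y ,_) zs) (pairs ys zs) f)
  (cong₂ _+_ (sumL-map (y ,_) zs f) (sumL-pairs ys zs f))

instance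
  Finite-× : {Y Z : Set} {{_ : Finite Y}} {{_ : Finite Z}} → Finite (Y × Z)
  Finite-× {Y} {Z} = record
    { elems = pairs elems elems
    ; _≟_ = eq
    ; once = λ { (y₀ , z₀) → trans (sumL-pairs (elems {Y}) (elems {Z}) _)
        (trans (sumL-cong (elems {Y}) λ y → trans (sumL-cong (elems {Z}) λ z →
            trans (ind-* (y ≟ y₀) (z ≟ z₀) (eq (y , z) (y₀ , z₀)) (λ { (refl , refl) → refl }) (λ { refl → refl , refl }))
              (*-comm (ind (y ≟ y₀)) (ind (z ≟ z₀))))
            (trans (sumL-* (elems {Z}) (λ z → ind (z ≟ z₀)) (ind (y ≟ y₀)))
              (trans (cong (_* ind (y ≟ y₀)) (once z₀)) (*-identityˡ _))))
          (once y₀)) } }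
    where
      eq : (x y : Y × Z) → Dec (x ≡ y)
      eq (a , b) (c , d) with a ≟ c | b ≟ d
      ... | yes refl | yes refl = yes refl
      ... | no n | _ = no λ { refl → n refl }
      ... | yes _ | no n = no λ { refl → n refl }

Finite-Fin : ∀ n → Finite (Fin n)
Finite-Fin n = record { elems = els n ; _≟_ = Data.Fin._≟_ ; once = on n }
  where
    els : ∀ n → List (Fin n)
    els zero = []
    els (suc n) = zero ∷ Data.List.map suc (els n)
    on : ∀ n (y : Fin n) → sumL (els n) (λ x → ind (x Data.Fin.≟ y)) ≡ 1
    on (suc n) zero = cong suc (trans (sumL-map suc (els n) _)
      (trans (sumL-cong (els n) λ y → ind-no (suc y Data.Fin.≟ zero) λ ()) (sumL-0 (els n))))
    on (suc n) (suc y) = trans (sumL-map suc (els n) _)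
      (trans (sumL-cong (els n) λ x → ≤-antisym
          (ind-mono (suc x Data.Fin.≟ suc y) (x Data.Fin.≟ y) λ { refl → refl })
          (ind-mono (x Data.Fin.≟ y) (suc x Data.Fin.≟ suc y) (cong suc)))
        (on n y))

Finite-Bool : Finite Bool
Finite-Bool = transport-Finite (Finite-Fin 2)
  (λ { zero → true ; (suc zero) → false }) (λ { true → zero ; false → suc zero })
  (λ { zero → refl ; (suc zero) → refl }) (λ { true → refl ; false → refl })

instance
  Finite-Vec : {Y : Set} {n : ℕ} {{_ : Finite Y}} → Finite (Vec Y n)
  Finite-Vec {n = zero} = transport-Finite (Finite-Fin 1) (λ _ → []) (λ _ → zero)
    (λ { zero → refl }) (λ { [] → refl })
  Finite-Vec {Y} {n = suc n} {{fy}} = transport-Finite (Finite-× {Y} {Vec Y n} {{fy}} {{Finite-Vec}})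
    (λ { (y , v) → y ∷ v }) (λ { (y ∷ v) → y , v }) (λ { (y , v) → refl }) (λ { (y ∷ v) → refl })

module _ {Y : Set} (fy : Finite Y) (P : Y → Set) (P? : ∀ y → Dec (P y))
         (irr : ∀ {y} (p p′ : P y) → p ≡ p′) where
  private
    sub1 : (y : Y) → Dec (P y) → List (Σ Y P)
    sub1 y (yes p) = (y , p) ∷ []
    sub1 y (no _) = []

    subs : List Y → List (Σ Y P)
    subs [] = []
    subs (y ∷ ys) = sub1 y (P? y) ++ subs ys

    lift-f : (Σ Y P → ℕ) → (y : Y) → Dec (P y) → ℕ
    lift-f f y (yes p) = f (y , p)
    lift-f f y (no _) = 0

    sum-subs : ∀ ys f → sumL (subs ys) f ≡ sumL ys (λ y → lift-f f y (P? y))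
    sum-subs [] f = refl
    sum-subs (y ∷ ys) f = trans (sumL-++ (sub1 y (P? y)) (subs ys) f)
        (cong₂ _+_ (h (P? y)) (sum-subs ys f))
      where
        h : ∀ d → sumL (sub1 y d) f ≡ lift-f f y d
        h (yes p) = +-identityʳ _
        h (no _) = refl

    eq : (x y : Σ Y P) → Dec (x ≡ y)
    eq (x , p) (y , r) with Finite._≟_ fy x y
    ... | yes refl = yes (cong (x ,_) (irr p r))
    ... | no n = no λ e → n (cong proj₁ e)

  Finite-Σ : Finite (Σ Y P)
  Finite-Σ = record
    { elems = subs (Finite.elems fy)
    ; _≟_ = eq
    ; once = λ { (y₀ , p₀) → trans (sum-subs (Finite.elems fy) _)
        (trans (sumL-cong (Finite.elems fy) (h y₀ p₀)) (Finite.once fy y₀)) } }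
    where
      h : ∀ y₀ p₀ y → lift-f (λ x → ind (eq x (y₀ , p₀))) y (P? y) ≡ ind (Finite._≟_ fy y y₀)
      h y₀ p₀ y with P? y
      ... | no n = sym (ind-no (Finite._≟_ fy y y₀) λ { refl → n p₀ })
      ... | yes p = ≤-antisym
        (ind-mono (eq (y , p) (y₀ , p₀)) (Finite._≟_ fy y y₀) (cong proj₁))
        (ind-mono (Finite._≟_ fy y y₀) (eq (y , p) (y₀ , p₀)) λ { refl → cong (y ,_) (irr p p₀) })

  opaque
    unfolding count

    count-Σ : {Q : Y → Set} {{Q? : ∀ {y} → Dec (Q y)}} {R : Σ Y P → Set} {{R? : ∀ {y} → Dec (R y)}} →
      (∀ y p → R (y , p) → Q y) → (∀ y → Q y → Σ (P y) λ p → R (y , p)) →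
      count {{Finite-Σ}} R ≡ count {{fy}} Q
    count-Σ {Q} {{Q?}} {R} {{R?}} f g = trans (sum-subs (Finite.elems fy) _) (sumL-cong (Finite.elems fy) h)
      where
        h : ∀ y → lift-f (λ x → ind (R? {x})) y (P? y) ≡ ind (Q? {y})
        h y with P? y
        ... | yes p = ≤-antisym (ind-mono R? Q? (f y p))
                (ind-mono Q? R? λ x → subst (λ z → R (y , z)) (irr _ p) (proj₂ (g y x)))
        ... | no n = sym (ind-no Q? λ x → n (proj₁ (g y x)))

module _ {Y Z W : Set} {{fy : Finite Y}} {{fz : Finite Z}} {{fw : Finite W}}
         {P : Y → Set} {{P? : ∀ {y} → Dec (P y)}}
         {D : Z → Set} {{D? : ∀ {z} → Dec (D z)}} {Q : Z → Y → Set} {{Q? : ∀ {z y} → Dec (Q z y)}}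
         {E : W → Set} {{E? : ∀ {z} → Dec (E z)}} {R : W → Y → Set} {{R? : ∀ {z y} → Dec (R z y)}} where

  branch₂ : (∀ y → P y → (Σ Z λ z → D z × Q z y) ⊎ (Σ W λ w → E w × R w y)) → (a b c : ℕ) →
    (∀ z → D z → count (Q z) * a ≤ b) → (∀ w → E w → count (R w) * a ≤ c) →
    count P * a ≤ count D * b + count E * c
  branch₂ h a b c f g = ≤-trans
      (*-monoˡ-≤ a (count-∪ {P = λ y → Σ Z λ z → D z × Q z y} {Q = λ y → Σ W λ w → E w × R w y} h))
      (≤-trans (≤-reflexive (*-distribʳ-+ a (count λ y → Σ Z λ z → D z × Q z y) _))
        (+-mono-≤ (branch {Q = Q} (λ y x → x) a b f) (branch {Q = R} (λ y x → x) a c g)))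
    where
      instance
        i₁ : ∀ {y} → Dec (Σ Z λ z → D z × Q z y)
        i₁ = dec-∃
        i₂ : ∀ {y} → Dec (Σ W λ w → E w × R w y)
        i₂ = dec-∃

module _ {Y Z : Set} {{fy : Finite Y}} {{fz : Finite Z}}
         {P : Y → Set} {{P? : ∀ {y} → Dec (P y)}} {D : Z → Set} {{D? : ∀ {z} → Dec (D z)}}
         {Q : Z → Y → Set} {{Q? : ∀ {z y} → Dec (Q z y)}} where

  cover-≤ : ∀ {a b} → (∀ y → P y → Σ Z λ z → D z × Q z y) → count D ≤ a →
    (∀ z → D z → count (Q z) ≤ b) → count P ≤ a * b
  cover-≤ {a} {b} h d k = ≤-trans (≤-reflexive (sym (*-identityʳ _)))
    (≤-trans (branch {D = D} {Q = Q} h 1 b (λ z w → ≤-trans (≤-reflexive (*-identityʳ _)) (k z w)))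
      (*-monoˡ-≤ b d))

count-≤1 : {Y : Set} {{_ : Finite Y}} {P : Y → Set} {{P? : ∀ {y} → Dec (P y)}} (y₀ : Y) →
  (∀ y → P y → y ≡ y₀) → count P ≤ 1
count-≤1 y₀ h = ≤-trans (count-mono {{_}} {{_}} {{λ {y} → y ≟ y₀}} h) (≤-reflexive (count-≡ y₀))

-- The q-integers 1 + q + ... + q^(k-1) and the abstract projective lattice.

br : ℕ → ℕ → ℕ
br q zero = 0
br q (suc k) = br q k + q ^ k

br-pred : ∀ p k → br (suc p) k * p + 1 ≡ suc p ^ k
br-pred p zero = refl
br-pred p (suc k) = trans (lem (br (suc p) k) (suc p ^ k) p)
    (cong (_+ p * suc p ^ k) (br-pred p k))
  where lem : ∀ a b p → (a + b) * p + 1 ≡ (a * p + 1) + p * b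
        lem = solve-∀

br-≤ : ∀ p k → br (suc p) k * p ≤ suc p ^ k
br-≤ p k = ≤-trans (m≤m+n _ 1) (≤-reflexive (br-pred p k))

br-≥ : ∀ q k → q ^ k ≤ br q (suc k)
br-≥ q k = m≤n+m _ _

br-mono : ∀ q {j k} → j ≤ k → br q j ≤ br q k
br-mono q {k = zero} z≤n = z≤n
br-mono q {j} {suc k} h with m≤n⇒m<n∨m≡n h
... | inj₁ (s≤s h′) = ≤-trans (br-mono q h′) (m≤m+n _ _)
... | inj₂ refl = ≤-refl

-- A finite modular lattice of rank d with the numerical regularity of PG(d-1,q), q = suc p.
record Geom (p d : ℕ) : Set₁ where
  infix 4 _⊑_
  infixr 7 _⊓_
  infixr 6 _⊔_
  field
    X : Set
    {{finite}} : Finite X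
    _⊑_ : X → X → Set
    {{⊑-dec}} : ∀ {x y} → Dec (x ⊑ y)
    ⊑-irr : ∀ {x y} (a b : x ⊑ y) → a ≡ b
    ⊑-refl : ∀ {x} → x ⊑ x
    ⊑-trans : ∀ {x y z} → x ⊑ y → y ⊑ z → x ⊑ z
    ⊑-antisym : ∀ {x y} → x ⊑ y → y ⊑ x → x ≡ y
    _⊓_ _⊔_ : X → X → X
    ⊓ˡ : ∀ {x y} → x ⊓ y ⊑ x
    ⊓ʳ : ∀ {x y} → x ⊓ y ⊑ y
    ⊓-glb : ∀ {x y z} → z ⊑ x → z ⊑ y → z ⊑ x ⊓ y
    ⊔ˡ : ∀ {x y} → x ⊑ x ⊔ y
    ⊔ʳ : ∀ {x y} → y ⊑ x ⊔ y
    ⊔-lub : ∀ {x y z} → x ⊑ z → y ⊑ z → x ⊔ y ⊑ z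
    𝟘 𝟙 : X
    𝟘-min : ∀ {x} → 𝟘 ⊑ x
    𝟙-max : ∀ {x} → x ⊑ 𝟙
    rk : X → ℕ
    rk-𝟘 : rk 𝟘 ≡ 0
    rk-𝟙 : rk 𝟙 ≡ d
    rk-mono : ∀ {x y} → x ⊑ y → rk x ≤ rk y
    rk-eq : ∀ {x y} → x ⊑ y → rk y ≤ rk x → y ⊑ x
    rk-mod : ∀ x y → rk (x ⊔ y) + rk (x ⊓ y) ≡ rk x + rk y
    1≤p : 1 ≤ p
    ups : ∀ {x z} r → x ⊑ z → rk x + r ≡ rk z →
      count (λ y → (x ⊑ y) × (y ⊑ z) × (rk y ≡ suc (rk x))) ≡ br (suc p) r
    dns : ∀ {x z} r → x ⊑ z → rk x + r ≡ rk z →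
      count (λ y → (x ⊑ y) × (y ⊑ z) × (suc (rk y) ≡ rk z)) ≡ br (suc p) r

  instance
    dec-X≡ : {x y : X} → Dec (x ≡ y)
    dec-X≡ {x} {y} = x ≟ y

module _ {p d : ℕ} (G : Geom p d) where
  open Geom G

  rk≤d : ∀ x → rk x ≤ d
  rk≤d x = ≤-trans (rk-mono 𝟙-max) (≤-reflexive rk-𝟙)

  private
    co-suc : ∀ {a b} → a ≤ d → b ≤ d → suc a ≡ b → d ∸ a ≡ suc (d ∸ b)
    co-suc {a} ha hb refl = trans (cong (_∸ a) (sym (m∸n+n≡m hb)))
      (trans (cong (_∸ a) (+-suc (d ∸ suc a) a)) (m+n∸n≡m (suc (d ∸ suc a)) a))

    co-suc⁻¹ : ∀ {a b} → a ≤ d → b ≤ d → d ∸ a ≡ suc (d ∸ b) → suc a ≡ b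
    co-suc⁻¹ {a} {b} ha hb e = sym (trans (sym (m∸[m∸n]≡n hb))
      (trans (cong (d ∸_) (sym (cong pred e))) (trans (sub (d ∸ a) (m∸n≤m d a) e) (cong suc (m∸[m∸n]≡n ha)))))
      where sub : ∀ k → k ≤ d → k ≡ suc (d ∸ b) → d ∸ pred k ≡ suc (d ∸ k)
            sub (suc k) h _ = co-suc (≤-trans (n≤1+n k) h) h refl

    co-diff : ∀ {a b r} → a ≤ d → b ≤ d → d ∸ a + r ≡ d ∸ b → b + r ≡ a
    co-diff {a} {b} {r} ha hb e = +-cancelˡ-≡ (d ∸ a) _ _
      (trans (lem (d ∸ a) b r) (trans (cong (_+ b) e) (trans (m∸n+n≡m hb) (sym (m∸n+n≡m ha)))))
      where lem : ∀ x b r → x + (b + r) ≡ x + r + b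
            lem = solve-∀

  -- Duality is mere reversal of the order. It exchanges `ups` and `dns`, which is why `Geom`
  -- records cover numbers in both directions.
  dual : Geom p d
  dual = record
    { X = X ; _⊑_ = λ x y → y ⊑ x ; ⊑-irr = ⊑-irr ; ⊑-refl = ⊑-refl
    ; ⊑-trans = λ a b → ⊑-trans b a ; ⊑-antisym = λ a b → ⊑-antisym b a
    ; _⊓_ = _⊔_ ; _⊔_ = _⊓_ ; ⊓ˡ = ⊔ˡ ; ⊓ʳ = ⊔ʳ ; ⊓-glb = ⊔-lub ; ⊔ˡ = ⊓ˡ ; ⊔ʳ = ⊓ʳ ; ⊔-lub = ⊓-glb
    ; 𝟘 = 𝟙 ; 𝟙 = 𝟘 ; 𝟘-min = 𝟙-max ; 𝟙-max = 𝟘-min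
    ; rk = λ x → d ∸ rk x
    ; rk-𝟘 = trans (cong (d ∸_) rk-𝟙) (n∸n≡0 d)
    ; rk-𝟙 = cong (d ∸_) rk-𝟘
    ; rk-mono = λ h → ∸-monoʳ-≤ d (rk-mono h)
    ; rk-eq = λ {x} {y} h k → rk-eq h (≤-trans (≤-reflexive (sym (m∸[m∸n]≡n (rk≤d x))))
        (≤-trans (∸-monoʳ-≤ d k) (≤-reflexive (m∸[m∸n]≡n (rk≤d y)))))
    ; rk-mod = λ x y → +-cancelʳ-≡ (rk (x ⊓ y) + rk (x ⊔ y)) _ _
        (trans (lem (d ∸ rk (x ⊓ y)) (d ∸ rk (x ⊔ y)) (rk (x ⊓ y)) (rk (x ⊔ y)))
          (trans (cong₂ _+_ (m∸n+n≡m (rk≤d (x ⊓ y))) (m∸n+n≡m (rk≤d (x ⊔ y))))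
            (sym (trans (cong (d ∸ rk x + (d ∸ rk y) +_) (trans (+-comm (rk (x ⊓ y)) _) (rk-mod x y)))
              (trans (lem (d ∸ rk x) (d ∸ rk y) (rk x) (rk y))
                (cong₂ _+_ (m∸n+n≡m (rk≤d x)) (m∸n+n≡m (rk≤d y))))))))
    ; 1≤p = 1≤p
    ; ups = λ {x} {z} r h e → trans
        (count-cong (λ y w → proj₁ (proj₂ w) , proj₁ w , co-suc⁻¹ (rk≤d y) (rk≤d x) (proj₂ (proj₂ w)))
                    (λ y w → proj₁ (proj₂ w) , proj₁ w , co-suc (rk≤d y) (rk≤d x) (proj₂ (proj₂ w))))
        (dns r h (co-diff (rk≤d x) (rk≤d z) e))
    ; dns = λ {x} {z} r h e → trans
        (count-cong (λ y w → proj₁ (proj₂ w) , proj₁ w , sym (co-suc⁻¹ (rk≤d z) (rk≤d y) (sym (proj₂ (proj₂ w)))))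
                    (λ y w → proj₁ (proj₂ w) , proj₁ w , sym (co-suc (rk≤d z) (rk≤d y) (sym (proj₂ (proj₂ w))))))
        (ups r h (co-diff (rk≤d x) (rk≤d z) e))
    }
    where lem : ∀ a b x y → a + b + (x + y) ≡ a + x + (b + y)
          lem = solve-∀

  module _ (a : X) (d′ : ℕ) (ed : rk a + d′ ≡ d) where
    private
      fin′ : Finite (Σ X (a ⊑_))
      fin′ = Finite-Σ finite (a ⊑_) (λ y → ⊑-dec) ⊑-irr

      r+ : ∀ {x} → a ⊑ x → rk a + (rk x ∸ rk a) ≡ rk x
      r+ h = m+[n∸m]≡n (rk-mono h)

      shift : ∀ {x z r} → a ⊑ x → a ⊑ z → (rk x ∸ rk a) + r ≡ rk z ∸ rk a → rk x + r ≡ rk z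
      shift {x} {z} {r} hx hz e = trans (cong (_+ r) (sym (r+ hx)))
        (trans (+-assoc (rk a) _ r) (trans (cong (rk a +_) e) (r+ hz)))

      s→ : ∀ {x y} → a ⊑ x → a ⊑ y → rk y ∸ rk a ≡ suc (rk x ∸ rk a) → rk y ≡ suc (rk x)
      s→ hx hy e = trans (sym (r+ hy)) (trans (cong (rk a +_) e) (trans (+-suc (rk a) _) (cong suc (r+ hx))))

      s← : ∀ {x y} → a ⊑ x → a ⊑ y → rk y ≡ suc (rk x) → rk y ∸ rk a ≡ suc (rk x ∸ rk a)
      s← hx hy e = trans (cong (_∸ rk a) e) (+-∸-assoc 1 (rk-mono hx))

    -- The quotient by `a`: the interval above `a` with ranks shifted. Irrelevance of the order
    -- proofs lets every count in it be compared with a count in the whole lattice.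
    upper : Geom p d′
    upper = record
      { X = Σ X (a ⊑_) ; finite = fin′
      ; _⊑_ = λ x y → proj₁ x ⊑ proj₁ y ; ⊑-irr = ⊑-irr ; ⊑-refl = ⊑-refl
      ; ⊑-trans = ⊑-trans ; ⊑-antisym = λ h k → ext (⊑-antisym h k)
      ; _⊓_ = λ x y → proj₁ x ⊓ proj₁ y , ⊓-glb (proj₂ x) (proj₂ y)
      ; _⊔_ = λ x y → proj₁ x ⊔ proj₁ y , ⊑-trans (proj₂ x) ⊔ˡ
      ; ⊓ˡ = ⊓ˡ ; ⊓ʳ = ⊓ʳ ; ⊓-glb = ⊓-glb ; ⊔ˡ = ⊔ˡ ; ⊔ʳ = ⊔ʳ ; ⊔-lub = ⊔-lub
      ; 𝟘 = a , ⊑-refl ; 𝟙 = 𝟙 , 𝟙-max ; 𝟘-min = λ {x} → proj₂ x ; 𝟙-max = 𝟙-max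
      ; rk = λ x → rk (proj₁ x) ∸ rk a
      ; rk-𝟘 = n∸n≡0 (rk a)
      ; rk-𝟙 = trans (cong (_∸ rk a) (trans rk-𝟙 (sym ed))) (m+n∸m≡n (rk a) d′)
      ; rk-mono = λ h → ∸-monoˡ-≤ (rk a) (rk-mono h)
      ; rk-eq = λ {x} {y} h k → rk-eq h (≤-trans (≤-reflexive (sym (r+ (proj₂ y))))
          (≤-trans (+-monoʳ-≤ (rk a) k) (≤-reflexive (r+ (proj₂ x)))))
      ; rk-mod = λ { (x , hx) (y , hy) → +-cancelˡ-≡ (rk a + rk a) _ _
          (trans (lem (rk a) _ _) (trans (cong₂ _+_ (r+ (⊑-trans hx ⊔ˡ)) (r+ (⊓-glb hx hy)))
            (trans (rk-mod x y) (sym (trans (lem (rk a) _ _) (cong₂ _+_ (r+ hx) (r+ hy))))))) }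
      ; 1≤p = 1≤p
      ; ups = λ { {x , hx} {z , hz} r h e → trans
          (count-Σ finite (a ⊑_) (λ y → ⊑-dec) ⊑-irr
            {Q = λ y → (x ⊑ y) × (y ⊑ z) × (rk y ≡ suc (rk x))}
            (λ y hy w → proj₁ w , proj₁ (proj₂ w) , s→ hx hy (proj₂ (proj₂ w)))
            (λ y w → ⊑-trans hx (proj₁ w) , proj₁ w , proj₁ (proj₂ w) ,
              s← hx (⊑-trans hx (proj₁ w)) (proj₂ (proj₂ w))))
          (ups r h (shift hx hz e)) }
      ; dns = λ { {x , hx} {z , hz} r h e → trans
          (count-Σ finite (a ⊑_) (λ y → ⊑-dec) ⊑-irr
            {Q = λ y → (x ⊑ y) × (y ⊑ z) × (suc (rk y) ≡ rk z)}
            (λ y hy w → proj₁ w , proj₁ (proj₂ w) , sym (s→ hy hz (sym (proj₂ (proj₂ w)))))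
            (λ y w → ⊑-trans hx (proj₁ w) , proj₁ w , proj₁ (proj₂ w) ,
              sym (s← (⊑-trans hx (proj₁ w)) hz (sym (proj₂ (proj₂ w))))))
          (dns r h (shift hx hz e)) }
      }
      where
        ext : {x y : Σ X (a ⊑_)} → proj₁ x ≡ proj₁ y → x ≡ y
        ext {x , h} {.x , k} refl = cong (x ,_) (⊑-irr h k)
        lem : ∀ a x y → a + a + (x + y) ≡ a + x + (a + y)
        lem = solve-∀

-- Ranks, atoms and the levels of intervals.

module GeomProps {p d : ℕ} (G : Geom p d) where
  open Geom G public

  q : ℕ
  q = suc p

  At : X → X → Set
  At x a = (rk a ≡ 1) × (a ⊑ x)

  Dj : X → X → Set
  Dj x y = rk (x ⊓ y) ≡ 0

  ⊑-≡ : ∀ {x y} → x ⊑ y → rk y ≤ rk x → x ≡ y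
  ⊑-≡ h k = ⊑-antisym h (rk-eq h k)

  count-At : ∀ x → count (At x) ≡ br q (rk x)
  count-At x = trans
    (count-cong (λ a w → 𝟘-min , proj₂ w , trans (proj₁ w) (cong suc (sym rk-𝟘)))
                (λ a w → trans (proj₂ (proj₂ w)) (cong suc rk-𝟘) , proj₁ (proj₂ w)))
    (ups (rk x) 𝟘-min (cong (_+ rk x) rk-𝟘))

  atom-below : ∀ x → 1 ≤ rk x → Σ X (At x)
  atom-below x h = count-find (≤-trans (pos (rk x) h) (≤-reflexive (sym (count-At x))))
    where pos : ∀ k → 1 ≤ k → 1 ≤ br q k
          pos (suc k) _ = ≤-trans (m^n>0 q k) (br-≥ q k)

  common-atom : ∀ x y → ¬ Dj x y → Σ X λ a → (rk a ≡ 1) × (a ⊑ x) × (a ⊑ y)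
  common-atom x y n with atom-below (x ⊓ y) (n≢0⇒n>0 n)
  ... | a , e , h = a , e , ⊑-trans h ⊓ˡ , ⊑-trans h ⊓ʳ

  meet-¬Dj : ∀ {x y a} → 1 ≤ rk a → a ⊑ x → a ⊑ y → ¬ Dj x y
  meet-¬Dj e h k dj = 1+n≰n (≤-trans e (≤-trans (rk-mono (⊓-glb h k)) (≤-reflexive dj)))

  Dj-sym : ∀ {x y} → Dj x y → Dj y x
  Dj-sym {x} {y} h = n≤0⇒n≡0 (≤-trans (rk-mono (⊓-glb ⊓ʳ ⊓ˡ)) (≤-reflexive h))

  Dj-mono : ∀ {x y x′ y′} → x′ ⊑ x → y′ ⊑ y → Dj x y → Dj x′ y′
  Dj-mono h k dj = n≤0⇒n≡0 (≤-trans (rk-mono (⊓-glb (⊑-trans ⊓ˡ h) (⊑-trans ⊓ʳ k))) (≤-reflexive dj))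

  rk-⊔-Dj : ∀ {x y} → Dj x y → rk (x ⊔ y) ≡ rk x + rk y
  rk-⊔-Dj {x} {y} h = trans (sym (+-identityʳ _)) (trans (cong (rk (x ⊔ y) +_) (sym h)) (rk-mod x y))

  rk-⊔-≤ : ∀ x y → rk (x ⊔ y) ≤ rk x + rk y
  rk-⊔-≤ x y = ≤-trans (m≤m+n _ _) (≤-reflexive (rk-mod x y))

  rk-⊓-≥ : ∀ {x y z} → x ⊑ z → y ⊑ z → rk x + rk y ≤ rk z + rk (x ⊓ y)
  rk-⊓-≥ {x} {y} h k = ≤-trans (≤-reflexive (sym (rk-mod x y))) (+-monoˡ-≤ _ (rk-mono (⊔-lub h k)))

  Dj-bound : ∀ {x y z} → x ⊑ z → y ⊑ z → Dj x y → rk x + rk y ≤ rk z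
  Dj-bound h k dj = ≤-trans (≤-reflexive (sym (rk-⊔-Dj dj))) (rk-mono (⊔-lub h k))

  atom-Dj : ∀ {x a} → rk a ≡ 1 → ¬ (a ⊑ x) → Dj x a
  atom-Dj {x} {a} e n with rk (x ⊓ a) in eq
  ... | zero = refl
  ... | suc k = ⊥-elim (n (⊑-trans (rk-eq ⊓ʳ (≤-trans (≤-reflexive e)
                  (≤-trans (s≤s z≤n) (≤-reflexive (sym eq))))) ⊓ˡ))

  rk-⊔-atom : ∀ {x a} → rk a ≡ 1 → ¬ (a ⊑ x) → rk (x ⊔ a) ≡ suc (rk x)
  rk-⊔-atom {x} e n = trans (rk-⊔-Dj (atom-Dj e n)) (trans (cong (rk x +_) e) (+-comm (rk x) 1))

  rk-⊔-atom-≤ : ∀ {x a} → rk a ≡ 1 → rk (x ⊔ a) ≤ suc (rk x)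
  rk-⊔-atom-≤ {x} {a} e = ≤-trans (rk-⊔-≤ x a) (≤-reflexive (trans (cong (rk x +_) e) (+-comm (rk x) 1)))

  Dj-atom⊑ : ∀ {x a b} → 1 ≤ rk a → Dj x b → a ⊑ b → ¬ (a ⊑ x)
  Dj-atom⊑ e dj h k = meet-¬Dj e k h dj

  -- `u ⊔ c` has rank `rk u + 1` and lies in `u ⊔ r`, whose rank is no larger, so the two joins are
  -- equal.
  exchange : ∀ {u r c} → rk r ≡ 1 → rk c ≡ 1 → ¬ (c ⊑ u) → c ⊑ u ⊔ r → r ⊑ u ⊔ c
  exchange {u} {r} {c} er ec n h = ⊑-trans ⊔ʳ (rk-eq (⊔-lub ⊔ˡ h)
    (≤-trans (rk-⊔-atom-≤ er) (≤-reflexive (sym (rk-⊔-atom ec n)))))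

  -- A common atom of `u ⊔ r` and `b` is outside `u`, so it can be exchanged with `r`. This locates
  -- the children `u ⊔ r` that meet a subspace `b` missed by `u`: all their atoms `r` lie in
  -- `u ⊔ b`.
  join-hit : ∀ {u r b} → rk r ≡ 1 → Dj u b → ¬ Dj (u ⊔ r) b → r ⊑ u ⊔ b
  join-hit {u} {r} {b} e dj n with common-atom (u ⊔ r) b n
  ... | c , ec , hc , kc = ⊑-trans (exchange e ec (Dj-atom⊑ (≤-reflexive (sym ec)) dj kc) hc)
          (⊔-lub ⊔ˡ (⊑-trans kc ⊔ʳ))

  ⊔-mono : ∀ {x y x′ y′} → x ⊑ x′ → y ⊑ y′ → x ⊔ y ⊑ x′ ⊔ y′
  ⊔-mono h k = ⊔-lub (⊑-trans h ⊔ˡ) (⊑-trans k ⊔ʳ)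

  rk-⊓-proper : ∀ {z y} → ¬ (z ⊑ y) → suc (rk (z ⊓ y)) ≤ rk z
  rk-⊓-proper n = ≰⇒> λ h → n (⊑-trans (rk-eq ⊓ˡ h) ⊓ʳ)

  count-At-⊓ : ∀ {z y k} → ¬ (z ⊑ y) → rk z ≡ suc k → count (λ r → At z r × (r ⊑ y)) ≤ br q k
  count-At-⊓ {z} {y} {k} n e = ≤-trans
    (count-mono λ r w → proj₁ (proj₁ w) , ⊓-glb (proj₂ (proj₁ w)) (proj₂ w))
    (≤-trans (≤-reflexive (count-At (z ⊓ y)))
      (br-mono q (≤-pred (≤-trans (rk-⊓-proper n) (≤-reflexive e)))))

  Lv : X → X → ℕ → X → Set
  Lv x z k y = (x ⊑ y) × (y ⊑ z) × (rk y ≡ rk x + k)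

  lv : X → X → ℕ → ℕ
  lv x z k = count (Lv x z k)

  lv-0 : ∀ {x z} → x ⊑ z → lv x z 0 ≡ 1
  lv-0 {x} h = trans (count-cong {Q = λ y → y ≡ x}
      (λ y w → sym (⊑-≡ (proj₁ w) (≤-reflexive (trans (proj₂ (proj₂ w)) (+-identityʳ _)))))
      (λ { y refl → ⊑-refl , h , sym (+-identityʳ _) }))
    (count-≡ x)

  -- Incident pairs in two consecutive levels, counted from below by `ups` and from above by `dns`.
  -- Iteration gives the Gaussian coefficients.
  lv-rec : ∀ {x z} k s → x ⊑ z → rk x + (k + suc s) ≡ rk z →
    lv x z k * br q (suc s) ≡ lv x z (suc k) * br q (suc k)
  lv-rec {x} {z} k s h e = double-count {R = λ y w → Lv x z k y × Lv x z (suc k) w × (y ⊑ w)}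
    _ _ (λ y w r → proj₁ r , proj₁ (proj₂ r)) f g
    where
      f : ∀ y → Lv x z k y → count (λ w → Lv x z k y × Lv x z (suc k) w × (y ⊑ w)) ≡ br q (suc s)
      f y (xy , yz , ry) = trans
        (count-cong
          (λ w t → let (_ , (xw , wz , rw) , yw) = t in
            yw , wz , trans rw (trans (+-suc (rk x) k) (cong suc (sym ry))))
          (λ w t → let (yw , wz , rw) = t in
            (xy , yz , ry) , (⊑-trans xy yw , wz , trans rw (trans (cong suc ry) (sym (+-suc (rk x) k)))) , yw))
        (ups (suc s) yz (trans (cong (_+ suc s) ry) (trans (+-assoc (rk x) k (suc s)) e)))
      g : ∀ w → Lv x z (suc k) w → count (λ y → Lv x z k y × Lv x z (suc k) w × (y ⊑ w)) ≡ br q (suc k)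
      g w (xw , wz , rw) = trans
        (count-cong
          (λ y t → let ((xy , yz , ry) , _ , yw) = t in
            xy , yw , trans (cong suc ry) (trans (sym (+-suc (rk x) k)) (sym rw)))
          (λ y t → let (xy , yw , ry) = t in
            (xy , ⊑-trans yw wz , suc-injective (trans ry (trans rw (+-suc (rk x) k)))) , (xw , wz , rw) , yw))
        (dns (suc k) xw (sym rw))

  -- The ratio of consecutive levels is `br q (suc s)` over `br q (suc k)`, hence at most q^(s+1) /
  -- (p q^k). The product of these ratios is the bound, with one p for each level.
  lv-≤ : ∀ {x z} k s → x ⊑ z → rk x + (k + s) ≡ rk z → lv x z k * p ^ k ≤ q ^ (k * s + k)
  lv-≤ {x} zero s h e = ≤-reflexive (trans (*-identityʳ _) (lv-0 h))
  lv-≤ {x} {z} (suc k) s h e = *-cancelʳ-≤ _ _ (q ^ k) {{m^n≢0 q k}} (begin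
      lv x z (suc k) * (p * p ^ k) * q ^ k
        ≤⟨ *-monoʳ-≤ (lv x z (suc k) * (p * p ^ k)) (br-≥ q k) ⟩
      lv x z (suc k) * (p * p ^ k) * br q (suc k)
        ≡⟨ l1 (lv x z (suc k)) p (p ^ k) (br q (suc k)) ⟩
      lv x z (suc k) * br q (suc k) * p * p ^ k
        ≡⟨ cong (λ t → t * p * p ^ k) (sym (lv-rec k s h (trans (cong (rk x +_) (+-suc k s)) e))) ⟩
      lv x z k * br q (suc s) * p * p ^ k
        ≡⟨ l2 (lv x z k) (br q (suc s)) p (p ^ k) ⟩
      (lv x z k * p ^ k) * (br q (suc s) * p)
        ≤⟨ *-mono-≤ (lv-≤ k (suc s) h (trans (cong (rk x +_) (+-suc k s)) e)) (br-≤ p (suc s)) ⟩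
      q ^ (k * suc s + k) * q ^ suc s
        ≡⟨ sym (^-distribˡ-+-* q (k * suc s + k) (suc s)) ⟩
      q ^ (k * suc s + k + suc s)
        ≡⟨ cong (q ^_) (l3 k s) ⟩
      q ^ (suc k * s + suc k + k)
        ≡⟨ ^-distribˡ-+-* q (suc k * s + suc k) k ⟩
      q ^ (suc k * s + suc k) * q ^ k ∎)
    where
      open ≤-Reasoning
      l1 : ∀ a b c e → a * (b * c) * e ≡ a * e * b * c
      l1 = solve-∀
      l2 : ∀ a b c e → a * b * c * e ≡ (a * e) * (b * c)
      l2 = solve-∀
      l3 : ∀ k s → k * suc s + k + suc s ≡ suc k * s + suc k + k
      l3 = solve-∀

  lv-≥ : ∀ {x z} k s → x ⊑ z → rk x + (k + s) ≡ rk z → p ^ k * q ^ (k * s) ≤ lv x z k * q ^ k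
  lv-≥ {x} zero s h e = ≤-reflexive (sym (trans (*-identityʳ _) (lv-0 h)))
  lv-≥ {x} {z} (suc k) s h e = *-cancelʳ-≤ _ _ (q ^ k) {{m^n≢0 q k}} (begin
      p * p ^ k * q ^ (suc k * s) * q ^ k
        ≡⟨ l0 p (p ^ k) (q ^ (suc k * s)) (q ^ k) ⟩
      p * (p ^ k * (q ^ (suc k * s) * q ^ k))
        ≡⟨ cong (λ t → p * (p ^ k * t)) (trans (sym (^-distribˡ-+-* q (suc k * s) k))
             (trans (cong (q ^_) (l3 k s)) (^-distribˡ-+-* q (k * suc s) s))) ⟩
      p * (p ^ k * (q ^ (k * suc s) * q ^ s))
        ≡⟨ l1 p (p ^ k) (q ^ (k * suc s)) (q ^ s) ⟩
      p * (p ^ k * q ^ (k * suc s)) * q ^ s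
        ≤⟨ *-mono-≤ (*-monoʳ-≤ p (lv-≥ k (suc s) h e′)) (br-≥ q s) ⟩
      p * (lv x z k * q ^ k) * br q (suc s)
        ≡⟨ l2 p (lv x z k) (q ^ k) (br q (suc s)) ⟩
      lv x z k * br q (suc s) * p * q ^ k
        ≡⟨ cong (λ t → t * p * q ^ k) (lv-rec k s h e′) ⟩
      lv x z (suc k) * br q (suc k) * p * q ^ k
        ≡⟨ cong (_* q ^ k) (*-assoc (lv x z (suc k)) _ p) ⟩
      lv x z (suc k) * (br q (suc k) * p) * q ^ k
        ≤⟨ *-monoˡ-≤ (q ^ k) (*-monoʳ-≤ (lv x z (suc k)) (br-≤ p (suc k))) ⟩
      lv x z (suc k) * q ^ suc k * q ^ k ∎)
    where
      open ≤-Reasoning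
      e′ = trans (cong (rk x +_) (+-suc k s)) e
      l0 : ∀ a b c e → a * b * c * e ≡ a * (b * (c * e))
      l0 = solve-∀
      l1 : ∀ a b c e → a * (b * (c * e)) ≡ a * (b * c) * e
      l1 = solve-∀
      l2 : ∀ a b c e → a * (b * c) * e ≡ b * e * a * c
      l2 = solve-∀
      l3 : ∀ k s → suc k * s + k ≡ k * suc s + s
      l3 = solve-∀

  fac : ℕ → ℕ
  fac zero = 1
  fac (suc k) = br q (suc k) * fac k

  lv-fac : ∀ {x z} k s → x ⊑ z → rk x + (k + s) ≡ rk z → lv x z k * (fac k * fac s) ≡ fac (k + s)
  lv-fac zero s h e = trans (cong (_* (1 * fac s)) (lv-0 h)) (lem (fac s))
    where lem : ∀ a → 1 * (1 * a) ≡ a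
          lem = solve-∀
  lv-fac {x} {z} (suc k) s h e = trans (l1 (lv x z (suc k)) (br q (suc k)) (fac k) (fac s))
      (trans (cong (λ t → t * (fac k * fac s)) (sym (lv-rec k s h e′)))
        (trans (l2 (lv x z k) (br q (suc s)) (fac k) (fac s))
          (trans (lv-fac k (suc s) h e′) (cong fac (+-suc k s)))))
    where
      e′ = trans (cong (rk x +_) (+-suc k s)) e
      l1 : ∀ a b c e → a * (b * c * e) ≡ a * b * (c * e)
      l1 = solve-∀
      l2 : ∀ a b c e → a * b * (c * e) ≡ a * (c * (b * e))
      l2 = solve-∀

  sub-of-rank : ∀ {a x} k g → a ⊑ x → rk a ≤ k → rk x ≡ k + g → Σ X λ y → (a ⊑ y) × (y ⊑ x) × (rk y ≡ k)
  sub-of-rank {x = x} k zero h l e = x , h , ⊑-refl , trans e (+-identityʳ k)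
  sub-of-rank {a} {x} k (suc g) h l e with count-find (pos (rk x ∸ rk a) (m+[n∸m]≡n (rk-mono h)))
    where
      pos : ∀ r → rk a + r ≡ rk x → 1 ≤ count (λ y → (a ⊑ y) × (y ⊑ x) × (suc (rk y) ≡ rk x))
      pos zero er = ⊥-elim (1+n≰n (≤-trans (s≤s l) (≤-trans (≤-trans (s≤s (m≤m+n k g))
        (≤-reflexive (sym (+-suc k g)))) (≤-reflexive (trans (sym e) (trans (sym er) (+-identityʳ _)))))))
      pos (suc r) er = ≤-trans (≤-trans (m^n>0 q r) (br-≥ q r)) (≤-reflexive (sym (dns (suc r) h er)))
  ... | y , ay , yx , ey with sub-of-rank k g ay l (suc-injective (trans ey (trans e (+-suc k g))))
  ... | w , aw , wy , ew = w , aw , ⊑-trans wy yx , ew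

  br-≤^ : ∀ k → br q k ≤ q ^ k
  br-≤^ k = ≤-trans (≤-trans (≤-reflexive (sym (*-identityʳ _))) (*-monoʳ-≤ (br q k) 1≤p)) (br-≤ p k)

  br-≤2 : ∀ k → br q (suc k) ≤ 2 * q ^ k
  br-≤2 k = ≤-trans (+-monoˡ-≤ (q ^ k) (br-≤^ k)) (≤-reflexive (cong (q ^ k +_) (sym (+-identityʳ _))))

  q≤2p : q ≤ 2 * p
  q≤2p = ≤-trans (+-monoˡ-≤ p 1≤p) (≤-reflexive (cong (p +_) (sym (+-identityʳ p))))

  q^≤2p^ : ∀ k → q ^ k ≤ 2 ^ k * p ^ k
  q^≤2p^ zero = ≤-refl
  q^≤2p^ (suc k) = ≤-trans (*-mono-≤ q≤2p (q^≤2p^ k)) (≤-reflexive (l p (2 ^ k) (p ^ k)))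
    where l : ∀ p a b → 2 * p * (a * b) ≡ 2 * a * (p * b)
          l = solve-∀

  -- Trades p^k for q^k at the price of 2^k, since q ≤ 2p.
  p-cancel : ∀ {x} k e → x * p ^ k ≤ q ^ (e + k) → x ≤ 2 ^ k * q ^ e
  p-cancel {x} k e h = *-cancelʳ-≤ x _ (p ^ k) {{m^n≢0 p k {{>-nonZero 1≤p}}}} (begin
    x * p ^ k                 ≤⟨ h ⟩
    q ^ (e + k)               ≡⟨ ^-distribˡ-+-* q e k ⟩
    q ^ e * q ^ k             ≤⟨ *-monoʳ-≤ (q ^ e) (q^≤2p^ k) ⟩
    q ^ e * (2 ^ k * p ^ k)   ≡⟨ l (q ^ e) (2 ^ k) (p ^ k) ⟩
    2 ^ k * q ^ e * p ^ k     ∎)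
    where open ≤-Reasoning
          l : ∀ a b c → a * (b * c) ≡ b * a * c
          l = solve-∀

  lv-≤2 : ∀ {x z} k s → x ⊑ z → rk x + (k + s) ≡ rk z → lv x z k ≤ 2 ^ k * q ^ (k * s)
  lv-≤2 k s h e = p-cancel k (k * s) (lv-≤ k s h e)

-- Intersecting families of rank n in rank 2n: Erdős-Ko-Rado and Hilton-Milner bounds.

-- The bounds carry powers of p = q - 1 so that the leading constants stay explicit.
module Intersecting {p n′ : ℕ} (G : Geom p (suc n′ + suc n′))
  (F : Geom.X G → Set) {{F? : ∀ {x} → Dec (F x)}}
  (F-rk : ∀ {s} → F s → Geom.rk G s ≡ suc n′)
  (F-int : ∀ {s t} → F s → F t → ¬ GeomProps.Dj G s t) where

  open GeomProps G

  private
    n = suc n′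

  N : X → ℕ
  N u = count (λ s → F s × (u ⊑ s))

  -- NC stands for noncover.
  NC : X → Set
  NC u = Σ X λ s → F s × Dj u s

  instance
    NC? : ∀ {u} → Dec (NC u)
    NC? = dec-∃

  NoCoverBelow : ℕ → Set
  NoCoverBelow k = ∀ u → rk u < k → NC u

  N-trivial : ∀ {u} m → rk u + m ≡ n → N u * p ^ m ≤ q ^ (m * n + m)
  N-trivial {u} m e = ≤-trans
    (*-monoˡ-≤ (p ^ m) (count-mono {Q = Lv u 𝟙 m} λ s w → proj₂ w , 𝟙-max , trans (F-rk (proj₁ w)) (sym e)))
    (lv-≤ m n 𝟙-max (trans (sym (+-assoc (rk u) m n)) (trans (cong (_+ n) e) (sym rk-𝟙))))

  child-rk : ∀ {u s a} → Dj u s → At s a → rk (u ⊔ a) ≡ suc (rk u)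
  child-rk dj (ea , ha) = rk-⊔-atom ea (Dj-atom⊑ (≤-reflexive (sym ea)) dj ha)

  -- A member above `u` meets `s` in an atom `a` and so lies above `u ⊔ a`. There are about q^(n-1)
  -- atoms, while the trivial bound drops by q^n from `u` to a child: each noncover gains a factor
  -- q.
  step : ∀ {u s} → F s → Dj u s → (A B : ℕ) → (∀ a → At s a → N (u ⊔ a) * A ≤ B) → N u * A ≤ br q n * B
  step {u} {s} fs dj A B h = ≤-trans
    (branch {D = At s} {Q = λ a t → F t × (u ⊔ a ⊑ t)}
      (λ t w → let (a , ea , at , as) = common-atom t s (F-int (proj₁ w) fs) in
        a , (ea , as) , proj₁ w , ⊔-lub (proj₂ w) at) A B h)
    (≤-reflexive (cong (_* B) (trans (count-At s) (cong (br q) (F-rk fs)))))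

  N-top : ∀ {u} → rk u ≡ n → NC u → N u ≡ 0
  N-top {u} e (s , fs , dj) = count-none λ t w →
    F-int (subst F (sym (⊑-≡ (proj₂ w) (≤-reflexive (trans (F-rk (proj₁ w)) (sym e))))) (proj₁ w)) fs dj

  private
    arith : ∀ {N A b B Q} → N * A ≤ b * B → b * p ≤ Q → N * A * (q * p) ≤ Q * (q * B)
    arith {N} {A} {b} {B} {Q} h k = begin
      N * A * (q * p)   ≤⟨ *-monoˡ-≤ (q * p) h ⟩
      b * B * (q * p)   ≡⟨ l b B q p ⟩
      b * p * (q * B)   ≤⟨ *-monoˡ-≤ (q * B) k ⟩
      Q * (q * B)       ∎
      where
        open ≤-Reasoning
        l : ∀ b B q p → b * B * (q * p) ≡ b * p * (q * B)
        l = solve-∀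

    expo : ∀ m → q ^ n * (q * q ^ (m * n + m)) ≡ q ^ (suc m * n + suc m)
    expo m = trans (sym (^-distribˡ-+-* q n (suc (m * n + m)))) (cong (q ^_) (l n m (m * n)))
      where l : ∀ n m x → n + suc (x + m) ≡ n + x + suc m
            l = solve-∀

    expo₁ : suc (n′ * n + n′) ≡ n′ * n + n
    expo₁ = sym (+-suc (n′ * n) n′)

  step′ : ∀ {u} m R c → NC u → rk u + suc m ≡ n →
    (∀ v → rk v ≡ suc (rk u) → N v * (q ^ R * p ^ m) ≤ c * q ^ (m * n + m)) →
    N u * (q ^ suc R * p ^ suc m) ≤ c * q ^ (suc m * n + suc m)
  step′ {u} m R c (s , fs , dj) e h = begin
      N u * (q * q ^ R * (p * p ^ m))      ≡⟨ l (N u) q (q ^ R) p (p ^ m) ⟩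
      N u * (q ^ R * p ^ m) * (q * p)
        ≤⟨ arith {N u} {b = br q n} (step fs dj _ _ λ a w → h (u ⊔ a) (child-rk dj w)) (br-≤ p n) ⟩
      q ^ n * (q * (c * q ^ (m * n + m)))  ≡⟨ l′ (q ^ n) q c (q ^ (m * n + m)) ⟩
      c * (q ^ n * (q * q ^ (m * n + m)))  ≡⟨ cong (c *_) (expo m) ⟩
      c * q ^ (suc m * n + suc m)          ∎
    where
      open ≤-Reasoning
      l : ∀ a b c d e → a * (b * c * (d * e)) ≡ a * (c * e) * (b * d)
      l = solve-∀
      l′ : ∀ a b c d → a * (b * (c * d)) ≡ c * (a * (b * d))
      l′ = solve-∀

  -- `R` counts steps that start below rank τ, hence at a noncover, and each of them gains one q. If
  -- `m` runs out before `R`, then `u` has rank n and is itself the only possible member, which a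
  -- noncover cannot be.
  N-bound : ∀ τ → NoCoverBelow τ → ∀ m R u → rk u + m ≡ n → rk u + R ≤ τ →
    N u * (q ^ R * p ^ m) ≤ q ^ (m * n + m)
  N-bound τ nc m zero u e h rewrite +-identityʳ (p ^ m) = N-trivial m e
  N-bound τ nc zero (suc R) u e h
    rewrite N-top (trans (sym (+-identityʳ _)) e) (nc u (≤-trans (≤-trans (m≤m+n _ R) (≤-reflexive (sym (+-suc (rk u) R)))) h)) = z≤n
  N-bound τ nc (suc m) (suc R) u e h = ≤-trans
    (step′ m R 1 (nc u (≤-trans (≤-trans (m≤m+n _ R) (≤-reflexive (sym (+-suc (rk u) R)))) h)) e
      λ v ev → ≤-trans (N-bound τ nc m R v
          (trans (cong (_+ m) ev) (trans (sym (+-suc (rk u) m)) e))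
          (≤-trans (≤-reflexive (trans (cong (_+ R) ev) (sym (+-suc (rk u) R)))) h))
        (≤-reflexive (sym (*-identityˡ _))))
    (≤-reflexive (*-identityˡ _))

  private
    point-sum : {P : X → Set} {{P? : ∀ {x} → Dec (P x)}} (t : X) (k R c e : ℕ) → rk t ≡ k →
      (∀ s → P s → F s × ¬ Dj t s) →
      (∀ a → rk a ≡ 1 → N a * (q ^ R * p ^ n′) ≤ c * q ^ e) →
      count P * p ^ n * q ^ R ≤ q ^ k * (c * q ^ e)
    point-sum {P} t k R c e et f h = begin
        count P * (p * p ^ n′) * q ^ R      ≡⟨ l (count P) p (p ^ n′) (q ^ R) ⟩
        count P * (q ^ R * p ^ n′) * p
          ≤⟨ *-monoˡ-≤ p (branch {P = P} {D = At t} {Q = λ a s → F s × (a ⊑ s)}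
              (λ s w → let (a , ea , at , as) = common-atom t s (proj₂ (f s w)) in
                a , (ea , at) , proj₁ (f s w) , as) _ (c * q ^ e) λ a w → h a (proj₁ w)) ⟩
        count (At t) * (c * q ^ e) * p      ≡⟨ cong (λ b → b * (c * q ^ e) * p) (trans (count-At t) (cong (br q) et)) ⟩
        br q k * (c * q ^ e) * p            ≡⟨ l′ (br q k) (c * q ^ e) p ⟩
        br q k * p * (c * q ^ e)            ≤⟨ *-monoˡ-≤ (c * q ^ e) (br-≤ p k) ⟩
        q ^ k * (c * q ^ e)                 ∎
      where
        open ≤-Reasoning
        l : ∀ a b c d → a * (b * c) * d ≡ a * (d * c) * b
        l = solve-∀
        l′ : ∀ a b c → a * b * c ≡ a * c * b
        l′ = solve-∀

    cancel : ∀ {x y} R → x * q ^ R ≤ q ^ R * y → x ≤ y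
    cancel {x} {y} R h = *-cancelʳ-≤ x y (q ^ R) {{m^n≢0 q R}} (≤-trans h (≤-reflexive (*-comm (q ^ R) y)))

    atom-m : ∀ {a} → rk a ≡ 1 → rk a + n′ ≡ n
    atom-m e = cong (_+ n′) e

  record MinCover : Set where
    field
      τ : ℕ
      T : X
      rk-T : rk T ≡ τ
      T-cover : ¬ NC T
      none : NoCoverBelow τ

  minCover : Σ X F → Σ MinCover λ c → MinCover.τ c ≤ n
  minCover (s₀ , f₀) = go n 0 (+-identityʳ n) (λ u ())
    where
      go : ∀ g k → g + k ≡ n → NoCoverBelow k → Σ MinCover λ c → MinCover.τ c ≤ n
      go g k e nc with search (λ u → (rk u ≡ k) × ¬ NC u)
      ... | inj₁ (T , et , ct) = record { τ = k ; T = T ; rk-T = et ; T-cover = ct ; none = nc } ,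
              ≤-trans (m≤n+m k g) (≤-reflexive e)
      -- A member of `F` is a cover of rank n, so the search stops there at the latest.
      go zero k e nc | inj₂ h = ⊥-elim (h s₀ (trans (F-rk f₀) (sym e) , λ { (t , ft , dj) → F-int f₀ ft dj }))
      go (suc g) k e nc | inj₂ h = go g (suc k) (trans (+-suc g k) e) λ u lt →
        case m≤n⇒m<n∨m≡n (≤-pred lt) of λ
          { (inj₁ l) → nc u l
          ; (inj₂ eq) → stable λ ¬nc → h u (eq , ¬nc) }

  cover-¬Dj : ∀ {u s} → ¬ NC u → F s → ¬ Dj u s
  cover-¬Dj nc fs dj = nc (_ , fs , dj)

  cover-pos : ∀ {u} → Σ X F → ¬ NC u → 1 ≤ rk u
  cover-pos {u} (s , fs) c = n≢0⇒n>0 λ e → c (s , fs , n≤0⇒n≡0 (≤-trans (rk-mono ⊓ˡ) (≤-reflexive e)))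

  -- A least cover of rank t + 1 has about q^t points, and at each point t steps gain a factor q
  -- before a cover can occur. The two powers cancel and leave the size of a point pencil.
  ekr : count F * p ^ n ≤ q ^ (n′ * n + n)
  ekr with search F
  ... | inj₂ h = ≤-trans (≤-reflexive (cong (_* p ^ n) (count-none h))) z≤n
  ... | inj₁ ne with minCover ne
  ... | record { τ = τ ; T = T ; rk-T = et ; T-cover = ct ; none = nc } , _ with τ | cover-pos ne ct
  ... | zero | le = ⊥-elim (1+n≰n (≤-trans le (≤-reflexive et)))
  ... | suc t | _ = ≤-trans
      (cancel t (≤-trans (point-sum T (suc t) t 1 (n′ * n + n′) et (λ s fs → fs , cover-¬Dj ct fs)
          λ a ea → ≤-trans (N-bound (suc t) nc n′ t a (atom-m ea) (≤-reflexive (cong (_+ t) ea)))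
            (≤-reflexive (sym (*-identityˡ _))))
        (≤-reflexive (l q (q ^ t) (q ^ (n′ * n + n′))))))
      (≤-reflexive (cong (q ^_) expo₁))
    where
      l : ∀ a b c → a * b * (1 * c) ≡ b * (a * c)
      l = solve-∀

  -- The last-step analysis: if no pair (u , y) as in `Concentrated` exists, only few of the
  -- extensions of a noncover of rank t become covers.
  module HiltonMilner (ne : Σ X F)
      (no-point : ∀ a → rk a ≡ 1 → NC a)
      (no-hyper : ∀ h → rk h ≡ n + n′ → Σ X λ s → F s × ¬ (s ⊑ h)) where

    Escapes : X → X → Set
    Escapes u y = Σ X λ s → F s × Dj u s × ¬ (s ⊑ y)

    instance
      Escapes? : ∀ {u y} → Dec (Escapes u y)
      Escapes? = dec-∃

    Concentrated : ℕ → X × X → Set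
    Concentrated t (u , y) = (rk u ≡ t) × (rk y ≡ n + t) × ¬ Escapes u y

    -- Members meeting `u` are counted through its points, each of which gains t times. The others
    -- lie in `y`. Below hyperplane rank the number of all n-subspaces of `y` is small enough; if
    -- `y` is a hyperplane, a member outside it cuts `y` in rank at most n′, and all members in `y`
    -- must meet this intersection.
    concentrated-bound : ∀ t u y → 1 ≤ t → t ≤ n′ → NoCoverBelow (suc t) → Concentrated t (u , y) →
      count F * p ^ n ≤ 2 * q ^ (n′ * n + n′)
    concentrated-bound t u y 1≤t t≤n′ nc (eu , ey , ne) = begin
        count F * p ^ n
          ≤⟨ *-monoˡ-≤ (p ^ n) (count-∪ {P = λ s → F s × ¬ Dj u s} {Q = λ s → F s × (s ⊑ y)} split) ⟩
        (count (λ s → F s × ¬ Dj u s) + count (λ s → F s × (s ⊑ y))) * p ^ n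
          ≡⟨ *-distribʳ-+ (p ^ n) (count (λ s → F s × ¬ Dj u s)) _ ⟩
        count (λ s → F s × ¬ Dj u s) * p ^ n + count (λ s → F s × (s ⊑ y)) * p ^ n
          ≤⟨ +-mono-≤ b₁ b₂ ⟩
        E + E ≡⟨ cong (E +_) (sym (+-identityʳ E)) ⟩
        2 * E ∎
      where
        open ≤-Reasoning
        E = q ^ (n′ * n + n′)
        split : ∀ s → F s → (F s × ¬ Dj u s) ⊎ (F s × (s ⊑ y))
        split s fs with decide (Dj u s)
        ... | inj₂ nd = inj₁ (fs , nd)
        ... | inj₁ dj = inj₂ (fs , stable λ n → ne (s , fs , dj , n))
        b₁ : count (λ s → F s × ¬ Dj u s) * p ^ n ≤ E
        b₁ = cancel t (≤-trans (point-sum u t t 1 (n′ * n + n′) eu (λ s w → w)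
               λ a ea → ≤-trans (N-bound (suc t) nc n′ t a (atom-m ea) (≤-reflexive (cong (_+ t) ea)))
                 (≤-reflexive (sym (*-identityˡ _))))
               (≤-reflexive (cong (q ^ t *_) (*-identityˡ E))))
        b₂ : count (λ s → F s × (s ⊑ y)) * p ^ n ≤ E
        b₂ with m≤n⇒m<n∨m≡n t≤n′
        ... | inj₁ lt = ≤-trans
                (*-monoˡ-≤ (p ^ n) (count-mono {Q = Lv 𝟘 y n} λ s w →
                  𝟘-min , proj₂ w , trans (F-rk (proj₁ w)) (cong (_+ n) (sym rk-𝟘))))
                (≤-trans (lv-≤ n t 𝟘-min (trans (cong (_+ (n + t)) rk-𝟘) (sym ey)))
                  (^-monoʳ-≤ q (≤-trans (≤-reflexive (l n t))
                    (≤-trans (*-monoˡ-≤ n lt) (m≤m+n _ n′)))))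
          where l : ∀ n t → n * t + n ≡ suc t * n
                l = solve-∀
        ... | inj₂ refl with no-hyper y ey
        ... | s₁ , f₁ , n₁ = begin
            C * (p * p ^ n′)                    ≡⟨ l C p (p ^ n′) ⟩
            C * p ^ n′ * p
              ≤⟨ *-monoˡ-≤ p (branch {D = At (s₁ ⊓ y)} {Q = λ a s → F s × (s ⊑ y) × (a ⊑ s)}
                   (λ s w → let (a , ea , a₁ , as) = common-atom s₁ s (F-int f₁ (proj₁ w)) in
                     a , (ea , ⊓-glb a₁ (⊑-trans as (proj₂ w))) , proj₁ w , proj₂ w , as)
                   (p ^ n′) (q ^ (n′ * n′ + n′)) bound) ⟩
            count (At (s₁ ⊓ y)) * q ^ (n′ * n′ + n′) * p
              ≤⟨ *-monoˡ-≤ p (*-monoˡ-≤ (q ^ (n′ * n′ + n′)) (≤-trans (≤-reflexive (count-At (s₁ ⊓ y)))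
                   (br-mono q (≤-pred (≤-trans (rk-⊓-proper n₁) (≤-reflexive (F-rk f₁))))))) ⟩
            br q n′ * q ^ (n′ * n′ + n′) * p    ≡⟨ l′ (br q n′) (q ^ (n′ * n′ + n′)) p ⟩
            br q n′ * p * q ^ (n′ * n′ + n′)    ≤⟨ *-monoˡ-≤ (q ^ (n′ * n′ + n′)) (br-≤ p n′) ⟩
            q ^ n′ * q ^ (n′ * n′ + n′)         ≡⟨ sym (^-distribˡ-+-* q n′ (n′ * n′ + n′)) ⟩
            q ^ (n′ + (n′ * n′ + n′))           ≡⟨ cong (q ^_) (l″ n′) ⟩
            E ∎
          where
            C = count (λ s → F s × (s ⊑ y))
            l : ∀ a b c → a * (b * c) ≡ a * c * b
            l = solve-∀
            l′ : ∀ a b c → a * b * c ≡ a * c * b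
            l′ = solve-∀
            l″ : ∀ n′ → n′ + (n′ * n′ + n′) ≡ n′ * suc n′ + n′
            l″ = solve-∀
            bound : ∀ a → At (s₁ ⊓ y) a → count (λ s → F s × (s ⊑ y) × (a ⊑ s)) * p ^ n′ ≤ q ^ (n′ * n′ + n′)
            bound a (ea , ha) = ≤-trans
              (*-monoˡ-≤ (p ^ n′) (count-mono {Q = Lv a y n′} λ s w →
                proj₂ (proj₂ w) , proj₁ (proj₂ w) , trans (F-rk (proj₁ w)) (cong (_+ n′) (sym ea))))
              (lv-≤ n′ n′ (⊑-trans ha ⊓ʳ) (trans (cong (_+ (n′ + n′)) ea) (sym ey)))

    module _ (t : ℕ) (nc : NoCoverBelow (suc t)) (t≤n′ : t ≤ n′)
             (spread : ∀ u y → ¬ Concentrated t (u , y)) where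

      -- A child `u ⊔ a`, with `a` in `s₀`, that is a cover meets `s₁`, so `a` lies in `u ⊔ s₁`. As
      -- `s₁` is not inside `u ⊔ s₀` and both joins have the same rank, `s₀` is not inside `u ⊔ s₁`.
      -- Hence these children come from a proper subspace of `s₀`, a fraction 1/q of all atoms; the
      -- trivial bound suffices for them, and the others gain q again.
      last-step : ∀ {u} m → rk u ≡ t → rk u + suc m ≡ n → N u * (q ^ 2 * p ^ suc m) ≤ 2 * q ^ (suc m * n + suc m)
      last-step {u} m eu em with nc u (s≤s (≤-reflexive eu))
      ... | s₀ , f₀ , d₀ = go (stable λ ne → spread u (u ⊔ s₀)
              (eu , trans (rk-⊔-Dj d₀) (trans (+-comm (rk u) _) (cong₂ _+_ (F-rk f₀) eu)) , ne))
        where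
          open ≤-Reasoning
          E = q ^ (m * n + m)
          child-m : ∀ {a} → At s₀ a → rk (u ⊔ a) + m ≡ n
          child-m w = trans (cong (_+ m) (child-rk d₀ w)) (trans (sym (+-suc (rk u) m)) em)
          fresh : ∀ m v → rk v + m ≡ n → NC v → N v * (q * p ^ m) ≤ q ^ (m * n + m)
          fresh zero v e c rewrite N-top (trans (sym (+-identityʳ _)) e) c = z≤n
          fresh (suc m) v e c = ≤-trans (≤-reflexive (cong (λ t → N v * (t * p ^ suc m)) (sym (*-identityʳ q))))
            (≤-trans (step′ m 0 1 c e λ w ew → ≤-trans
                (≤-reflexive (cong (N w *_) (*-identityˡ (p ^ m))))
                (≤-trans (N-trivial m (trans (cong (_+ m) ew) (trans (sym (+-suc (rk v) m)) e)))
                  (≤-reflexive (sym (*-identityˡ _)))))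
              (≤-reflexive (*-identityˡ _)))
          go : Escapes u (u ⊔ s₀) → N u * (q ^ 2 * p ^ suc m) ≤ 2 * q ^ (suc m * n + suc m)
          go (s₁ , f₁ , d₁ , n₁) = begin
              N u * (q ^ 2 * (p * p ^ m))
                ≡⟨ l (N u) q p (p ^ m) ⟩
              N u * (q * p ^ m) * (q * p)
                ≤⟨ *-monoˡ-≤ (q * p) (branch₂ {D = λ a → At s₀ a × ¬ NC (u ⊔ a)} {Q = λ a s → F s × (u ⊔ a ⊑ s)}
                     {E = λ a → At s₀ a × NC (u ⊔ a)} {R = λ a s → F s × (u ⊔ a ⊑ s)}
                     split (q * p ^ m) (q * E) E
                     (λ a w → ≤-trans (≤-reflexive (l₁ (N (u ⊔ a)) q (p ^ m)))
                       (*-monoʳ-≤ q (N-trivial m (child-m (proj₁ w)))))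
                     (λ a w → fresh m (u ⊔ a) (child-m (proj₁ w)) (proj₂ w))) ⟩
              (count (λ a → At s₀ a × ¬ NC (u ⊔ a)) * (q * E) + count (λ a → At s₀ a × NC (u ⊔ a)) * E) * (q * p)
                ≤⟨ *-monoˡ-≤ (q * p) (+-mono-≤ (*-monoˡ-≤ (q * E) few) (*-monoˡ-≤ E all)) ⟩
              (br q n′ * (q * E) + br q n * E) * (q * p)
                ≡⟨ l₂ (br q n′) q E (br q n) p ⟩
              (br q n′ * p) * (q * (q * E)) + (br q n * p) * (q * E)
                ≤⟨ +-mono-≤ (*-monoˡ-≤ (q * (q * E)) (br-≤ p n′)) (*-monoˡ-≤ (q * E) (br-≤ p n)) ⟩
              q ^ n′ * (q * (q * E)) + q ^ n * (q * E)
                ≡⟨ l₃ (q ^ n′) q E ⟩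
              2 * (q ^ n * (q * E))
                ≡⟨ cong (2 *_) (expo m) ⟩
              2 * q ^ (suc m * n + suc m) ∎
            where
              l : ∀ a b c d → a * (b * (b * 1) * (c * d)) ≡ a * (b * d) * (b * c)
              l = solve-∀
              l₁ : ∀ a b c → a * (b * c) ≡ b * (a * c)
              l₁ = solve-∀
              l₂ : ∀ a b c d e → (a * (b * c) + d * c) * (b * e) ≡ (a * e) * (b * (b * c)) + (d * e) * (b * c)
              l₂ = solve-∀
              l₃ : ∀ a b c → a * (b * (b * c)) + (b * a) * (b * c) ≡ 2 * (b * a * (b * c))
              l₃ = solve-∀
              split : ∀ s → F s × (u ⊑ s) →
                (Σ X λ a → (At s₀ a × ¬ NC (u ⊔ a)) × F s × (u ⊔ a ⊑ s)) ⊎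
                (Σ X λ a → (At s₀ a × NC (u ⊔ a)) × F s × (u ⊔ a ⊑ s))
              split s (fs , us) with common-atom s s₀ (F-int fs f₀)
              ... | a , ea , as , a₀ with decide (NC (u ⊔ a))
              ... | inj₁ c = inj₂ (a , ((ea , a₀) , c) , fs , ⊔-lub us as)
              ... | inj₂ c = inj₁ (a , ((ea , a₀) , c) , fs , ⊔-lub us as)
              all : count (λ a → At s₀ a × NC (u ⊔ a)) ≤ br q n
              all = ≤-trans (count-mono {Q = At s₀} λ a w → proj₁ w)
                (≤-reflexive (trans (count-At s₀) (cong (br q) (F-rk f₀))))
              few : count (λ a → At s₀ a × ¬ NC (u ⊔ a)) ≤ br q n′
              few = ≤-trans (count-mono {Q = λ a → At s₀ a × (a ⊑ u ⊔ s₁)} λ a w →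
                  proj₁ w , join-hit (proj₁ (proj₁ w)) d₁ (cover-¬Dj (proj₂ w) f₁))
                (count-At-⊓ (λ h → n₁ (⊑-trans ⊔ʳ (rk-eq (⊔-lub ⊔ˡ h) (≤-reflexive
                  (trans (rk-⊔-Dj d₁) (trans (cong (rk u +_) (trans (F-rk f₁) (sym (F-rk f₀)))) (sym (rk-⊔-Dj d₀))))))))
                  (F-rk f₀))

      N-spread : ∀ R u m → rk u + m ≡ n → rk u + R ≡ t → N u * (q ^ (2 + R) * p ^ m) ≤ 2 * q ^ (m * n + m)
      N-spread R u zero e h = ⊥-elim (1+n≰n (≤-trans (≤-reflexive (trans (sym e) (+-identityʳ _)))
        (≤-trans (m≤m+n (rk u) R) (≤-trans (≤-reflexive h) t≤n′))))
      N-spread zero u (suc m) e h = last-step m (trans (sym (+-identityʳ _)) h) e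
      N-spread (suc R) u (suc m) e h = step′ m (2 + R) 2
        (nc u (s≤s (≤-trans (m≤m+n (rk u) _) (≤-reflexive h)))) e
        λ v ev → N-spread R v m (trans (cong (_+ m) ev) (trans (sym (+-suc (rk u) m)) e))
          (trans (cong (_+ R) ev) (trans (sym (+-suc (rk u) R)) h))

    -- If nothing is concentrated, each point gains t + 2 factors q, while a least cover of rank t +
    -- 2 has only about q^(t+1) points. The surplus is one factor q over `ekr`, and the constant 2
    -- is that of the last step.
    hilton-milner : count F * p ^ n ≤ 2 * q ^ (n′ * n + n′)
    hilton-milner with minCover ne
    ... | record { τ = τ ; T = T ; rk-T = et ; T-cover = ct ; none = nc } , τ≤n with τ
    ... | zero = ⊥-elim (1+n≰n (≤-trans (cover-pos ne ct) (≤-reflexive et)))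
    ... | suc zero = ⊥-elim (ct (no-point T et))
    ... | suc (suc t) with search (Concentrated (suc t))
    ... | inj₁ ((u , y) , c) = concentrated-bound (suc t) u y (s≤s z≤n) (≤-pred τ≤n) nc c
    ... | inj₂ h = cancel (2 + t) (≤-trans
        (point-sum T (2 + t) (2 + t) 2 (n′ * n + n′) et (λ s fs → fs , cover-¬Dj ct fs)
          λ a ea → N-spread (suc t) nc (≤-pred τ≤n) (λ u y → h (u , y)) t a n′ (atom-m ea) (cong (_+ t) ea))
        ≤-refl)

-- The case n = 3: the exact bound for nontrivial intersecting families of planes.

-- Pairwise meeting planes of PG(5,q).
module Planes {p : ℕ} (G : Geom p 6)
  (F : Geom.X G → Set) {{F? : ∀ {x} → Dec (F x)}}
  (F-rk : ∀ {s} → F s → Geom.rk G s ≡ 3)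
  (F-int : ∀ {s t} → F s → F t → ¬ GeomProps.Dj G s t) where

  open GeomProps G

  hm : ℕ
  hm = q ^ 5 + 2 * q ^ 4 + 3 * q ^ 3 + 2 * q ^ 2 + q + 1

  N : X → ℕ
  N u = count (λ s → F s × (u ⊑ s))

  B₂ : br q 2 ≤ 2 * q
  B₂ = ≤-trans (br-≤2 1) (≤-reflexive (cong (2 *_) (*-identityʳ q)))
  B₃ : br q 3 ≤ 2 * (q * q)
  B₃ = ≤-trans (br-≤2 2) (≤-reflexive (l q))
    where l : ∀ q → 2 * (q * (q * 1)) ≡ 2 * (q * q)
          l = solve-∀
  B₄ : br q 4 ≤ 2 * (q * q * q)
  B₄ = ≤-trans (br-≤2 3) (≤-reflexive (l q))
    where l : ∀ q → 2 * (q * (q * (q * 1))) ≡ 2 * (q * q * q)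
          l = solve-∀

  Q₃ Q₄ : ℕ
  Q₃ = q * q * q
  Q₄ = q * q * q * q

  Q₃≤Q₄ : Q₃ ≤ Q₄
  Q₃≤Q₄ = m≤m*n Q₃ q

  b₂b₃ : br q 2 * br q 3 ≤ 4 * Q₃
  b₂b₃ = ≤-trans (*-mono-≤ B₂ B₃) (≤-reflexive (l q))
    where l : ∀ q → 2 * q * (2 * (q * q)) ≡ 4 * (q * q * q)
          l = solve-∀

  b₂b₄ : br q 2 * br q 4 ≤ 4 * Q₄
  b₂b₄ = ≤-trans (*-mono-≤ B₂ B₄) (≤-reflexive (l q))
    where l : ∀ q → 2 * q * (2 * (q * q * q)) ≡ 4 * (q * q * q * q)
          l = solve-∀

  b₃b₃ : br q 3 * br q 3 ≤ 4 * Q₄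
  b₃b₃ = ≤-trans (*-mono-≤ B₃ B₃) (≤-reflexive (l q))
    where l : ∀ q → 2 * (q * q) * (2 * (q * q)) ≡ 4 * (q * q * q * q)
          l = solve-∀

  Planes⊒ : X → X → Set
  Planes⊒ ℓ s = F s × (ℓ ⊑ s)

  N-line : ∀ {u} → rk u ≡ 2 → N u ≤ br q 4
  N-line {u} e = ≤-trans
    (count-mono {Q = λ s → (u ⊑ s) × (s ⊑ 𝟙) × (rk s ≡ suc (rk u))} λ s w →
      proj₂ w , 𝟙-max , trans (F-rk (proj₁ w)) (cong suc (sym e)))
    (≤-reflexive (ups 4 𝟙-max (trans (cong (_+ 4) e) (sym rk-𝟙))))

  line-between : ∀ {u y k} → rk u ≡ 2 → rk y ≤ 2 + k → count (λ s → F s × (u ⊑ s) × (s ⊑ y)) ≤ br q k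
  line-between {u} {y} {k} e h with decide (u ⊑ y)
  ... | inj₂ n = ≤-trans (≤-reflexive (count-none λ s w → n (⊑-trans (proj₁ (proj₂ w)) (proj₂ (proj₂ w))))) z≤n
  ... | inj₁ uy = ≤-trans
    (count-mono {Q = λ s → (u ⊑ s) × (s ⊑ y) × (rk s ≡ suc (rk u))} λ s w →
      proj₁ (proj₂ w) , proj₂ (proj₂ w) , trans (F-rk (proj₁ w)) (cong suc (sym e)))
    (≤-trans (≤-reflexive (ups (rk y ∸ rk u) uy (m+[n∸m]≡n (rk-mono uy))))
      (br-mono q (≤-trans (∸-monoʳ-≤ (rk y) (≤-reflexive (sym e))) (∸-monoˡ-≤ 2 h))))

  plane-is : ∀ {s ℓ a} → F s → rk ℓ ≡ 2 → ℓ ⊑ s → a ⊑ s → ¬ (a ⊑ ℓ) → ℓ ⊔ a ≡ s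
  plane-is {s} {ℓ} {a} fs e h k n = ⊑-≡ (⊔-lub h k) (≤-trans (≤-reflexive (F-rk fs))
    (≰⇒> λ le → n (⊑-trans ⊔ʳ (rk-eq ⊔ˡ (≤-trans le (≤-reflexive (sym e)))))))

  two-lines : ∀ {s ℓ ℓ′} → F s → rk ℓ ≡ 2 → rk ℓ′ ≡ 2 → ℓ ⊑ s → ℓ′ ⊑ s → ℓ ≢ ℓ′ → ℓ ⊔ ℓ′ ≡ s
  two-lines fs e e′ h k n = plane-is fs e h k λ le → n (sym (⊑-≡ le (≤-reflexive (trans e (sym e′)))))

  Ln : X → X → X → Set
  Ln P y ℓ = (P ⊑ ℓ) × (ℓ ⊑ y) × (rk ℓ ≡ 2)

  count-Ln : ∀ {P y k} → rk P ≡ 1 → P ⊑ y → rk y ≡ suc k → count (Ln P y) ≡ br q k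
  count-Ln {P} {y} {k} e h ey = trans
    (count-cong (λ ℓ w → proj₁ w , proj₁ (proj₂ w) , trans (proj₂ (proj₂ w)) (cong suc (sym e)))
                (λ ℓ w → proj₁ w , proj₁ (proj₂ w) , trans (proj₂ (proj₂ w)) (cong suc e)))
    (ups k h (trans (cong (_+ k) e) (sym ey)))

  Ln-≤ : ∀ {P y k} → rk P ≡ 1 → rk y ≤ suc k → count (Ln P y) ≤ br q k
  Ln-≤ {P} {y} {k} e h with decide (P ⊑ y)
  ... | inj₂ n = ≤-trans (≤-reflexive (count-none λ ℓ w → n (⊑-trans (proj₁ w) (proj₁ (proj₂ w))))) z≤n
  ... | inj₁ py with rk y in ey
  ...   | zero = ⊥-elim (1+n≰n (≤-trans (≤-reflexive (sym e)) (≤-trans (rk-mono py) (≤-reflexive ey))))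
  ...   | suc j = ≤-trans (≤-reflexive (count-Ln e py ey)) (br-mono q (≤-pred h))

  pair-bound : {P : X → Set} {{P? : ∀ {s} → Dec (P s)}} {A B : X → Set}
    {{A? : ∀ {s} → Dec (A s)}} {{B? : ∀ {s} → Dec (B s)}} →
    (∀ s → P s → Σ X λ a → Σ X λ b → A a × B b × (s ≡ a ⊔ b)) → count P ≤ count A * count B
  pair-bound {P} {A} {B} h = ≤-trans
    (cover-≤ {D = A} {Q = λ a s → Σ X λ b → B b × (s ≡ a ⊔ b)} {{Q? = dec-∃}} {b = count B * 1}
      (λ s w → let (a , b , wa , wb , e) = h s w in a , wa , b , wb , e) ≤-refl
      λ a _ → cover-≤ {P = λ s → Σ X λ b → B b × (s ≡ a ⊔ b)} {{P? = dec-∃}} {D = B} {Q = λ b s → s ≡ a ⊔ b} (λ s w → w) ≤-refl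
        λ b _ → count-≤1 (a ⊔ b) λ s e → e)
    (≤-reflexive (cong (count A *_) (*-identityʳ _)))

  ∪-≤ : ∀ {Y A B : X → Set} {{_ : ∀ {u} → Dec (A u)}} {{_ : ∀ {u} → Dec (B u)}} {{_ : ∀ {u} → Dec (Y u)}} {a b} →
    (∀ u → Y u → A u ⊎ B u) → count A ≤ a → count B ≤ b → count Y ≤ a + b
  ∪-≤ {A = A} {B} f h k = ≤-trans (count-∪ {P = A} {Q = B} f) (+-mono-≤ h k)

  module Point (P : X) (eP : rk P ≡ 1) where

    Off : X → Set
    Off s = F s × ¬ (P ⊑ s)

    rk-D : ∀ {s} → Off s → rk (P ⊔ s) ≡ 4
    rk-D {s} (fs , n) = trans (rk-⊔-Dj (Dj-sym (atom-Dj eP n))) (cong₂ _+_ eP (F-rk fs))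

    line-of : ∀ {s t} → F s → P ⊑ s → Off t → Σ X λ ℓ → Ln P (P ⊔ t) ℓ × (ℓ ⊑ s)
    line-of {s} {t} fs ps (ft , n) with common-atom s t (F-int fs ft)
    ... | a , ea , as , at = P ⊔ a ,
          (⊔ˡ , ⊔-mono ⊑-refl at , trans (rk-⊔-atom ea (λ h → n (subst (_⊑ t) (⊑-≡ h (≤-reflexive (trans eP (sym ea)))) at)))
            (cong suc eP)) , ⊔-lub ps as

    count-Ln-D : ∀ {t} → Off t → count (Ln P (P ⊔ t)) ≡ br q 3
    count-Ln-D o = count-Ln eP ⊔ˡ (rk-D o)

    -- Of the `br q 4` planes of the solid, `br q 3` contain P, and the difference is q^3.
    off-in : ∀ {t} → Off t → count (λ s → Off s × (s ⊑ P ⊔ t)) ≤ q ^ 3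
    off-in {t} o = +-cancelʳ-≤ (br q 3) _ _ (≤-trans
        (≤-reflexive (cong (count (λ s → Off s × (s ⊑ D)) +_) (sym (dns {P} {D} 3 ⊔ˡ (trans (cong (_+ 3) eP) (sym (rk-D o)))))))
        (≤-trans (+-monoˡ-≤ _ (count-mono {Q = λ s → ((𝟘 ⊑ s) × (s ⊑ D) × (suc (rk s) ≡ rk D)) × ¬ (P ⊑ s)}
            λ s w → (𝟘-min , proj₂ w , trans (cong suc (F-rk (proj₁ (proj₁ w)))) (sym (rk-D o))) , proj₂ (proj₁ w)))
          (≤-trans (≤-reflexive (sym (count-⊎ {R = λ s → (𝟘 ⊑ s) × (s ⊑ D) × (suc (rk s) ≡ rk D)}
              split (λ s w → proj₁ w) (λ s w → 𝟘-min , proj₂ w) (λ s w v → proj₂ w (proj₁ v)))))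
            (≤-reflexive (trans (dns 4 𝟘-min (trans (cong (_+ 4) rk-𝟘) (sym (rk-D o)))) (+-comm (br q 3) (q ^ 3)))))))
      where
        D = P ⊔ t
        split : ∀ s → (𝟘 ⊑ s) × (s ⊑ D) × (suc (rk s) ≡ rk D) →
          (((𝟘 ⊑ s) × (s ⊑ D) × (suc (rk s) ≡ rk D)) × ¬ (P ⊑ s)) ⊎ ((P ⊑ s) × (s ⊑ D) × (suc (rk s) ≡ rk D))
        split s w with decide (P ⊑ s)
        ... | inj₁ h = inj₂ (h , proj₂ w)
        ... | inj₂ h = inj₁ (w , h)

    -- The Hilton–Milner configuration.
    all-in-solid : ∀ {t} → Off t → (∀ s → Off s → s ⊑ P ⊔ t) → count F ≤ hm
    all-in-solid {t} o h = begin
        count F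
          ≤⟨ count-∪ {P = λ s → F s × (P ⊑ s)} {Q = λ s → Off s × (s ⊑ D)} split₁ ⟩
        count (λ s → F s × (P ⊑ s)) + count (λ s → Off s × (s ⊑ D))
          ≤⟨ +-mono-≤ (count-∪ {P = λ s → (P ⊑ s) × (s ⊑ D) × (suc (rk s) ≡ rk D)} {Q = λ s → F s × (P ⊑ s) × ¬ (s ⊑ D)} split₂) (off-in o) ⟩
        count (λ s → (P ⊑ s) × (s ⊑ D) × (suc (rk s) ≡ rk D)) + count (λ s → F s × (P ⊑ s) × ¬ (s ⊑ D)) + q ^ 3
          ≤⟨ +-monoˡ-≤ (q ^ 3) (+-mono-≤ (≤-reflexive (dns 3 ⊔ˡ (trans (cong (_+ 3) eP) (sym (rk-D o)))))
               (cover-≤ {D = Ln P D} {Q = λ ℓ s → ((ℓ ⊑ s) × (s ⊑ 𝟙) × (rk s ≡ suc (rk ℓ))) × ¬ (s ⊑ D)}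
                 (λ s w → let (ℓ , lℓ , ℓs) = line-of (proj₁ w) (proj₁ (proj₂ w)) o in
                   ℓ , lℓ , (ℓs , 𝟙-max , trans (F-rk (proj₁ w)) (cong suc (sym (proj₂ (proj₂ lℓ))))) , proj₂ (proj₂ w))
                 (≤-reflexive (count-Ln-D o)) per-line)) ⟩
        br q 3 + br q 3 * (q ^ 2 + q ^ 3) + q ^ 3
          ≡⟨ l q ⟩
        hm ∎
      where
        open ≤-Reasoning
        D = P ⊔ t
        l : ∀ q → 0 + 1 + q * 1 + q * (q * 1) + (0 + 1 + q * 1 + q * (q * 1)) * (q * (q * 1) + q * (q * (q * 1))) + q * (q * (q * 1)) ≡
          q * (q * (q * (q * (q * 1)))) + 2 * (q * (q * (q * (q * 1)))) + 3 * (q * (q * (q * 1))) + 2 * (q * (q * 1)) + q + 1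
        l = solve-∀
        split₁ : ∀ s → F s → (F s × (P ⊑ s)) ⊎ (Off s × (s ⊑ D))
        split₁ s fs with decide (P ⊑ s)
        ... | inj₁ k = inj₁ (fs , k)
        ... | inj₂ k = inj₂ ((fs , k) , h s (fs , k))
        split₂ : ∀ s → F s × (P ⊑ s) → ((P ⊑ s) × (s ⊑ D) × (suc (rk s) ≡ rk D)) ⊎ (F s × (P ⊑ s) × ¬ (s ⊑ D))
        split₂ s (fs , k) with decide (s ⊑ D)
        ... | inj₁ k′ = inj₁ (k , k′ , trans (cong suc (F-rk fs)) (sym (rk-D o)))
        ... | inj₂ k′ = inj₂ (fs , k , k′)
        per-line : ∀ ℓ → Ln P D ℓ → count (λ s → ((ℓ ⊑ s) × (s ⊑ 𝟙) × (rk s ≡ suc (rk ℓ))) × ¬ (s ⊑ D)) ≤ q ^ 2 + q ^ 3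
        per-line ℓ (_ , ℓD , eℓ) = +-cancelʳ-≤ (br q 2) _ _ (≤-reflexive (trans
            (cong (count (λ s → ((ℓ ⊑ s) × (s ⊑ 𝟙) × (rk s ≡ suc (rk ℓ))) × ¬ (s ⊑ D)) +_)
              (sym (ups 2 ℓD (trans (cong (_+ 2) eℓ) (sym (rk-D o))))))
            (trans (sym (count-⊎ {R = λ s → (ℓ ⊑ s) × (s ⊑ 𝟙) × (rk s ≡ suc (rk ℓ))} sp
                (λ s w → proj₁ w) (λ s w → proj₁ w , 𝟙-max , proj₂ (proj₂ w)) (λ s w v → proj₂ w (proj₁ (proj₂ v)))))
              (trans (ups 4 𝟙-max (trans (cong (_+ 4) eℓ) (sym rk-𝟙))) (l′ (br q 2) (q ^ 2) (q ^ 3))))))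
          where
            l′ : ∀ a b c → a + b + c ≡ b + c + a
            l′ = solve-∀
            sp : ∀ s → (ℓ ⊑ s) × (s ⊑ 𝟙) × (rk s ≡ suc (rk ℓ)) →
              (((ℓ ⊑ s) × (s ⊑ 𝟙) × (rk s ≡ suc (rk ℓ))) × ¬ (s ⊑ D)) ⊎ ((ℓ ⊑ s) × (s ⊑ D) × (rk s ≡ suc (rk ℓ)))
            sp s w with decide (s ⊑ D)
            ... | inj₁ k = inj₂ (proj₁ w , k , proj₂ (proj₂ w))
            ... | inj₂ k = inj₁ (w , k)

    rk-DD : ∀ {s t} → Off s → Off t → ¬ (s ⊑ P ⊔ t) → rk ((P ⊔ t) ⊓ (P ⊔ s)) ≤ 3
    rk-DD os ot n = ≤-pred (≤-trans (rk-⊓-proper λ h → n (⊑-trans ⊔ʳ (rk-eq h (≤-reflexive (trans (rk-D os) (sym (rk-D ot)))))))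
      (≤-reflexive (rk-D ot)))

    -- A member through P has a line through P in each solid. If the two lines agree, they lie in
    -- the intersection, of rank at most 3; otherwise they span the member.
    two-solids : ∀ {s t} → Off s → Off t → ¬ (t ⊑ P ⊔ s) → N P ≤ 8 * Q₄
    two-solids {s} {t} os ot n = ≤-trans
        (count-∪ {P = λ u → Σ X λ ℓ → Ln P (D ⊓ D′) ℓ × Planes⊒ ℓ u}
                 {Q = λ u → Σ X λ a → Σ X λ b → Ln P D a × Ln P D′ b × (u ≡ a ⊔ b)} {{dec-∃}} {{dec-∃ {{P? = dec-∃}}}} split)
        (≤-trans (+-mono-≤
          (≤-trans (cover-≤ {P = λ u → Σ X λ ℓ → Ln P (D ⊓ D′) ℓ × Planes⊒ ℓ u} {{P? = dec-∃}} (λ u w → w)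
              (Ln-≤ eP (rk-DD ot os n)) λ ℓ w → N-line (proj₂ (proj₂ w))) b₂b₄)
          (≤-trans (pair-bound {P = λ u → Σ X λ a → Σ X λ b → Ln P D a × Ln P D′ b × (u ≡ a ⊔ b)} {{P? = dec-∃ {{P? = dec-∃}}}} (λ u w → w))
            (≤-trans (≤-reflexive (cong₂ _*_ (count-Ln-D os) (count-Ln-D ot))) b₃b₃)))
          (≤-reflexive (l Q₄)))
      where
        D = P ⊔ s
        D′ = P ⊔ t
        l : ∀ x → 4 * x + 4 * x ≡ 8 * x
        l = solve-∀
        split : ∀ u → F u × (P ⊑ u) → (Σ X λ ℓ → Ln P (D ⊓ D′) ℓ × Planes⊒ ℓ u) ⊎
          (Σ X λ a → Σ X λ b → Ln P D a × Ln P D′ b × (u ≡ a ⊔ b))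
        split u (fu , pu) with line-of fu pu os | line-of fu pu ot
        ... | ℓ , wℓ , ℓu | m , wm , mu with decide (ℓ ≡ m)
        ... | inj₁ refl = inj₁ (ℓ , (proj₁ wℓ , ⊓-glb (proj₁ (proj₂ wℓ)) (proj₁ (proj₂ wm)) , proj₂ (proj₂ wℓ)) , fu , ℓu)
        ... | inj₂ ne = inj₂ (ℓ , m , wℓ , wm , sym (two-lines fu (proj₂ (proj₂ wℓ)) (proj₂ (proj₂ wm)) ℓu mu ne))

    point-dichotomy : Σ X Off → count F ≤ hm ⊎ N P ≤ 8 * Q₄
    point-dichotomy (t , o) with search (λ s → Off s × ¬ (s ⊑ P ⊔ t))
    ... | inj₂ h = inj₁ (all-in-solid o λ s os → stable λ n → h s (os , n))
    ... | inj₁ (s , os , n) = inj₂ (two-solids o os n)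

    -- A member through P has a line through P in each of the three solids. Unless the solids share
    -- a plane or lie in one hyperplane, these lines leave only O(q^3) members; the cases are sorted
    -- by which of the other solids contain the line taken in `D₁`.
    three-solids : ∀ {s₁ s₂ s₃} → Off s₁ → Off s₂ → Off s₃ →
      ¬ (s₂ ⊑ P ⊔ s₁) → ¬ (s₃ ⊑ P ⊔ s₁) → ¬ (s₃ ⊑ P ⊔ s₂) →
      let D₁ = P ⊔ s₁ ; D₂ = P ⊔ s₂ ; D₃ = P ⊔ s₃ in
      (3 ≤ rk (D₁ ⊓ D₂ ⊓ D₃)) ⊎ ((D₁ ⊑ D₂ ⊔ D₃) × (rk (D₂ ⊔ D₃) ≤ 5)) ⊎ (N P ≤ 18 * Q₃)
    three-solids {s₁} {s₂} {s₃} o₁ o₂ o₃ n₂ n₃ n₂₃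
      with decide (3 ≤ rk ((P ⊔ s₁) ⊓ (P ⊔ s₂) ⊓ (P ⊔ s₃)))
         | decide ((P ⊔ s₁ ⊑ (P ⊔ s₂) ⊔ (P ⊔ s₃)) × (rk ((P ⊔ s₂) ⊔ (P ⊔ s₃)) ≤ 5))
    ... | inj₁ h | _ = inj₁ h
    ... | inj₂ _ | inj₁ h = inj₂ (inj₁ h)
    ... | inj₂ nb | inj₂ nc = inj₂ (inj₂ bound)
      where
        D₁ = P ⊔ s₁
        D₂ = P ⊔ s₂
        D₃ = P ⊔ s₃
        -- The exceptional lines: both joins have rank at most 5, so here they coincide and equal
        -- `D₂ ⊔ D₃`. Then ℓ lies in `D₁ ⊓ (D₂ ⊔ D₃)`, a proper subspace of `D₁`, which leaves at
        -- most `br q 2` such lines.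
        Tri : X → Set
        Tri ℓ = Ln P D₁ ℓ × (5 ≤ rk ((ℓ ⊔ D₂) ⊓ (ℓ ⊔ D₃)))
        E : X → X
        E ℓ = (ℓ ⊔ D₂) ⊓ (ℓ ⊔ D₃)
        C₁ C₂ C₃ C₄ C₅ : X → Set
        C₁ u = Σ X λ ℓ → Ln P (D₁ ⊓ D₂ ⊓ D₃) ℓ × Planes⊒ ℓ u
        C₂ u = Σ X λ a → Σ X λ b → Ln P (D₁ ⊓ D₂) a × Ln P D₃ b × (u ≡ a ⊔ b)
        C₃ u = Σ X λ a → Σ X λ b → Ln P (D₁ ⊓ D₃) a × Ln P D₂ b × (u ≡ a ⊔ b)
        C₄ u = Σ X λ ℓ → (Ln P D₁ ℓ × (rk (E ℓ) ≤ 4)) × F u × (ℓ ⊑ u) × (u ⊑ E ℓ)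
        C₅ u = Σ X λ ℓ → Tri ℓ × F u × (ℓ ⊑ u) × (u ⊑ E ℓ)
        instance
          i₁ : ∀ {u} → Dec (C₁ u)
          i₁ = dec-∃
          i₂ : ∀ {u} → Dec (C₂ u)
          i₂ = dec-∃ {{P? = dec-∃}}
          i₃ : ∀ {u} → Dec (C₃ u)
          i₃ = dec-∃ {{P? = dec-∃}}
          i₄ : ∀ {u} → Dec (C₄ u)
          i₄ = dec-∃
          i₅ : ∀ {u} → Dec (C₅ u)
          i₅ = dec-∃
        split : ∀ u → F u × (P ⊑ u) → C₁ u ⊎ C₂ u ⊎ C₃ u ⊎ C₄ u ⊎ C₅ u
        split u (fu , pu) with line-of fu pu o₁ | line-of fu pu o₂ | line-of fu pu o₃
        ... | ℓ , (pℓ , ℓD , eℓ) , ℓu | m , wm , mu | k , wk , ku with decide (ℓ ⊑ D₂) | decide (ℓ ⊑ D₃)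
        ... | inj₁ h₂ | inj₁ h₃ = inj₁ (ℓ , (pℓ , ⊓-glb ℓD (⊓-glb h₂ h₃) , eℓ) , fu , ℓu)
        ... | inj₁ h₂ | inj₂ h₃ = inj₂ (inj₁ (ℓ , k , (pℓ , ⊓-glb ℓD h₂ , eℓ) , wk ,
                sym (two-lines fu eℓ (proj₂ (proj₂ wk)) ℓu ku λ { refl → h₃ (proj₁ (proj₂ wk)) })))
        ... | inj₂ h₂ | inj₁ h₃ = inj₂ (inj₂ (inj₁ (ℓ , m , (pℓ , ⊓-glb ℓD h₃ , eℓ) , wm ,
                sym (two-lines fu eℓ (proj₂ (proj₂ wm)) ℓu mu λ { refl → h₂ (proj₁ (proj₂ wm)) }))))
        ... | inj₂ h₂ | inj₂ h₃ = inj₂ (inj₂ (inj₂ (fin (decide (rk (E ℓ) ≤ 4)))))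
          where
            uE : u ⊑ E ℓ
            uE = ⊓-glb
              (subst (_⊑ ℓ ⊔ D₂) (two-lines fu eℓ (proj₂ (proj₂ wm)) ℓu mu λ { refl → h₂ (proj₁ (proj₂ wm)) })
                (⊔-mono ⊑-refl (proj₁ (proj₂ wm))))
              (subst (_⊑ ℓ ⊔ D₃) (two-lines fu eℓ (proj₂ (proj₂ wk)) ℓu ku λ { refl → h₃ (proj₁ (proj₂ wk)) })
                (⊔-mono ⊑-refl (proj₁ (proj₂ wk))))
            fin : (rk (E ℓ) ≤ 4) ⊎ ¬ (rk (E ℓ) ≤ 4) → C₄ u ⊎ C₅ u
            fin (inj₁ h) = inj₁ (ℓ , ((pℓ , ℓD , eℓ) , h) , fu , ℓu , uE)
            fin (inj₂ h) = inj₂ (ℓ , ((pℓ , ℓD , eℓ) , ≰⇒> h) , fu , ℓu , uE)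
        rk-join : ∀ ℓ {D} → P ⊑ ℓ → rk ℓ ≡ 2 → P ⊑ D → rk D ≡ 4 → rk (ℓ ⊔ D) ≤ 5
        rk-join ℓ {D} pℓ eℓ pD eD = +-cancelʳ-≤ 1 _ _ (≤-trans
          (+-monoʳ-≤ (rk (ℓ ⊔ D)) (≤-trans (≤-reflexive (sym eP)) (rk-mono (⊓-glb pℓ pD))))
          (≤-reflexive (trans (rk-mod ℓ D) (cong₂ _+_ eℓ eD))))
        b₄ : ∀ ℓ → Ln P D₁ ℓ × (rk (E ℓ) ≤ 4) → count (λ u → F u × (ℓ ⊑ u) × (u ⊑ E ℓ)) ≤ br q 2
        b₄ ℓ w = line-between (proj₂ (proj₂ (proj₁ w))) (proj₂ w)
        b₅ : ∀ ℓ → Tri ℓ → count (λ u → F u × (ℓ ⊑ u) × (u ⊑ E ℓ)) ≤ br q 3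
        b₅ ℓ ((pℓ , ℓD , eℓ) , _) = line-between eℓ (≤-trans (rk-mono ⊓ˡ) (rk-join ℓ pℓ eℓ ⊔ˡ (rk-D o₂)))
        tri-few : count Tri ≤ br q 2
        tri-few with search Tri
        ... | inj₂ h = ≤-trans (≤-reflexive (count-none h)) z≤n
        ... | inj₁ (ℓ₀ , t₀) = ≤-trans (count-mono {Q = Ln P (D₁ ⊓ (D₂ ⊔ D₃))}
                λ ℓ t → proj₁ (proj₁ t) , ⊓-glb (proj₁ (proj₂ (proj₁ t))) (inside ℓ t) , proj₂ (proj₂ (proj₁ t)))
              (Ln-≤ eP (≤-pred (≤-trans (rk-⊓-proper λ h → nc (h , rank₅)) (≤-reflexive (rk-D o₁)))))
          where
            same : ∀ ℓ → Tri ℓ → D₂ ⊔ D₃ ⊑ ℓ ⊔ D₂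
            same ℓ ((pℓ , ℓD , eℓ) , h) = ⊔-lub ⊔ʳ
              (⊑-trans ⊔ʳ (⊑-trans (rk-eq ⊓ʳ (≤-trans (rk-join ℓ pℓ eℓ ⊔ˡ (rk-D o₃)) h)) ⊓ˡ))
            rank₅ : rk (D₂ ⊔ D₃) ≤ 5
            rank₅ = ≤-trans (rk-mono (same ℓ₀ t₀))
              (rk-join ℓ₀ (proj₁ (proj₁ t₀)) (proj₂ (proj₂ (proj₁ t₀))) ⊔ˡ (rk-D o₂))
            rank₅′ : 5 ≤ rk (D₂ ⊔ D₃)
            rank₅′ = ≰⇒> λ le → n₂₃ (⊑-trans ⊔ʳ (⊑-trans ⊔ʳ (rk-eq ⊔ˡ (≤-trans le (≤-reflexive (sym (rk-D o₂)))))))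
            inside : ∀ ℓ → Tri ℓ → ℓ ⊑ D₂ ⊔ D₃
            inside ℓ t@((pℓ , ℓD , eℓ) , h) = ⊑-trans ⊔ˡ
              (rk-eq (same ℓ t) (≤-trans (rk-join ℓ pℓ eℓ ⊔ˡ (rk-D o₂)) rank₅′))
        bound : N P ≤ 18 * Q₃
        bound = ≤-trans
          (∪-≤ {A = C₁} {B = λ u → C₂ u ⊎ C₃ u ⊎ C₄ u ⊎ C₅ u} split
            (≤-trans (cover-≤ {P = C₁} (λ u w → w) (Ln-≤ {k = 1} eP (≤-pred (≰⇒> nb))) λ ℓ w → N-line (proj₂ (proj₂ w)))
              (≤-trans (≤-reflexive (*-identityˡ (br q 4))) B₄))
          (∪-≤ {A = C₂} {B = λ u → C₃ u ⊎ C₄ u ⊎ C₅ u} (λ u w → w)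
            (≤-trans (pair-bound {P = C₂} λ u w → w)
              (≤-trans (*-mono-≤ (Ln-≤ {k = 2} eP (rk-DD o₂ o₁ n₂)) (≤-reflexive (count-Ln-D o₃))) b₂b₃))
          (∪-≤ {A = C₃} {B = λ u → C₄ u ⊎ C₅ u} (λ u w → w)
            (≤-trans (pair-bound {P = C₃} λ u w → w)
              (≤-trans (*-mono-≤ (Ln-≤ {k = 2} eP (rk-DD o₃ o₁ n₃)) (≤-reflexive (count-Ln-D o₂))) b₂b₃))
          (∪-≤ {A = C₄} {B = C₅} (λ u w → w)
            (≤-trans (cover-≤ {P = C₄} (λ u w → w)
                (≤-trans (count-mono {Q = Ln P D₁} λ ℓ w → proj₁ w) (≤-reflexive (count-Ln-D o₁))) b₄)
              (≤-trans (≤-reflexive (*-comm (br q 3) (br q 2))) b₂b₃))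
            (≤-trans (cover-≤ {P = C₅} (λ u w → w) tri-few b₅) b₂b₃)))))
          (≤-reflexive (l Q₃))
          where l : ∀ x → 2 * x + (4 * x + (4 * x + (4 * x + 4 * x))) ≡ 18 * x
                l = solve-∀

    -- If every member has at least a line in M, the count is that of M together with all planes
    -- meeting M in a line, which is again exactly `hm`. Otherwise some `s₅` meets M in at most a
    -- point, and every member is pinned down by a line of M and `s₅`, or by lines of the first two
    -- solids.
    type-M : ∀ {M s₁ s₂} → rk M ≡ 3 → P ⊑ M → Off s₁ → Off s₂ →
      (P ⊔ s₁) ⊓ (P ⊔ s₂) ⊑ M → (∀ s → Off s → M ⊑ P ⊔ s) → count F ≤ hm ⊎ count F ≤ 16 * Q₄
    type-M {M} {s₁} {s₂} eM pM o₁ o₂ DDM h with search (λ s → F s × ¬ (2 ≤ rk (s ⊓ M)))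
    ... | inj₂ all = inj₁ (begin
        count F
          ≤⟨ count-∪ {P = λ s → s ≡ M} {Q = λ s → Σ X λ ℓ → Line ℓ × Near ℓ s} {{it}} {{dec-∃}} split ⟩
        count (λ s → s ≡ M) + count (λ s → Σ X λ ℓ → Line ℓ × Near ℓ s) {{dec-∃}}
          ≤⟨ +-mono-≤ (≤-reflexive (count-≡ M)) (cover-≤ {P = λ s → Σ X λ ℓ → Line ℓ × Near ℓ s} {{dec-∃}} (λ s w → w)
               (≤-reflexive lines) near) ⟩
        1 + br q 3 * (q + q ^ 2 + q ^ 3)
          ≡⟨ l q ⟩
        hm ∎)
      where
        open ≤-Reasoning
        it : {x y : X} → Dec (x ≡ y)
        it {x} {y} = x ≟ y
        Line : X → Set
        Line ℓ = (𝟘 ⊑ ℓ) × (ℓ ⊑ M) × (suc (rk ℓ) ≡ rk M)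
        Near : X → X → Set
        Near ℓ s = ((ℓ ⊑ s) × (s ⊑ 𝟙) × (rk s ≡ suc (rk ℓ))) × ¬ (s ≡ M)
        lines : count Line ≡ br q 3
        lines = dns 3 𝟘-min (trans (cong (_+ 3) rk-𝟘) (sym eM))
        l : ∀ q → 1 + (0 + 1 + q * 1 + q * (q * 1)) * (q + q * (q * 1) + q * (q * (q * 1))) ≡
          q * (q * (q * (q * (q * 1)))) + 2 * (q * (q * (q * (q * 1)))) + 3 * (q * (q * (q * 1))) + 2 * (q * (q * 1)) + q + 1
        l = solve-∀
        l′ : ∀ q → 0 + 1 + q * 1 + q * (q * 1) + q * (q * (q * 1)) ≡ q + q * (q * 1) + q * (q * (q * 1)) + 1
        l′ = solve-∀
        split : ∀ s → F s → (s ≡ M) ⊎ (Σ X λ ℓ → Line ℓ × Near ℓ s)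
        split s fs with decide (s ≡ M)
        ... | inj₁ e = inj₁ e
        ... | inj₂ n with sub-of-rank {𝟘} {s ⊓ M} 2 (rk (s ⊓ M) ∸ 2) 𝟘-min (≤-trans (≤-reflexive rk-𝟘) z≤n)
                            (sym (m+[n∸m]≡n (stable λ k → all s (fs , k))))
        ... | ℓ , z , ℓsM , eℓ = inj₂ (ℓ , (z , ⊑-trans ℓsM ⊓ʳ , trans (cong suc eℓ) (sym eM)) ,
                (⊑-trans ℓsM ⊓ˡ , 𝟙-max , trans (F-rk fs) (cong suc (sym eℓ))) , n)
        near : ∀ ℓ → Line ℓ → count (Near ℓ) ≤ q + q ^ 2 + q ^ 3
        near ℓ (_ , ℓM , eℓ) = +-cancelʳ-≤ 1 _ _ (≤-reflexive (trans
          (trans (cong (count (Near ℓ) +_) (sym (count-≡ M)))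
            (sym (count-⊎ {P = Near ℓ} {Q = λ s → s ≡ M} {R = λ s → (ℓ ⊑ s) × (s ⊑ 𝟙) × (rk s ≡ suc (rk ℓ))}
              (λ s w → case decide (s ≡ M) of λ { (inj₁ e) → inj₂ e ; (inj₂ n) → inj₁ (w , n) })
              (λ s w → proj₁ w) (λ { s refl → ℓM , 𝟙-max , sym eℓ }) (λ s w → proj₂ w))))
          (trans (ups 4 𝟙-max (trans (cong (_+ 4) (suc-injective (trans eℓ eM))) (sym rk-𝟙))) (l′ q))))
    ... | inj₁ (s₅ , f₅ , n₅) = inj₂ (begin
        count F
          ≤⟨ ∪-≤ {A = C₁} {B = λ s → C₂ s ⊎ C₃ s} split
               (≤-trans (cover-≤ {P = C₁} (λ s w → w) thru λ ℓ w → N-line (proj₂ (proj₂ (proj₂ w)))) b₂b₄)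
               (∪-≤ {A = C₂} {B = C₃} (λ s w → w)
                 (≤-trans (pair-bound {P = C₂} λ s w → w) (≤-trans (*-mono-≤ (≤-reflexive lines)
                   (≤-reflexive (trans (count-At s₅) (cong (br q) (F-rk f₅))))) b₃b₃))
                 (≤-trans (pair-bound {P = C₃} λ s w → w)
                   (≤-trans (≤-reflexive (cong₂ _*_ (count-Ln-D o₁) (count-Ln-D o₂))) b₃b₃))) ⟩
        4 * Q₄ + (4 * Q₄ + 4 * Q₄) ≡⟨ l Q₄ ⟩
        12 * Q₄ ≤⟨ *-monoˡ-≤ Q₄ (m≤m+n 12 4) ⟩
        16 * Q₄ ∎)
      where
        open ≤-Reasoning
        l : ∀ x → 4 * x + (4 * x + 4 * x) ≡ 12 * x
        l = solve-∀
        Line Thru : X → Set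
        Line ℓ = (𝟘 ⊑ ℓ) × (ℓ ⊑ M) × (suc (rk ℓ) ≡ rk M)
        Thru ℓ = (rk (s₅ ⊓ M) ≡ 1) × Ln (s₅ ⊓ M) M ℓ
        lines : count Line ≡ br q 3
        lines = dns 3 𝟘-min (trans (cong (_+ 3) rk-𝟘) (sym eM))
        thru : count Thru ≤ br q 2
        thru with decide (rk (s₅ ⊓ M) ≡ 1)
        ... | inj₁ e = ≤-trans (count-mono λ ℓ w → proj₂ w) (Ln-≤ {s₅ ⊓ M} e (≤-reflexive eM))
        ... | inj₂ n = ≤-trans (≤-reflexive (count-none λ ℓ w → n (proj₁ w))) z≤n
        C₁ C₂ C₃ : X → Set
        C₁ s = Σ X λ ℓ → Thru ℓ × Planes⊒ ℓ s
        C₂ s = Σ X λ ℓ → Σ X λ a → Line ℓ × At s₅ a × (s ≡ ℓ ⊔ a)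
        C₃ s = Σ X λ a → Σ X λ b → Ln P (P ⊔ s₁) a × Ln P (P ⊔ s₂) b × (s ≡ a ⊔ b)
        instance
          i₁ : ∀ {u} → Dec (C₁ u)
          i₁ = dec-∃
          i₂ : ∀ {u} → Dec (C₂ u)
          i₂ = dec-∃ {{P? = dec-∃}}
          i₃ : ∀ {u} → Dec (C₃ u)
          i₃ = dec-∃ {{P? = dec-∃}}
        heavy : ∀ s → F s → 2 ≤ rk (s ⊓ M) → C₁ s ⊎ C₂ s
        heavy s fs k with sub-of-rank {𝟘} {s ⊓ M} 2 (rk (s ⊓ M) ∸ 2) 𝟘-min (≤-trans (≤-reflexive rk-𝟘) z≤n) (sym (m+[n∸m]≡n k))
        ... | ℓ , z , ℓsM , eℓ with decide (Dj ℓ s₅)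
        ... | inj₁ dj = let (a , ea , as , a₅) = common-atom s s₅ (F-int fs f₅) in
                inj₂ (ℓ , a , (z , ⊑-trans ℓsM ⊓ʳ , trans (cong suc eℓ) (sym eM)) , (ea , a₅) ,
                  sym (plane-is fs eℓ (⊑-trans ℓsM ⊓ˡ) as (Dj-atom⊑ (≤-reflexive (sym ea)) dj a₅)))
        ... | inj₂ nd = let (c , ec , cℓ , c₅) = common-atom ℓ s₅ nd
                            e = ⊑-≡ (⊓-glb c₅ (⊑-trans cℓ (⊑-trans ℓsM ⊓ʳ))) (≤-trans (≤-pred (≰⇒> n₅)) (≤-reflexive (sym ec))) in
                inj₁ (ℓ , (trans (cong rk (sym e)) ec , subst (_⊑ ℓ) e cℓ , ⊑-trans ℓsM ⊓ʳ , eℓ) , fs , ⊑-trans ℓsM ⊓ˡ)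
        light : ∀ s → F s → ¬ (2 ≤ rk (s ⊓ M)) → C₃ s
        light s fs k with decide (P ⊑ s)
        -- If `s` missed P, then `s` and M would be planes of the solid `P ⊔ s` and share a line.
        ... | inj₂ n = ⊥-elim (k (+-cancelˡ-≤ 4 _ _ (≤-trans (≤-reflexive (sym (cong₂ _+_ (F-rk fs) eM)))
                (≤-trans (rk-⊓-≥ ⊔ʳ (h s (fs , n))) (≤-reflexive (cong (_+ rk (s ⊓ M)) (rk-D (fs , n))))))))
        ... | inj₁ ps with line-of fs ps o₁ | line-of fs ps o₂
        ... | a , wa , as | b , wb , bs = a , b , wa , wb ,
                sym (two-lines fs (proj₂ (proj₂ wa)) (proj₂ (proj₂ wb)) as bs λ { refl →
                  k (≤-trans (≤-reflexive (sym (proj₂ (proj₂ wa))))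
                    (rk-mono (⊓-glb as (⊑-trans (⊓-glb (proj₁ (proj₂ wa)) (proj₁ (proj₂ wb))) DDM)))) })
        split : ∀ s → F s → C₁ s ⊎ C₂ s ⊎ C₃ s
        split s fs with decide (2 ≤ rk (s ⊓ M))
        ... | inj₂ k = inj₂ (inj₂ (light s fs k))
        ... | inj₁ k with heavy s fs k
        ... | inj₁ x = inj₁ x
        ... | inj₂ x = inj₂ (inj₁ x)

    -- Such a member contains P. Its lines in the two solids lie in H, so they coincide; two
    -- different ones would span the member inside H.
    outside-H : ∀ {s₁ s₂ H} → Off s₁ → Off s₂ → ¬ (s₂ ⊑ P ⊔ s₁) → P ⊔ s₁ ⊑ H → P ⊔ s₂ ⊑ H →
      (∀ s → Off s → s ⊑ H) → count (λ s → F s × ¬ (s ⊑ H)) ≤ 4 * Q₄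
    outside-H {s₁} {s₂} {H} o₁ o₂ n₂ h₁ h₂ h = ≤-trans
        (cover-≤ {D = Ln P ((P ⊔ s₁) ⊓ (P ⊔ s₂))} {Q = Planes⊒} f (Ln-≤ {k = 2} eP (rk-DD o₂ o₁ n₂))
          λ ℓ w → N-line (proj₂ (proj₂ w))) b₂b₄
      where
        f : ∀ s → F s × ¬ (s ⊑ H) → Σ X λ ℓ → Ln P ((P ⊔ s₁) ⊓ (P ⊔ s₂)) ℓ × Planes⊒ ℓ s
        f s (fs , n) with stable {P ⊑ s} (λ np → n (h s (fs , np)))
        ... | ps with line-of fs ps o₁ | line-of fs ps o₂
        ... | a , wa , as | b , wb , bs with decide (a ≡ b)
        ... | inj₁ refl = a , (proj₁ wa , ⊓-glb (proj₁ (proj₂ wa)) (proj₁ (proj₂ wb)) , proj₂ (proj₂ wa)) , fs , as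
        ... | inj₂ ne = ⊥-elim (n (subst (_⊑ H) (two-lines fs (proj₂ (proj₂ wa)) (proj₂ (proj₂ wb)) as bs ne)
                (⊔-lub (⊑-trans (proj₁ (proj₂ wa)) h₁) (⊑-trans (proj₁ (proj₂ wb)) h₂))))

    module _ (hyper : ∀ H → rk H ≡ 5 → count F ≤ hm ⊎ count (λ s → F s × (s ⊑ H)) ≤ 8 * Q₄) where

      -- If P is heavy, any three different solids `P ⊔ s` share a plane or lie in one hyperplane.
      -- Modulo P they are planes meeting pairwise in lines, so they all contain the plane M or all
      -- lie in H. The first case is `type-M`; in the second, `hyper` (obtained by duality from
      -- `point-dichotomy`) counts the members inside H.
      point-light : Σ X Off → (count F ≤ hm ⊎ count F ≤ 16 * Q₄) ⊎ N P ≤ 18 * Q₃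
      point-light (s₁ , o₁) with search (λ s → Off s × ¬ (s ⊑ P ⊔ s₁))
      ... | inj₂ h = inj₁ (inj₁ (all-in-solid o₁ λ s os → stable λ n → h s (os , n)))
      ... | inj₁ (s₂ , o₂ , n₂) with search (λ s → Off s × ¬ (s ⊑ P ⊔ s₁) × ¬ (s ⊑ P ⊔ s₂))
      ... | inj₂ h = inj₁ (inj₂ (≤-trans
            (∪-≤ {A = λ s → F s × (P ⊑ s)} {B = λ s → (Off s × (s ⊑ P ⊔ s₁)) ⊎ (Off s × (s ⊑ P ⊔ s₂))} split
              (two-solids o₁ o₂ n₂) (∪-≤ {A = λ s → Off s × (s ⊑ P ⊔ s₁)} {B = λ s → Off s × (s ⊑ P ⊔ s₂)} (λ s w → w)
                (≤-trans (off-in o₁) q³≤) (≤-trans (off-in o₂) q³≤)))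
            (≤-trans (≤-reflexive (l Q₄)) (*-monoˡ-≤ Q₄ (m≤m+n 10 6)))))
        where
          l : ∀ x → 8 * x + (x + x) ≡ 10 * x
          l = solve-∀
          q³≤ : q ^ 3 ≤ Q₄
          q³≤ = ≤-trans (≤-reflexive (l₃ q)) Q₃≤Q₄
            where l₃ : ∀ q → q * (q * (q * 1)) ≡ q * q * q
                  l₃ = solve-∀
          split : ∀ s → F s → (F s × (P ⊑ s)) ⊎ (Off s × (s ⊑ P ⊔ s₁)) ⊎ (Off s × (s ⊑ P ⊔ s₂))
          split s fs with decide (P ⊑ s) | decide (s ⊑ P ⊔ s₁) | decide (s ⊑ P ⊔ s₂)
          ... | inj₁ k | _ | _ = inj₁ (fs , k)
          ... | inj₂ k | inj₁ x | _ = inj₂ (inj₁ ((fs , k) , x))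
          ... | inj₂ k | inj₂ _ | inj₁ x = inj₂ (inj₂ ((fs , k) , x))
          ... | inj₂ k | inj₂ x | inj₂ y = ⊥-elim (h s ((fs , k) , x , y))
      ... | inj₁ (s₃ , o₃ , n₃ , n₂₃) with decide (N P ≤ 18 * Q₃)
      ... | inj₁ done = inj₂ done
      ... | inj₂ heavy = inj₁ result
        where
          D₁ = P ⊔ s₁
          D₂ = P ⊔ s₂
          M = D₁ ⊓ D₂
          H = D₁ ⊔ D₂
          tri : ∀ {s t u} → Off s → Off t → Off u → ¬ (t ⊑ P ⊔ s) → ¬ (u ⊑ P ⊔ s) → ¬ (u ⊑ P ⊔ t) →
            (3 ≤ rk ((P ⊔ s) ⊓ (P ⊔ t) ⊓ (P ⊔ u))) ⊎ ((P ⊔ s ⊑ (P ⊔ t) ⊔ (P ⊔ u)) × (rk ((P ⊔ t) ⊔ (P ⊔ u)) ≤ 5))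
          tri a b c x y z with three-solids a b c x y z
          ... | inj₁ w = inj₁ w
          ... | inj₂ (inj₁ w) = inj₂ w
          ... | inj₂ (inj₂ w) = ⊥-elim (heavy w)
          HM : rk H + rk M ≡ 8
          HM = trans (rk-mod D₁ D₂) (cong₂ _+_ (rk-D o₁) (rk-D o₂))
          M≤3 : rk M ≤ 3
          M≤3 = rk-DD o₂ o₁ n₂
          H≥5 : 5 ≤ rk H
          H≥5 = +-cancelʳ-≤ 3 _ _ (≤-trans (≤-reflexive (sym HM)) (+-monoʳ-≤ (rk H) M≤3))
          M≥3 : 3 ≤ rk M
          M≥3 with tri o₁ o₂ o₃ n₂ n₃ n₂₃
          ... | inj₁ w = ≤-trans w (rk-mono (⊓-glb ⊓ˡ (⊑-trans ⊓ʳ ⊓ˡ)))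
          ... | inj₂ (w , r) = +-cancelˡ-≤ 5 _ _ (≤-trans (≤-reflexive (sym HM))
                  (+-monoˡ-≤ (rk M) (≤-trans (rk-mono (⊔-lub w ⊔ˡ)) r)))
          eM : rk M ≡ 3
          eM = ≤-antisym M≤3 M≥3
          eH : rk H ≡ 5
          eH = ≤-antisym (+-cancelʳ-≤ 3 _ _ (≤-trans (+-monoʳ-≤ (rk H) M≥3) (≤-reflexive HM))) H≥5
          third : ∀ {s} → Off s → ¬ (s ⊑ D₁) → ¬ (s ⊑ D₂) → (M ⊑ P ⊔ s) ⊎ (s ⊑ H)
          third o x y with tri o₁ o₂ o n₂ x y
          ... | inj₁ w = inj₁ (⊑-trans (rk-eq (⊓-glb ⊓ˡ (⊑-trans ⊓ʳ ⊓ˡ)) (≤-trans M≤3 w)) (⊑-trans ⊓ʳ ⊓ʳ))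
          ... | inj₂ (w , r) = inj₂ (⊑-trans ⊔ʳ (⊑-trans ⊔ʳ (rk-eq (⊔-lub w ⊔ˡ) (≤-trans r H≥5))))
          D⊑→ : ∀ {s t} → Off s → Off t → s ⊑ P ⊔ t → P ⊔ t ⊑ P ⊔ s
          D⊑→ os ot h = rk-eq (⊔-lub ⊔ˡ h) (≤-reflexive (trans (rk-D ot) (sym (rk-D os))))
          -- By `third`, `P ⊔ s` lies in H and `P ⊔ t` contains M. Taken together with `D₁`, a
          -- common plane of the three would be M, inside `P ⊔ s`; a common hyperplane H′ would
          -- differ from H, so that `P ⊔ s` equals `H ⊓ H′`, which contains `D₁` and thus M.
          clash : ∀ {s t} → Off s → Off t → ¬ (M ⊑ P ⊔ s) → ¬ (t ⊑ H) → Empty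
          clash {s} {t} os ot nM nH with third os (λ h → nM (⊑-trans ⊓ˡ (D⊑→ os o₁ h))) (λ h → nM (⊑-trans ⊓ʳ (D⊑→ os o₂ h)))
          ... | inj₁ x = nM x
          ... | inj₂ sH with third ot (λ h → nH (⊑-trans h ⊔ˡ)) (λ h → nH (⊑-trans h ⊔ʳ))
          ... | inj₂ x = nH x
          ... | inj₁ Mt with tri o₁ ot os (λ h → nH (⊑-trans h ⊔ˡ)) (λ h → nM (⊑-trans ⊓ˡ (D⊑→ os o₁ h)))
                               (λ h → nM (⊑-trans Mt (D⊑→ os ot h)))
          ... | inj₁ w = nM (⊑-trans (⊑-trans (⊓-glb ⊓ˡ Mt)
              (rk-eq (⊓-glb ⊓ˡ (⊑-trans ⊓ʳ ⊓ˡ)) (≤-trans (≤-trans (≤-reflexive (cong rk (sym eq))) M≤3) w))) (⊑-trans ⊓ʳ ⊓ʳ))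
            where
              eq : M ≡ D₁ ⊓ (P ⊔ t)
              eq = ⊑-≡ (⊓-glb ⊓ˡ Mt) (≤-trans (rk-DD ot o₁ (λ h → nH (⊑-trans h ⊔ˡ))) M≥3)
          ... | inj₂ (w , r) = nM (⊑-trans ⊓ˡ (⊑-trans (⊓-glb ⊔ˡ ⊔ˡ) (rk-eq (⊓-glb s⊑H s⊑H′)
                  (≤-trans (≤-pred (≤-trans (rk-⊓-proper λ k → nH (⊑-trans ⊔ʳ (⊑-trans ⊔ʳ
                      (rk-eq k (≤-trans H′≤5 H≥5))))) (≤-reflexive eH)))
                    (≤-reflexive (sym (rk-D os)))))))
            where
              H′ = D₁ ⊔ (P ⊔ t)
              H′≥5 : 5 ≤ rk H′
              H′≥5 = +-cancelʳ-≤ 3 _ _ (≤-trans (≤-reflexive (sym (trans (rk-mod D₁ (P ⊔ t)) (cong₂ _+_ (rk-D o₁) (rk-D ot)))))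
                (+-monoʳ-≤ (rk H′) (rk-DD ot o₁ (λ h → nH (⊑-trans h ⊔ˡ)))))
              H′≤5 : rk H′ ≤ 5
              H′≤5 = ≤-trans (rk-mono (⊔-lub w ⊔ˡ)) r
              s⊑H : P ⊔ s ⊑ H
              s⊑H = ⊔-lub (⊑-trans ⊔ˡ ⊔ˡ) sH
              s⊑H′ : P ⊔ s ⊑ H′
              s⊑H′ = ⊑-trans ⊔ʳ (rk-eq (⊔-lub w ⊔ˡ) (≤-trans r H′≥5))
          result : count F ≤ hm ⊎ count F ≤ 16 * Q₄
          result with search (λ s → Off s × ¬ (M ⊑ P ⊔ s)) | search (λ s → Off s × ¬ (s ⊑ H))
          ... | inj₂ h | _ = type-M eM (⊓-glb ⊔ˡ ⊔ˡ) o₁ o₂ ⊑-refl λ s os → stable λ n → h s (os , n)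
          ... | inj₁ (s , os , nM) | inj₁ (t , ot , nH) = ⊥-elim (clash os ot nM nH)
          ... | inj₁ _ | inj₂ h with hyper H eH
          ... | inj₁ x = inj₁ x
          ... | inj₂ x = inj₂ (≤-trans
                (∪-≤ {A = λ s → F s × (s ⊑ H)} {B = λ s → F s × ¬ (s ⊑ H)}
                  (λ s fs → case decide (s ⊑ H) of λ { (inj₁ k) → inj₁ (fs , k) ; (inj₂ k) → inj₂ (fs , k) })
                  x (outside-H o₁ o₂ n₂ ⊔ˡ ⊔ʳ λ s os → stable λ n → h s (os , n)))
                (≤-trans (≤-reflexive (l Q₄)) (*-monoˡ-≤ Q₄ (m≤m+n 12 4))))
            where l : ∀ x → 8 * x + 4 * x ≡ 12 * x
                  l = solve-∀

module NontrivialPlanes {p : ℕ} (G : Geom p 6)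
  (F : Geom.X G → Set) {{F? : ∀ {x} → Dec (F x)}}
  (F-rk : ∀ {s} → F s → Geom.rk G s ≡ 3)
  (F-int : ∀ {s t} → F s → F t → ¬ GeomProps.Dj G s t)
  (no-point : ∀ a → Geom.rk G a ≡ 1 → Σ (Geom.X G) λ s → F s × ¬ Geom._⊑_ G a s)
  (no-hyper : ∀ h → Geom.rk G h ≡ 5 → Σ (Geom.X G) λ s → F s × ¬ Geom._⊑_ G s h) where

  open Planes G F F-rk F-int
  open GeomProps G

  private
    module Co = Planes (dual G) F (λ fs → cong (6 ∸_) (F-rk fs))
      (λ {s} {t} fs ft e → F-int fs ft (n≤0⇒n≡0 (+-cancelˡ-≤ 6 _ _
        (≤-trans (+-monoˡ-≤ (rk (s ⊓ t)) (m∸n≡0⇒m≤n e))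
          (≤-reflexive (trans (rk-mod s t) (cong₂ _+_ (F-rk fs) (F-rk ft))))))))

    co₁ : ∀ {h} → rk h ≡ 5 → 6 ∸ rk h ≡ 1
    co₁ e = cong (6 ∸_) e

    co₅ : ∀ {a} → 6 ∸ rk a ≡ 5 → rk a ≡ 1
    co₅ {a} e = trans (sym (m∸[m∸n]≡n (rk≤d G a))) (cong (6 ∸_) e)

    points : ∀ a → rk a ≡ 1 → (count F ≤ hm ⊎ count F ≤ 16 * Q₄) ⊎ N a ≤ 18 * Q₃
    points a e = Point.point-light a e
      (λ h eh → Co.Point.point-dichotomy h (co₁ eh) (no-hyper h eh)) (no-point a e)

    hypers : ∀ h → rk h ≡ 5 → (count F ≤ hm ⊎ count F ≤ 16 * Q₄) ⊎ count (λ s → F s × (s ⊑ h)) ≤ 18 * Q₃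
    hypers h e = Co.Point.point-light h (co₁ e)
      (λ a ea → Point.point-dichotomy a (co₅ ea) (no-point a (co₅ ea))) (no-hyper h e)

  module _ (pts : ∀ a → rk a ≡ 1 → N a ≤ 18 * Q₃)
           (hyp : ∀ h → rk h ≡ 5 → count (λ s → F s × (s ⊑ h)) ≤ 18 * Q₃) where

    b₂Q₃ : br q 2 * (18 * Q₃) ≤ 36 * Q₄
    b₂Q₃ = ≤-trans (*-monoˡ-≤ (18 * Q₃) B₂) (≤-reflexive (l q))
      where l : ∀ q → 2 * q * (18 * (q * q * q)) ≡ 36 * (q * q * q * q)
            l = solve-∀

    through-line : ∀ u → rk u ≡ 2 → count (λ s → F s × ¬ Dj u s) ≤ 36 * Q₄
    through-line u e = ≤-trans (cover-≤ {D = At u} {Q = Planes⊒}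
        (λ s w → let (a , ea , au , as) = common-atom u s (proj₂ w) in a , (ea , au) , proj₁ w , as)
        (≤-reflexive (trans (count-At u) (cong (br q) e))) λ a w → pts a (proj₁ w)) b₂Q₃

    Miss₁ : X → Set
    Miss₁ u = Σ X λ s → F s × Dj u s
    Miss₂ : X × X → Set
    Miss₂ (u , h) = Σ X λ s → F s × Dj u s × ¬ (s ⊑ h)
    Miss₃ : X × X → Set
    Miss₃ (u , e) = Σ X λ s → F s × Dj u s × (rk (s ⊓ e) ≤ 1)

    instance
      i₁ : ∀ {u} → Dec (Miss₁ u)
      i₁ = dec-∃
      i₂ : ∀ {u} → Dec (Miss₂ u)
      i₂ = dec-∃
      i₃ : ∀ {u} → Dec (Miss₃ u)
      i₃ = dec-∃

    second-point : ∀ {u s t} → rk u ≡ 2 → F s → u ⊑ s → F t → Dj u t →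
      Σ X λ a → (rk a ≡ 1) × (a ⊑ t) × (u ⊔ a ≡ s)
    second-point {u} {s} {t} eu fs us ft dt with common-atom s t (F-int fs ft)
    ... | a , ea , as , at = a , ea , at , plane-is fs eu us as (Dj-atom⊑ (≤-reflexive (sym ea)) dt at)

    -- If some line u is met by all members, or the members missing it all lie in a hyperplane or
    -- all share a line with one solid, then lightness of points and hyperplanes gives O(q^4). If no
    -- line behaves so, three successive members missing u leave at most one member through u, and
    -- `F` is counted through two points.
    all-light : count F ≤ 72 * Q₄
    all-light with search (λ u → (rk u ≡ 2) × ¬ Miss₁ u)
                 | search (λ x → (rk (proj₁ x) ≡ 2) × (rk (proj₂ x) ≡ 5) × ¬ Miss₂ x)
                 | search (λ x → (rk (proj₁ x) ≡ 2) × (rk (proj₂ x) ≡ 4) × ¬ Miss₃ x)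
    ... | inj₁ (u , eu , n) | _ | _ = ≤-trans
          (count-mono {Q = λ s → F s × ¬ Dj u s} λ s fs → fs , λ dj → n (s , fs , dj))
          (≤-trans (through-line u eu) (*-monoˡ-≤ Q₄ (m≤m+n 36 36)))
    ... | inj₂ _ | inj₁ ((u , h) , eu , eh , n) | _ = ≤-trans
          (∪-≤ {A = λ s → F s × ¬ Dj u s} {B = λ s → F s × (s ⊑ h)}
            (λ s fs → case decide (Dj u s) of λ
              { (inj₁ dj) → inj₂ (fs , stable λ k → n (s , fs , dj , k)) ; (inj₂ nd) → inj₁ (fs , nd) })
            (through-line u eu) (hyp h eh))
          (≤-trans (+-monoʳ-≤ (36 * Q₄) (*-mono-≤ (m≤m+n 18 18) Q₃≤Q₄)) (≤-reflexive (l Q₄)))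
      where l : ∀ x → 36 * x + 36 * x ≡ 72 * x
            l = solve-∀
    ... | inj₂ _ | inj₂ _ | inj₁ ((u , e) , eu , ee , n) = ≤-trans
          (∪-≤ {A = λ s → F s × ¬ Dj u s} {B = λ s → F s × (2 ≤ rk (s ⊓ e))}
            (λ s fs → case decide (Dj u s) of λ
              { (inj₁ dj) → inj₂ (fs , stable λ k → n (s , fs , dj , ≤-pred (≰⇒> k))) ; (inj₂ nd) → inj₁ (fs , nd) })
            (through-line u eu)
            (≤-trans (cover-≤ {D = λ h → (e ⊑ h) × (h ⊑ 𝟙) × (rk h ≡ suc (rk e))} {Q = λ h s → F s × (s ⊑ h)} f
              (≤-reflexive (ups 2 𝟙-max (trans (cong (_+ 2) ee) (sym rk-𝟙))))
              (λ h w → hyp h (trans (proj₂ (proj₂ w)) (cong suc ee)))) b₂Q₃))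
          (≤-reflexive (l Q₄))
      where
        l : ∀ x → 36 * x + 36 * x ≡ 72 * x
        l = solve-∀
        f : ∀ s → F s × (2 ≤ rk (s ⊓ e)) → Σ X λ h → ((e ⊑ h) × (h ⊑ 𝟙) × (rk h ≡ suc (rk e))) × F s × (s ⊑ h)
        f s (fs , k) with GeomProps.sub-of-rank (dual G) {𝟙} {s ⊔ e} 1 (5 ∸ rk (s ⊔ e)) 𝟙-max
                            (≤-trans (≤-reflexive (cong (6 ∸_) rk-𝟙)) z≤n)
                            (+-∸-assoc 1 rank₅)
          where
            rank₅ : rk (s ⊔ e) ≤ 5
            rank₅ = +-cancelʳ-≤ 2 _ _ (≤-trans (+-monoʳ-≤ _ k) (≤-reflexive (trans (rk-mod s e) (cong₂ _+_ (F-rk fs) ee))))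
        ... | h , _ , seh , eh = h , (⊑-trans ⊔ʳ seh , 𝟙-max ,
                trans (trans (sym (m∸[m∸n]≡n (rk≤d G h))) (cong (6 ∸_) eh)) (cong suc (sym ee))) , fs , ⊑-trans ⊔ˡ seh
    ... | inj₂ n₁ | inj₂ n₂ | inj₂ n₃ with search F
    ... | inj₂ h = ≤-trans (≤-reflexive (count-none h)) z≤n
    ... | inj₁ (s₀ , f₀) = ≤-trans
          (cover-≤ {D = At s₀} {Q = Planes⊒}
            (λ s fs → let (a , ea , a₀ , as) = common-atom s₀ s (F-int f₀ fs) in a , (ea , a₀) , fs , as)
            (≤-reflexive (trans (count-At s₀) (cong (br q) (F-rk f₀)))) point)
          (≤-trans b₃b₃ (*-monoˡ-≤ Q₄ (m≤m+n 4 68)))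
      where
        unique : ∀ u → rk u ≡ 2 → N u ≤ 1
        unique u eu with stable {Miss₁ u} (λ k → n₁ u (eu , k))
        ... | s₂ , f₂ , d₂ with stable {Miss₂ (u , u ⊔ s₂)} (λ k → n₂ (u , u ⊔ s₂) (eu , rk₂ , k))
          where rk₂ = trans (rk-⊔-Dj d₂) (cong₂ _+_ eu (F-rk f₂))
        ... | s₃ , f₃ , d₃ , k₃ with stable {Miss₃ (u , (u ⊔ s₂) ⊓ (u ⊔ s₃))} (λ k → n₃ (u , (u ⊔ s₂) ⊓ (u ⊔ s₃)) (eu , rk₄ , k))
          where
            rk₂ : rk (u ⊔ s₂) ≡ 5
            rk₂ = trans (rk-⊔-Dj d₂) (cong₂ _+_ eu (F-rk f₂))
            rk₃ : rk (u ⊔ s₃) ≡ 5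
            rk₃ = trans (rk-⊔-Dj d₃) (cong₂ _+_ eu (F-rk f₃))
            rk₄ : rk ((u ⊔ s₂) ⊓ (u ⊔ s₃)) ≡ 4
            rk₄ = ≤-antisym
              (≤-pred (≤-trans (rk-⊓-proper λ h → k₃ (⊑-trans ⊔ʳ (rk-eq h (≤-reflexive (trans rk₃ (sym rk₂)))))) (≤-reflexive rk₂)))
              (+-cancelˡ-≤ 6 _ _ (≤-trans (≤-reflexive (sym (cong₂ _+_ rk₂ rk₃)))
                (≤-trans (rk-⊓-≥ 𝟙-max 𝟙-max) (≤-reflexive (cong (_+ rk ((u ⊔ s₂) ⊓ (u ⊔ s₃))) rk-𝟙)))))
        -- A member `s` above u lies in `u ⊔ s₂` and in `u ⊔ s₃`. It meets `s₄`, and the common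
        -- point can only be the one that `s₄` has in the intersection of these joins; with u this
        -- point spans `s`.
        ... | s₄ , f₄ , d₄ , k₄ = count-≤1 (u ⊔ (s₄ ⊓ ((u ⊔ s₂) ⊓ (u ⊔ s₃)))) λ s w →
              let (fs , us) = w
                  (a₂ , _ , h₂ , e₂) = second-point eu fs us f₂ d₂
                  (a₃ , _ , h₃ , e₃) = second-point eu fs us f₃ d₃
                  (a₄ , ea₄ , h₄ , e₄) = second-point eu fs us f₄ d₄
                  sE = ⊓-glb (subst (_⊑ u ⊔ s₂) e₂ (⊔-mono ⊑-refl h₂)) (subst (_⊑ u ⊔ s₃) e₃ (⊔-mono ⊑-refl h₃))
                  a₄s = subst (a₄ ⊑_) e₄ ⊔ʳ
                  e = ⊑-≡ (⊓-glb h₄ (⊑-trans a₄s sE)) (≤-trans k₄ (≤-reflexive (sym ea₄)))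
              in trans (sym e₄) (cong (u ⊔_) e)
        point : ∀ a → At s₀ a → N a ≤ br q 3
        point a (ea , _) with no-point a ea
        ... | s₁ , f₁ , n = ≤-trans
          (cover-≤ {D = At s₁} {Q = λ r s → F s × (a ⊔ r ⊑ s)} {b = 1}
            (λ s w → let (r , er , r₁ , rs) = common-atom s₁ s (F-int f₁ (proj₁ w)) in
              r , (er , r₁) , proj₁ w , ⊔-lub (proj₂ w) rs)
            (≤-reflexive (trans (count-At s₁) (cong (br q) (F-rk f₁))))
            λ r w → unique (a ⊔ r) (trans (rk-⊔-atom (proj₁ w) (λ h → n (subst (_⊑ s₁)
              (⊑-≡ h (≤-reflexive (trans ea (sym (proj₁ w))))) (proj₂ w)))) (cong suc ea)))
          (≤-reflexive (*-identityʳ _))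

  planes-bound : count F ≤ hm ⊎ count F ≤ 72 * Q₄
  planes-bound with search (λ a → (rk a ≡ 1) × ¬ (N a ≤ 18 * Q₃))
                  | search (λ h → (rk h ≡ 5) × ¬ (count (λ s → F s × (s ⊑ h)) ≤ 18 * Q₃))
  ... | inj₁ (a , ea , n) | _ = relax (points a ea)
    where
      relax : (count F ≤ hm ⊎ count F ≤ 16 * Q₄) ⊎ N a ≤ 18 * Q₃ → count F ≤ hm ⊎ count F ≤ 72 * Q₄
      relax (inj₁ (inj₁ x)) = inj₁ x
      relax (inj₁ (inj₂ x)) = inj₂ (≤-trans x (*-monoˡ-≤ Q₄ (m≤m+n 16 56)))
      relax (inj₂ x) = ⊥-elim (n x)
  ... | inj₂ _ | inj₁ (h , eh , n) = relax (hypers h eh)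
    where
      relax : (count F ≤ hm ⊎ count F ≤ 16 * Q₄) ⊎ count (λ s → F s × (s ⊑ h)) ≤ 18 * Q₃ → count F ≤ hm ⊎ count F ≤ 72 * Q₄
      relax (inj₁ (inj₁ x)) = inj₁ x
      relax (inj₁ (inj₂ x)) = inj₂ (≤-trans x (*-monoˡ-≤ Q₄ (m≤m+n 16 56)))
      relax (inj₂ x) = ⊥-elim (n x)
  ... | inj₂ ps | inj₂ hs = inj₂ (all-light
        (λ a e → stable λ k → ps a (e , k)) (λ h e → stable λ k → hs h (e , k)))

-- Families of pairwise non-opposite flags: the branching argument.

-- The constants of the argument depend only on n = k + 2.
opaque
  κ-of : ℕ → ℕ
  κ-of k = 2 ^ suc (suc (suc k))

  κ-def : ∀ k → κ-of k ≡ 2 ^ suc (suc (suc k))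
  κ-def k = refl

  -- An ordinary step multiplies the constant by 4. The ratio 8 leaves room for the doubly gaining
  -- steps as well, whose constants reach 26 κ and must fit into `cst-of k 2`, that is 64 κ.
  cst-of : ℕ → ℕ → ℕ
  cst-of k zero = κ-of k
  cst-of k (suc R) = 8 * cst-of k R

  κ≤cst : ∀ k → κ-of k ≤ cst-of k 0
  κ≤cst k = ≤-refl

  cst-step : ∀ k R → 4 * cst-of k R ≤ cst-of k (suc R)
  cst-step k R = *-monoˡ-≤ (cst-of k R) (m≤m+n 4 4)

  κ≤cst₂ : ∀ k {j} → j ≤ 64 → j * κ-of k ≤ cst-of k 2
  κ≤cst₂ k h = ≤-trans (*-monoˡ-≤ (κ-of k) h) (≤-reflexive (l (κ-of k)))
    where l : ∀ x → 64 * x ≡ 8 * (8 * x)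
          l = solve-∀

  κ+cst≤cst₂ : ∀ k → 10 * κ-of k + 2 * cst-of k 1 ≤ cst-of k 2
  κ+cst≤cst₂ k = ≤-trans (≤-reflexive (l (κ-of k))) (κ≤cst₂ k {26} (m≤m+n 26 38))
    where l : ∀ x → 10 * x + 2 * (8 * x) ≡ 26 * x
          l = solve-∀

  cst-mono : ∀ k {a b} → a ≤ b → cst-of k a ≤ cst-of k b
  cst-mono k {b = zero} z≤n = ≤-refl
  cst-mono k {a} {suc b} h with m≤n⇒m<n∨m≡n h
  ... | inj₂ refl = ≤-refl
  ... | inj₁ (s≤s h′) = ≤-trans (cst-mono k h′) (m≤m+n _ _)

-- `c₂` and `c₃` bound the exceptions in `EC` and `Pair`, `c₅` and `c₆` those in the last two
-- alternatives of `Conclusion`. The last summand of `c₂` pays for `big-top`.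
c₂-of c₃-of c₅-of c₆-of : ℕ → ℕ
c₂-of k = κ-of k + 2 * κ-of k + 2 * cst-of k (suc (suc (suc k)))
c₃-of k = 2 * κ-of k + κ-of k
c₅-of k = c₃-of k + 2 * cst-of k (suc (suc k))
c₆-of k = c₂-of k + 2 * cst-of k (suc (suc (suc (suc k))))

-- A coclique F of (n-1,n)-flags (a , b), as vector subspaces of ranks n = k + 2 and n + 1.
module FlagFamily {p k : ℕ} (G : Geom p (suc (suc (suc k) + suc (suc k))))
  (F : Geom.X G × Geom.X G → Set) {{F? : ∀ {φ} → Dec (F φ)}}
  (F-A : ∀ {φ} → F φ → Geom.rk G (proj₁ φ) ≡ suc (suc k))
  (F-B : ∀ {φ} → F φ → Geom.rk G (proj₂ φ) ≡ suc (suc (suc k)))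
  (F-⊑ : ∀ {φ} → F φ → Geom._⊑_ G (proj₁ φ) (proj₂ φ))
  (F-int : ∀ {φ ψ} → F φ → F ψ → GeomProps.Dj G (proj₁ φ) (proj₂ ψ) → GeomProps.Dj G (proj₁ ψ) (proj₂ φ) → Empty)
  where

  open GeomProps G

  n n′ : ℕ
  n′ = suc k
  n = suc n′

  In₀ : X → X × X → Set
  In₀ u (a , b) = F (a , b) × (u ⊑ a)

  In₁ : X → X → X × X → Set
  In₁ u x (a , b) = F (a , b) × (u ⊑ a) × (x ⊑ b) × ¬ (x ⊑ a)

  N₀ : X → ℕ
  N₀ u = count (In₀ u)

  N₁ : X → X → ℕ
  N₁ u x = count (In₁ u x)

  κ : ℕ
  κ = κ-of k

  2^≤ : ∀ {m} → m ≤ n → 2 * 2 ^ m ≤ κ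
  2^≤ h = ≤-trans (*-monoʳ-≤ 2 (^-monoʳ-≤ 2 h)) (≤-reflexive (sym (κ-def k)))

  above-A : ∀ a → count (λ φ → F φ × (proj₁ φ ≡ a)) ≤ 2 * q ^ n
  above-A a with search (λ φ → F φ × (proj₁ φ ≡ a))
  ... | inj₂ h = ≤-trans (≤-reflexive (count-none h)) z≤n
  ... | inj₁ ((_ , _) , f₀ , refl) = ≤-trans
    (count-inj {Q = λ b → (a ⊑ b) × (b ⊑ 𝟙) × (rk b ≡ suc (rk a))} proj₂
      (λ { (_ , b) (f , refl) → F-⊑ f , 𝟙-max , trans (F-B f) (cong suc (sym (F-A f₀))) })
      (λ { (_ , b) (_ , _) (_ , refl) (_ , refl) refl → refl }))
    (≤-trans (≤-reflexive (ups (suc n) 𝟙-max (trans (cong (_+ suc n) (F-A f₀))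
      (trans (+-suc n n) (sym rk-𝟙))))) (br-≤2 n))

  below-B : ∀ b → count (λ φ → F φ × (proj₂ φ ≡ b)) ≤ 2 * q ^ n
  below-B b with search (λ φ → F φ × (proj₂ φ ≡ b))
  ... | inj₂ h = ≤-trans (≤-reflexive (count-none h)) z≤n
  ... | inj₁ ((_ , _) , f₀ , refl) = ≤-trans
    (count-inj {Q = λ a → (𝟘 ⊑ a) × (a ⊑ b) × (suc (rk a) ≡ rk b)} proj₁
      (λ { (a , _) (f , refl) → 𝟘-min , F-⊑ f , trans (cong suc (F-A f)) (sym (F-B f)) })
      (λ { (a , _) (_ , _) (_ , refl) (_ , refl) refl → refl }))
    (≤-trans (≤-reflexive (dns (suc n) 𝟘-min (trans (cong (_+ suc n) rk-𝟘) (sym (F-B f₀))))) (br-≤2 n))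

  N₀-trivial : ∀ {u} m → rk u + m ≡ n → N₀ u ≤ κ * q ^ (m * suc n + n)
  N₀-trivial {u} m e = ≤-trans
    (cover-≤ {D = Lv u 𝟙 m} {Q = λ a φ → F φ × (proj₁ φ ≡ a)}
      (λ { (a , b) (f , ua) → a , (ua , 𝟙-max , trans (F-A f) (sym e)) , f , refl })
      (lv-≤2 m (suc n) 𝟙-max (trans (sym (+-assoc (rk u) m (suc n))) (trans (cong (_+ suc n) e) (trans (+-suc n n) (sym rk-𝟙)))))
      (λ a _ → above-A a))
    (≤-trans (≤-reflexive (trans (l (2 ^ m) (q ^ (m * suc n)) (q ^ n))
        (cong (2 * 2 ^ m *_) (sym (^-distribˡ-+-* q (m * suc n) n)))))
      (*-monoˡ-≤ (q ^ (m * suc n + n)) (2^≤ (≤-trans (m≤n+m m (rk u)) (≤-reflexive e)))))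
    where l : ∀ a b c → a * b * (2 * c) ≡ 2 * a * (b * c)
          l = solve-∀

  B-is : ∀ {a b x} → F (a , b) → rk x ≡ 1 → x ⊑ b → ¬ (x ⊑ a) → a ⊔ x ≡ b
  B-is f e h n = ⊑-≡ (⊔-lub (F-⊑ f) h) (≤-reflexive (trans (F-B f) (sym (trans (rk-⊔-atom e n) (cong suc (F-A f))))))

  -- Here `b` is `a ⊔ x`, so only `a` is free: knowing a point of `b` outside `a` saves a factor of
  -- order q^n.
  N₁-trivial : ∀ {u x} m → rk x ≡ 1 → rk u + m ≡ n → N₁ u x ≤ κ * q ^ (m * suc n)
  N₁-trivial {u} {x} m ex e = ≤-trans
    (count-inj {Q = Lv u 𝟙 m} proj₁
      (λ { (a , b) (f , ua , _) → ua , 𝟙-max , trans (F-A f) (sym e) })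
      (λ { (a , b) (_ , c) (f , _ , xb , na) (g , _ , xc , _) refl →
        cong (a ,_) (trans (sym (B-is f ex xb na)) (B-is g ex xc na)) }))
    (≤-trans (lv-≤2 m (suc n) 𝟙-max (trans (sym (+-assoc (rk u) m (suc n))) (trans (cong (_+ suc n) e) (trans (+-suc n n) (sym rk-𝟙)))))
      (*-monoˡ-≤ (q ^ (m * suc n)) (≤-trans (m≤m+n (2 ^ m) _) (2^≤ (≤-trans (m≤n+m m (rk u)) (≤-reflexive e))))))

  -- Modulo x, the elements b of flags with x ≤ b and x ≰ a pairwise meet.
  module Quotient (x : X) (ex : rk x ≡ 1) where

    U : Geom p (n + n)
    U = upper G x (n + n) (cong (_+ (n + n)) ex)

    data S (y : Geom.X U) : Set where
      inS : ∀ a → F (a , proj₁ y) → ¬ (x ⊑ a) → S y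

    instance
      finite-U : Finite (Geom.X U)
      finite-U = Geom.finite U
      S? : ∀ {y} → Dec (S y)
      S? {y} with search (λ a → F (a , proj₁ y) × ¬ (x ⊑ a))
      ... | inj₁ (a , f , na) = yes (inS a f na)
      ... | inj₂ h = no λ { (inS a f na) → h a (f , na) }

    S-rk : ∀ {y} → S y → Geom.rk U y ≡ n
    S-rk (inS a f _) = cong₂ _∸_ (F-B f) ex

    -- If b and c met only in x, a point common to `a` and c, or to `a′` and b, would have to be x,
    -- which neither `a` nor `a′` contains. The two flags would be opposite.
    S-int : ∀ {y z} → S y → S z → ¬ GeomProps.Dj U y z
    S-int {b , xb} {c , xc} (inS a f na) (inS a′ g na′) dj = F-int f g
        (disj (F-⊑ f) na (λ r → r)) (disj (F-⊑ g) na′ (λ r → ⊑-trans r (⊓-glb ⊓ʳ ⊓ˡ)))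
      where
        meet-x : b ⊓ c ⊑ x
        meet-x = rk-eq (⊓-glb xb xc) (m∸n≡0⇒m≤n dj)
        disj : ∀ {a b′ c′} → a ⊑ b′ → ¬ (x ⊑ a) → (∀ {r} → r ⊑ b′ ⊓ c′ → r ⊑ b ⊓ c) → Dj a c′
        disj ab n s = stable λ nd → let (r , er , ra , rc) = common-atom _ _ nd
                                        rx = ⊑-trans (s (⊓-glb (⊑-trans ra ab) rc)) meet-x
          in n (subst (_⊑ _) (⊑-≡ rx (≤-reflexive (trans ex (sym er)))) ra)

    S-count : count S ≤ 2 ^ n * q ^ (n′ * n)
    S-count = p-cancel n (n′ * n) (Intersecting.ekr U S (λ {y} → S-rk {y}) (λ {y} {z} → S-int {y} {z}))

  -- Erdős-Ko-Rado in the quotient by x bounds the number of b's, and at most 2q^n flags share a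
  -- given b.
  N₁-ekr : ∀ {x} → rk x ≡ 1 → N₁ 𝟘 x ≤ κ * q ^ (n * n)
  N₁-ekr {x} ex = ≤-trans
    (cover-≤ {D = S} {Q = λ y φ → F φ × (proj₂ φ ≡ proj₁ y)}
      (λ { (a , b) (f , _ , xb , na) → (b , xb) , inS a f na , f , refl }) S-count (λ y _ → below-B (proj₁ y)))
    (≤-reflexive (trans (l (2 ^ n) (q ^ (n′ * n)) (q ^ n)) (cong₂ _*_ (sym (κ-def k))
      (sym (^-distribˡ-+-* q n (n′ * n))))))
    where open Quotient x ex
          l : ∀ a b c → a * b * (2 * c) ≡ 2 * a * (c * b)
          l = solve-∀

dual-family : {X : Set} → (X × X → Set) → X × X → Set
dual-family F (b , a) = F (a , b)

module FlagBranch {p k : ℕ} (G : Geom p (suc (suc (suc k) + suc (suc k))))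
  (F : Geom.X G × Geom.X G → Set) {{F? : ∀ {φ} → Dec (F φ)}}
  (F-A : ∀ {φ} → F φ → Geom.rk G (proj₁ φ) ≡ suc (suc k))
  (F-B : ∀ {φ} → F φ → Geom.rk G (proj₂ φ) ≡ suc (suc (suc k)))
  (F-⊑ : ∀ {φ} → F φ → Geom._⊑_ G (proj₁ φ) (proj₂ φ))
  (F-int : ∀ {φ ψ} → F φ → F ψ → GeomProps.Dj G (proj₁ φ) (proj₂ ψ) → GeomProps.Dj G (proj₁ ψ) (proj₂ φ) → Empty)
  where

  open FlagFamily G F F-A F-B F-⊑ F-int
  open GeomProps G

  private
    full-Dj : ∀ {x y} → rk x + rk y ≡ suc (n + n) → suc (n + n) ∸ rk (x ⊔ y) ≡ 0 → Dj x y
    full-Dj {x} {y} e h = n≤0⇒n≡0 (+-cancelˡ-≤ (suc (n + n)) _ _ (≤-trans (+-monoˡ-≤ (rk (x ⊓ y)) (m∸n≡0⇒m≤n h))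
      (≤-reflexive (trans (rk-mod x y) (trans e (sym (+-identityʳ _)))))))

    dual? : ∀ {φ} → Dec (dual-family F φ)
    dual? {b , a} = F? {a , b}

  co-A : ∀ {φ} → dual-family F φ → suc (n + n) ∸ rk (proj₁ φ) ≡ n
  co-A f = trans (cong (suc (n + n) ∸_) (F-B f)) (m+n∸m≡n n n)

  co-B : ∀ {φ} → dual-family F φ → suc (n + n) ∸ rk (proj₂ φ) ≡ suc n
  co-B f = trans (cong (suc (n + n) ∸_) (F-A f)) (m+n∸n≡m (suc n) n)

  co-int : ∀ {φ ψ} → dual-family F φ → dual-family F ψ →
    GeomProps.Dj (dual G) (proj₁ φ) (proj₂ ψ) → GeomProps.Dj (dual G) (proj₁ ψ) (proj₂ φ) → Empty
  co-int f g h h′ = F-int f g (Dj-sym (full-Dj (cong₂ _+_ (F-B g) (F-A f)) h′)) (Dj-sym (full-Dj (cong₂ _+_ (F-B f) (F-A g)) h))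

  private
    module Co = FlagFamily (dual G) (dual-family F) {{λ {φ} → dual? {φ}}} (λ {φ} → co-A {φ}) (λ {φ} → co-B {φ})
      (λ {φ} f → F-⊑ f) (λ {φ} {ψ} → co-int {φ} {ψ})

  -- In the dual lattice `h` is a point and (b , a) is a flag whose larger member contains that
  -- point while the smaller does not: this is `N₁-ekr` there.
  hyperplane-few : ∀ {h} → rk h ≡ n + n → count (λ φ → F φ × (proj₁ φ ⊑ h) × ¬ (proj₂ φ ⊑ h)) ≤ κ * q ^ (n * n)
  hyperplane-few {h} e = ≤-trans
    (count-inj {Q = Co.In₁ 𝟙 h} (λ { (a , b) → b , a }) (λ { (a , b) (f , u , v) → f , 𝟙-max , u , v })
      (λ { (a , b) (c , d) _ _ refl → refl }))
    (Co.N₁-ekr {h} (trans (cong (suc (n + n) ∸_) e) (m+n∸n≡m 1 (n + n))))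

  small-few : ∀ {y} → rk y < n + n → count (λ φ → F φ × (proj₁ φ ⊑ y)) ≤ κ * q ^ (n * n)
  small-few {y} lt with decide (n ≤ rk y)
  ... | inj₂ nl = ≤-trans (≤-reflexive (count-none λ φ w → nl (≤-trans (≤-reflexive (sym (F-A (proj₁ w)))) (rk-mono (proj₂ w))))) z≤n
  ... | inj₁ le = ≤-trans
    (cover-≤ {D = Lv 𝟘 y n} {Q = λ a φ → F φ × (proj₁ φ ≡ a)}
      (λ { (a , b) (f , ay) → a , (𝟘-min , ay , trans (F-A f) (cong (_+ n) (sym rk-𝟘))) , f , refl })
      (lv-≤2 n (rk y ∸ n) 𝟘-min (trans (cong (_+ (n + (rk y ∸ n))) rk-𝟘) (m+[n∸m]≡n le))) (λ a _ → above-A a))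
    (≤-trans (*-monoˡ-≤ (2 * q ^ n) (*-monoʳ-≤ (2 ^ n) (^-monoʳ-≤ q (*-monoʳ-≤ n
        (≤-pred (≤-trans (≤-reflexive (sym (+-∸-assoc 1 le))) (≤-trans (∸-monoˡ-≤ n lt) (≤-reflexive (m+n∸n≡m n n)))))))))
      (≤-trans (≤-reflexive (trans (l (2 ^ n) (q ^ (n * n′)) (q ^ n)) (cong₂ _*_ (sym (κ-def k)) (sym (^-distribˡ-+-* q n (n * n′))))))
        (≤-reflexive (cong (λ e → κ * q ^ e) (sym (*-suc n n′))))))
    where l : ∀ a b c → a * b * (2 * c) ≡ 2 * a * (c * b)
          l = solve-∀

  -- N is at most c q^(n²+n-2). Written this way, the inequality compares N with the trivial bound
  -- of order q^(n(n+1)+n) after n + 2 gains.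
  record Few (c N : ℕ) : Set where
    constructor few
    field unfew : N * q ^ (2 + n) ≤ c * q ^ (n * suc n + n)

  open Few

  instance
    Few? : ∀ {c N} → Dec (Few c N)
    Few? {c} {N} with decide (N * q ^ (2 + n) ≤ c * q ^ (n * suc n + n))
    ... | inj₁ h = yes (few h)
    ... | inj₂ h = no λ w → h (unfew w)

  few-weaken : ∀ {c c′ N} → c ≤ c′ → Few c N → Few c′ N
  few-weaken h (few f) = few (≤-trans f (*-monoˡ-≤ (q ^ (n * suc n + n)) h))

  few-mono : ∀ {c M N} → M ≤ N → Few c N → Few c M
  few-mono h (few f) = few (≤-trans (*-monoˡ-≤ (q ^ (2 + n)) h) f)

  few-+ : ∀ {c c′ M N} → Few c M → Few c′ N → Few (c + c′) (M + N)
  few-+ {c} {c′} {M} {N} (few f) (few g) = few (≤-trans (≤-reflexive (*-distribʳ-+ (q ^ (2 + n)) M N))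
    (≤-trans (+-mono-≤ f g) (≤-reflexive (sym (*-distribʳ-+ (q ^ (n * suc n + n)) c c′)))))

  few-∪ : ∀ {c c′} {P Q R : X × X → Set} {{_ : ∀ {φ} → Dec (P φ)}} {{_ : ∀ {φ} → Dec (Q φ)}} {{_ : ∀ {φ} → Dec (R φ)}} →
    (∀ φ → R φ → P φ ⊎ Q φ) → Few c (count P) → Few c′ (count Q) → Few (c + c′) (count R)
  few-∪ {c} {c′} {P} {Q} {R} h f g = few-mono (count-∪ {P = P} {Q = Q} h) (few-+ f g)

  few-nn : ∀ {c N} → N ≤ c * q ^ (n * n) → Few c N
  few-nn {c} {N} h = few (begin
      N * q ^ (2 + n)                     ≤⟨ *-monoˡ-≤ (q ^ (2 + n)) h ⟩
      c * q ^ (n * n) * q ^ (2 + n)       ≡⟨ *-assoc c _ _ ⟩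
      c * (q ^ (n * n) * q ^ (2 + n))     ≡⟨ cong (c *_) (sym (^-distribˡ-+-* q (n * n) (2 + n))) ⟩
      c * q ^ (n * n + (2 + n))           ≤⟨ *-monoʳ-≤ c (^-monoʳ-≤ q (≤-trans (m≤m+n _ k) (≤-reflexive (l k)))) ⟩
      c * q ^ (n * suc n + n)             ∎)
    where
      open ≤-Reasoning
      l : ∀ k → suc (suc k) * suc (suc k) + (2 + suc (suc k)) + k ≡ suc (suc k) * suc (suc (suc k)) + suc (suc k)
      l = solve-∀

  few-points : ∀ {c N} → N ≤ br q n′ * (c * q ^ (n * n)) → Few (2 * c) N
  few-points {c} {N} h = few (begin
      N * q ^ (2 + n)                                 ≤⟨ *-monoˡ-≤ (q ^ (2 + n)) (≤-trans h (*-monoˡ-≤ (c * q ^ (n * n)) (br-≤2 k))) ⟩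
      2 * q ^ k * (c * q ^ (n * n)) * q ^ (2 + n)     ≡⟨ l (q ^ k) c (q ^ (n * n)) (q ^ (2 + n)) ⟩
      2 * c * (q ^ k * (q ^ (n * n) * q ^ (2 + n)))
        ≡⟨ cong (λ t → 2 * c * (q ^ k * t)) (sym (^-distribˡ-+-* q (n * n) (2 + n))) ⟩
      2 * c * (q ^ k * q ^ (n * n + (2 + n)))         ≡⟨ cong (2 * c *_) (sym (^-distribˡ-+-* q k (n * n + (2 + n)))) ⟩
      2 * c * q ^ (k + (n * n + (2 + n)))             ≡⟨ cong (λ e → 2 * c * q ^ e) (l′ k) ⟩
      2 * c * q ^ (n * suc n + n)                     ∎)
    where
      open ≤-Reasoning
      l : ∀ a c b d → 2 * a * (c * b) * d ≡ 2 * c * (a * (b * d))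
      l = solve-∀
      l′ : ∀ k → k + (suc (suc k) * suc (suc k) + (2 + suc (suc k))) ≡ suc (suc k) * suc (suc (suc k)) + suc (suc k)
      l′ = solve-∀

  -- A state is given by a subspace u of `a` and by w, which is u itself, or `u ⊔ x` once a point x
  -- of `b` outside `a` is known. The asymmetric condition is what both `split₀` and `split₁` can
  -- exploit.
  Missed : X → X → X × X → Set
  Missed u w (a , b) = F (a , b) × Dj u b × Dj w a

  NC : X → X → Set
  NC u w = Σ (X × X) (Missed u w)

  instance
    NC? : ∀ {u w} → Dec (NC u w)
    NC? = dec-∃

  child-rk : ∀ {u z r} → Dj u z → At z r → rk (u ⊔ r) ≡ suc (rk u)
  child-rk dj (er , hr) = rk-⊔-atom er (Dj-atom⊑ (≤-reflexive (sym er)) dj hr)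

  C₀ CP : X → X → X × X → Set
  C₀ z u ψ = Σ X λ r → At z r × In₀ (u ⊔ r) ψ
  CP z u ψ = Σ X λ r → At z r × In₁ u r ψ
  C₁ : X → X → X → X × X → Set
  C₁ z u x ψ = Σ X λ r → At z r × In₁ (u ⊔ r) x ψ

  instance
    C₀? : ∀ {z u ψ} → Dec (C₀ z u ψ)
    C₀? = dec-∃
    CP? : ∀ {z u ψ} → Dec (CP z u ψ)
    CP? = dec-∃
    C₁? : ∀ {z u x ψ} → Dec (C₁ z u x ψ)
    C₁? = dec-∃

  meet-or : ∀ {φ ψ} → F φ → F ψ → ¬ Dj (proj₁ ψ) (proj₂ φ) ⊎ ¬ Dj (proj₁ φ) (proj₂ ψ)
  meet-or {φ} {ψ} f g with decide (Dj (proj₁ ψ) (proj₂ φ))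
  ... | inj₂ nd = inj₁ nd
  ... | inj₁ dj = inj₂ λ dj′ → F-int f g dj′ dj

  -- A flag that is not opposite to the missed one has a point in `a ⊓ b₀` or in `a₀ ⊓ b`. In the
  -- second case the point lies in `a`, and then also in `b₀`, or it becomes the known point of `b`.
  split₀ : ∀ {u a b} → F (a , b) → Dj u b → N₀ u ≤ count (C₀ b u) + count (CP a u)
  split₀ {u} {a₀} {b₀} f₀ dj = count-∪ {P = C₀ b₀ u} {Q = CP a₀ u} h
    where
      h : ∀ ψ → In₀ u ψ → C₀ b₀ u ψ ⊎ CP a₀ u ψ
      h (a , b) (f , ua) with meet-or f₀ f
      ... | inj₁ nd = let (r , er , ra , rb₀) = common-atom a b₀ nd in inj₁ (r , (er , rb₀) , f , ⊔-lub ua ra)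
      ... | inj₂ nd with common-atom a₀ b nd
      ... | r , er , ra₀ , rb with decide (r ⊑ a)
      ... | inj₁ ra = inj₁ (r , (er , ⊑-trans ra₀ (F-⊑ f₀)) , f , ⊔-lub ua ra)
      ... | inj₂ na = inj₂ (r , (er , ra₀) , f , ua , rb , na)

  -- A point r of `a₀ ⊓ b` outside `a` is turned into a point of `a`: the line `x ⊔ r` lies in `b`,
  -- where `a` is a hyperplane, so it meets `a` in a point of `x ⊔ a₀`.
  split₁ : ∀ {u x a b} → rk x ≡ 1 → F (a , b) → Dj (u ⊔ x) a → N₁ u x ≤ count (C₁ b u x) + count (C₁ (x ⊔ a) u x)
  split₁ {u} {x} {a₀} {b₀} ex f₀ dj = count-∪ {P = C₁ b₀ u x} {Q = C₁ (x ⊔ a₀) u x} h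
    where
      h : ∀ ψ → In₁ u x ψ → C₁ b₀ u x ψ ⊎ C₁ (x ⊔ a₀) u x ψ
      h (a , b) (f , ua , xb , na) with meet-or f₀ f
      ... | inj₁ nd = let (r , er , ra , rb₀) = common-atom a b₀ nd in inj₁ (r , (er , rb₀) , f , ⊔-lub ua ra , xb , na)
      ... | inj₂ nd with common-atom a₀ b nd
      ... | r , er , ra₀ , rb with decide (r ⊑ a)
      ... | inj₁ ra = inj₁ (r , (er , ⊑-trans ra₀ (F-⊑ f₀)) , f , ⊔-lub ua ra , xb , na)
      ... | inj₂ nr = let (c , ec , cl , ca) = common-atom (x ⊔ r) a meets in
              inj₂ (c , (ec , ⊑-trans cl (⊔-mono ⊑-refl ra₀)) , f , ⊔-lub ua ca , xb , na)
        where
          r⋢x : ¬ (r ⊑ x)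
          r⋢x h = Dj-atom⊑ (≤-reflexive (sym er)) dj ra₀ (⊑-trans h ⊔ʳ)
          meets : ¬ Dj (x ⊔ r) a
          meets d = 1+n≰n (subst₂ _≤_ (cong₂ _+_ (trans (rk-⊔-atom er r⋢x) (cong suc ex)) (F-A f)) (F-B f)
            (Dj-bound (⊔-lub xb rb) (F-⊑ f) d))

  -- At rank n the flag is determined, a = u and b = `u ⊔ x`, and the member missing the state would
  -- be opposite to it.
  N₁-top : ∀ {u x} → rk x ≡ 1 → rk u ≡ n → NC u (u ⊔ x) → N₁ u x ≡ 0
  N₁-top {u} {x} ex e ((a₀ , b₀) , f₀ , d , d′) = count-none λ { (a , b) (f , ua , xb , na) →
    let ea = ⊑-≡ ua (≤-reflexive (trans (F-A f) (sym e)))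
        eb = trans (cong (_⊔ x) ea) (B-is f ex xb na)
    in F-int f f₀ (subst (λ t → Dj t b₀) ea d) (Dj-sym (subst (λ t → Dj t a₀) eb d′)) }

  -- Bounds for the families of descendants of a state: `plain` when all children satisfy the
  -- same bound, `mixed` when a few of them (those in S) only satisfy a weaker one.
  plain : {Q : X → X × X → Set} {{Q? : ∀ {r ψ} → Dec (Q r ψ)}} (z : X) (j A c Y : ℕ) → rk z ≡ suc j →
    (∀ r → At z r → count (Q r) * A ≤ c * Y) →
    count (λ ψ → Σ X λ r → At z r × Q r ψ) {{dec-∃}} * (q * A) ≤ 2 * c * (q ^ suc j * Y)
  plain {Q} z j A c Y ez h = begin
      C * (q * A)                   ≡⟨ l C q A ⟩
      C * A * q                     ≤⟨ *-monoˡ-≤ q (branch {P = λ ψ → Σ X λ r → At z r × Q r ψ} {{dec-∃}} {D = At z} (λ ψ w → w) A (c * Y) h) ⟩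
      count (At z) * (c * Y) * q    ≤⟨ *-monoˡ-≤ q (*-monoˡ-≤ (c * Y) (≤-trans (≤-reflexive (trans (count-At z) (cong (br q) ez))) (br-≤2 j))) ⟩
      2 * q ^ j * (c * Y) * q       ≡⟨ l′ (q ^ j) c Y q ⟩
      2 * c * (q * q ^ j * Y)       ∎
    where
      open ≤-Reasoning
      C = count (λ ψ → Σ X λ r → At z r × Q r ψ) {{dec-∃}}
      l : ∀ a b c → a * (b * c) ≡ a * c * b
      l = solve-∀
      l′ : ∀ a c y q → 2 * a * (c * y) * q ≡ 2 * c * (q * a * y)
      l′ = solve-∀

  mixed : {Q : X → X × X → Set} {{Q? : ∀ {r ψ} → Dec (Q r ψ)}} {S : X → Set} {{S? : ∀ {r} → Dec (S r)}}
    (z : X) (j σ c c′ Y : ℕ) → rk z ≡ suc (suc j) → count (λ r → At z r × S r) ≤ σ * q ^ j →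
    (∀ r → At z r → S r → count (Q r) ≤ c * Y) → (∀ r → At z r → ¬ S r → count (Q r) * q ≤ c′ * Y) →
    count (λ ψ → Σ X λ r → At z r × Q r ψ) {{dec-∃}} * (q * q) ≤ (σ * c + 2 * c′) * (q ^ suc (suc j) * Y)
  mixed {Q} {S} z j σ c c′ Y ez hs h h′ = begin
      C * (q * q)                   ≡⟨ sym (*-assoc C q q) ⟩
      C * q * q
        ≤⟨ *-monoˡ-≤ q (branch₂ {P = λ ψ → Σ X λ r → At z r × Q r ψ} {{dec-∃}} {D = λ r → At z r × S r} {Q = Q}
             {E = λ r → At z r × ¬ S r} {R = Q} sp q (q * (c * Y)) (c′ * Y)
             (λ r w → ≤-trans (*-monoˡ-≤ q (h r (proj₁ w) (proj₂ w))) (≤-reflexive (*-comm (c * Y) q)))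
             (λ r w → h′ r (proj₁ w) (proj₂ w))) ⟩
      (count (λ r → At z r × S r) * (q * (c * Y)) + count (λ r → At z r × ¬ S r) * (c′ * Y)) * q
        ≤⟨ *-monoˡ-≤ q (+-mono-≤ (*-monoˡ-≤ (q * (c * Y)) hs) (*-monoˡ-≤ (c′ * Y)
             (≤-trans (count-mono {Q = At z} λ r w → proj₁ w) (≤-trans (≤-reflexive (trans (count-At z) (cong (br q) ez))) (br-≤2 (suc j)))))) ⟩
      (σ * q ^ j * (q * (c * Y)) + 2 * (q * q ^ j) * (c′ * Y)) * q
        ≡⟨ l σ (q ^ j) q c c′ Y ⟩
      (σ * c + 2 * c′) * (q * (q * q ^ j) * Y) ∎
    where
      open ≤-Reasoning
      C = count (λ ψ → Σ X λ r → At z r × Q r ψ) {{dec-∃}}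
      l : ∀ s a q c d y → (s * a * (q * (c * y)) + 2 * (q * a) * (d * y)) * q ≡ (s * c + 2 * d) * (q * (q * a) * y)
      l = solve-∀
      sp : ∀ ψ → (Σ X λ r → At z r × Q r ψ) → (Σ X λ r → (At z r × S r) × Q r ψ) ⊎ (Σ X λ r → (At z r × ¬ S r) × Q r ψ)
      sp ψ (r , w , x) with decide (S r)
      ... | inj₁ s = inj₁ (r , (w , s) , x)
      ... | inj₂ s = inj₂ (r , (w , s) , x)

  e₁ : ∀ m → q ^ suc n * q ^ (m * suc n) ≡ q ^ (suc m * suc n)
  e₁ m = sym (^-distribˡ-+-* q (suc n) (m * suc n))

  e₀ : ∀ m → q ^ suc n * q ^ (m * suc n + n) ≡ q ^ (suc m * suc n + n)
  e₀ m = trans (sym (^-distribˡ-+-* q (suc n) (m * suc n + n))) (cong (q ^_) (sym (+-assoc (suc n) (m * suc n) n)))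

  eP : ∀ m → q ^ n * q ^ (m * suc n) ≡ q ^ (m * suc n + n)
  eP m = trans (*-comm (q ^ n) _) (sym (^-distribˡ-+-* q (m * suc n) n))

  rk-xa : ∀ {u x φ} → rk x ≡ 1 → F φ → Dj (u ⊔ x) (proj₁ φ) → rk (x ⊔ proj₁ φ) ≡ suc n
  rk-xa ex f d = trans (rk-⊔-Dj (Dj-mono ⊔ʳ ⊑-refl d)) (cong₂ _+_ ex (F-A f))

  -- The rank of the join of u, x and `a` is the sum of the three ranks, so independence does not
  -- depend on the bracketing.
  Dj-xa : ∀ {u x φ} → rk x ≡ 1 → ¬ (x ⊑ u) → F φ → Dj (u ⊔ x) (proj₁ φ) → Dj u (x ⊔ proj₁ φ)
  Dj-xa {u} {x} {a , b} ex nx f d = +-cancelˡ-≡ (rk (u ⊔ x ⊔ a)) _ _ (trans (rk-mod u (x ⊔ a))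
    (trans (cong (rk u +_) (trans (rk-xa {u} ex f d) (cong suc (sym (F-A f)))))
      (trans (+-suc (rk u) (rk a)) (trans (cong (_+ rk a) (sym (rk-⊔-atom ex nx)))
        (trans (sym (rk-⊔-Dj d)) (trans (cong rk assoc) (sym (+-identityʳ _))))))))
    where
      assoc : (u ⊔ x) ⊔ a ≡ u ⊔ x ⊔ a
      assoc = ⊑-antisym (⊔-lub (⊔-lub ⊔ˡ (⊑-trans ⊔ˡ ⊔ʳ)) (⊑-trans ⊔ʳ ⊔ʳ)) (⊔-lub (⊑-trans ⊔ˡ ⊔ˡ) (⊔-lub (⊑-trans ⊔ʳ ⊔ˡ) ⊔ʳ))

  Bound₁ : ℕ → ℕ → ℕ → X → X → Set
  Bound₁ R c m u x = N₁ u x * q ^ R ≤ c * q ^ (m * suc n)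

  Bound₀ : ℕ → ℕ → ℕ → X → Set
  Bound₀ R c m u = N₀ u * q ^ R ≤ c * q ^ (m * suc n + n)

  N₁-absorbed : ∀ {u x} → x ⊑ u → N₁ u x ≡ 0
  N₁-absorbed h = count-none λ { (a , b) (_ , ua , _ , na) → na (⊑-trans h ua) }

  weaken₁ : ∀ {R c c′ m u x} → c ≤ c′ → Bound₁ R c m u x → Bound₁ R c′ m u x
  weaken₁ {m = m} h b = ≤-trans b (*-monoˡ-≤ (q ^ (m * suc n)) h)

  weaken₀ : ∀ {R c c′ m u} → c ≤ c′ → Bound₀ R c m u → Bound₀ R c′ m u
  weaken₀ {m = m} h b = ≤-trans b (*-monoˡ-≤ (q ^ (m * suc n + n)) h)

  trivial₁ : ∀ {u x m} → rk x ≡ 1 → rk u + m ≡ n → Bound₁ 0 κ m u x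
  trivial₁ {m = m} ex e = ≤-trans (≤-reflexive (*-identityʳ _)) (N₁-trivial m ex e)

  trivial₀ : ∀ {u m} → rk u + m ≡ n → Bound₀ 0 κ m u
  trivial₀ {m = m} e = ≤-trans (≤-reflexive (*-identityʳ _)) (N₀-trivial m e)

  child-m : ∀ {u v m} → rk v ≡ suc (rk u) → rk u + suc m ≡ n → rk v + m ≡ n
  child-m {u} {m = m} ev e = trans (cong (_+ m) ev) (trans (sym (+-suc (rk u) m)) e)

  step₁ : ∀ {u x} m R c → rk x ≡ 1 → ¬ (x ⊑ u) → NC u (u ⊔ x) →
    (∀ v → rk v ≡ suc (rk u) → ¬ (x ⊑ v) → Bound₁ R c m v x) → Bound₁ (suc R) (4 * c) (suc m) u x
  step₁ {u} {x} m R c ex nx ((a , b) , f , d , d′) h = begin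
      N₁ u x * (q * q ^ R)
        ≤⟨ *-monoˡ-≤ (q * q ^ R) (split₁ ex f d′) ⟩
      (count (C₁ b u x) + count (C₁ (x ⊔ a) u x)) * (q * q ^ R)
        ≡⟨ *-distribʳ-+ (q * q ^ R) (count (C₁ b u x)) _ ⟩
      count (C₁ b u x) * (q * q ^ R) + count (C₁ (x ⊔ a) u x) * (q * q ^ R)
        ≤⟨ +-mono-≤ (plain b n (q ^ R) c (q ^ (m * suc n)) (F-B f) (child b d))
             (plain (x ⊔ a) n (q ^ R) c (q ^ (m * suc n)) (rk-xa {u} ex f d′) (child (x ⊔ a) (Dj-xa ex nx f d′))) ⟩
      2 * c * (q ^ suc n * q ^ (m * suc n)) + 2 * c * (q ^ suc n * q ^ (m * suc n))
        ≡⟨ cong (λ t → 2 * c * t + 2 * c * t) (e₁ m) ⟩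
      2 * c * q ^ (suc m * suc n) + 2 * c * q ^ (suc m * suc n)
        ≡⟨ l c (q ^ (suc m * suc n)) ⟩
      4 * c * q ^ (suc m * suc n) ∎
    where
      open ≤-Reasoning
      l : ∀ c y → 2 * c * y + 2 * c * y ≡ 4 * c * y
      l = solve-∀
      child : ∀ z → Dj u z → ∀ r → At z r → N₁ (u ⊔ r) x * q ^ R ≤ c * q ^ (m * suc n)
      child z dz r w with decide (x ⊑ u ⊔ r)
      ... | inj₁ k rewrite N₁-absorbed k = z≤n
      ... | inj₂ k = h (u ⊔ r) (child-rk dz w) k

  -- A new point of `a` has about q^n choices and lowers the trivial bound by q^(n+1); a first point
  -- of `b` has about q^(n-1) choices and lowers it by q^n. Either way one factor q is gained.
  step₀ : ∀ {u} m R c → NC u u → (∀ v → rk v ≡ suc (rk u) → Bound₀ R c m v) →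
    (∀ r → rk r ≡ 1 → ¬ (r ⊑ u) → Bound₁ R c (suc m) u r) → Bound₀ (suc R) (4 * c) (suc m) u
  step₀ {u} m R c ((a , b) , f , d , d′) h h′ = begin
      N₀ u * (q * q ^ R)
        ≤⟨ *-monoˡ-≤ (q * q ^ R) (split₀ f d) ⟩
      (count (C₀ b u) + count (CP a u)) * (q * q ^ R)
        ≡⟨ *-distribʳ-+ (q * q ^ R) (count (C₀ b u)) _ ⟩
      count (C₀ b u) * (q * q ^ R) + count (CP a u) * (q * q ^ R)
        ≤⟨ +-mono-≤ (plain b n (q ^ R) c (q ^ (m * suc n + n)) (F-B f) (λ r w → h (u ⊔ r) (child-rk d w)))
             (plain a n′ (q ^ R) c (q ^ (suc m * suc n)) (F-A f)
               (λ r w → h′ r (proj₁ w) (Dj-atom⊑ (≤-reflexive (sym (proj₁ w))) d′ (proj₂ w)))) ⟩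
      2 * c * (q ^ suc n * q ^ (m * suc n + n)) + 2 * c * (q ^ n * q ^ (suc m * suc n))
        ≡⟨ cong₂ (λ s t → 2 * c * s + 2 * c * t) (e₀ m) (eP (suc m)) ⟩
      2 * c * q ^ (suc m * suc n + n) + 2 * c * q ^ (suc m * suc n + n)
        ≡⟨ l c (q ^ (suc m * suc n + n)) ⟩
      4 * c * q ^ (suc m * suc n + n) ∎
    where
      open ≤-Reasoning
      l : ∀ c y → 2 * c * y + 2 * c * y ≡ 4 * c * y
      l = solve-∀

  fresh₁ : ∀ {u x} m → rk x ≡ 1 → ¬ (x ⊑ u) → rk u + m ≡ n → NC u (u ⊔ x) → Bound₁ 1 (4 * κ) m u x
  fresh₁ zero ex nx e c rewrite N₁-top ex (trans (sym (+-identityʳ _)) e) c = z≤n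
  fresh₁ (suc m) ex nx e c = step₁ m 0 κ ex nx c λ v ev nv → trivial₁ {m = m} ex (child-m ev e)

  fresh₀ : ∀ {u} m → rk u + m ≡ n → NC u u → Bound₀ 1 (4 * κ) m u
  fresh₀ {u} zero e ((a , b) , f , d , d′) = begin
      N₀ u * (q * 1)
        ≤⟨ *-monoˡ-≤ (q * 1) (split₀ f d) ⟩
      (count (C₀ b u) + count (CP a u)) * (q * 1)
        ≡⟨ cong (λ t → (t + count (CP a u)) * (q * 1)) (count-none {P = C₀ b u} λ ψ w → let (r , w₁ , w₂ , w₃) = w in
             1+n≰n (≤-trans (≤-reflexive (trans (cong suc (sym (trans (sym (+-identityʳ _)) e))) (sym (child-rk d w₁))))
               (≤-trans (rk-mono w₃) (≤-reflexive (F-A w₂))))) ⟩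
      count (CP a u) * (q * 1)
        ≤⟨ plain a n′ 1 κ (q ^ 0) (F-A f) (λ r w → trivial₁ {m = 0} (proj₁ w) e) ⟩
      2 * κ * (q ^ n * 1)   ≤⟨ *-mono-≤ (*-monoˡ-≤ κ (m≤m+n 2 2)) (≤-reflexive (*-identityʳ (q ^ n))) ⟩
      4 * κ * q ^ n ∎
    where open ≤-Reasoning
  fresh₀ (suc m) e c = step₀ m 0 κ c (λ v ev → trivial₀ {m = m} (child-m ev e)) λ r er _ → trivial₁ {m = suc m} er e

  -- A child is stuck if every member of F meets it.
  stuck₀ : ∀ {u a b a₁ b₁} → F (a , b) → Dj u b → F (a₁ , b₁) → Dj u b₁ → ¬ (a₁ ⊑ u ⊔ b) →
    count (λ r → At b r × ¬ NC (u ⊔ r) (u ⊔ r)) ≤ br q n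
  stuck₀ {u} {a} {b} {a₁} {b₁} f d f₁ d₁ n₁ = ≤-trans
    (count-mono {Q = λ r → At b r × (r ⊑ u ⊔ b₁)} λ r w → proj₁ w , join-hit (proj₁ (proj₁ w)) d₁
      λ dj → proj₂ w (_ , f₁ , dj , Dj-mono ⊑-refl (F-⊑ f₁) dj))
    (count-At-⊓ (λ h → n₁ (⊑-trans (F-⊑ f₁) (⊑-trans ⊔ʳ (rk-eq (⊔-lub ⊔ˡ h) (≤-reflexive
      (trans (rk-⊔-Dj d₁) (trans (cong (rk u +_) (trans (F-B f₁) (sym (F-B f)))) (sym (rk-⊔-Dj d)))))))))
      (F-B f))

  stuckP : ∀ {u a b a₁ b₁} → F (a , b) → Dj u a → F (a₁ , b₁) → Dj u b₁ → ¬ (a₁ ⊑ u ⊔ a) →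
    count (λ r → At a r × ¬ NC u (u ⊔ r)) ≤ br q n′
  stuckP {u} {a} {b} {a₁} {b₁} f d f₁ d₁ n₁ = ≤-trans
    (count-mono {Q = λ r → At a r × (r ⊑ u ⊔ a₁)} λ r w → proj₁ w ,
      join-hit (proj₁ (proj₁ w)) da λ dj → proj₂ w (_ , f₁ , d₁ , dj))
    (count-At-⊓ (λ h → n₁ (⊑-trans ⊔ʳ (rk-eq (⊔-lub ⊔ˡ h) (≤-reflexive
      (trans (rk-⊔-Dj da) (trans (cong (rk u +_) (trans (F-A f₁) (sym (F-A f)))) (sym (rk-⊔-Dj d))))))))
      (F-A f))
    where da = Dj-mono ⊑-refl (F-⊑ f₁) d₁

  -- A stuck child fails to miss (`a₁` , `b₁`) because `u ⊔ r` meets `b₁` or `(u ⊔ r) ⊔ x` meets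
  -- `a₁`. Then r lies in `u ⊔ b₁` or in `(u ⊔ x) ⊔ a₁`. Neither rank exceeds that of `u ⊔ z`, and
  -- both joins contain `a₁`, which `u ⊔ z` does not; so neither contains z.
  stuck₁ : ∀ {u x z a₁ b₁} → rk x ≡ 1 → rk z ≡ suc n → Dj u z → F (a₁ , b₁) → Dj u b₁ → Dj (u ⊔ x) a₁ →
    ¬ (a₁ ⊑ u ⊔ z) → count (λ r → At z r × ¬ NC (u ⊔ r) ((u ⊔ r) ⊔ x)) ≤ br q n + br q n
  stuck₁ {u} {x} {z} {a₁} {b₁} ex ez d f₁ d₁ d₁′ n₁ = ≤-trans
    (count-∪ {P = λ r → At z r × (r ⊑ u ⊔ b₁)} {Q = λ r → At z r × (r ⊑ (u ⊔ x) ⊔ a₁)} h)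
    (+-mono-≤
      (count-At-⊓ (λ h → n₁ (⊑-trans (F-⊑ f₁) (⊑-trans ⊔ʳ (rk-eq (⊔-lub ⊔ˡ h) (≤-reflexive
        (trans (rk-⊔-Dj d₁) (trans (cong (rk u +_) (trans (F-B f₁) (sym ez))) (sym (rk-⊔-Dj d))))))))) ez)
      (count-At-⊓ (λ h → n₁ (⊑-trans ⊔ʳ (rk-eq (⊔-lub (⊑-trans ⊔ˡ ⊔ˡ) h) (≤-trans
        (≤-trans (≤-reflexive (rk-⊔-Dj d₁′)) (+-mono-≤ (rk-⊔-atom-≤ ex) (≤-reflexive (F-A f₁))))
        (≤-reflexive (trans (sym (+-suc (rk u) n)) (trans (cong (rk u +_) (sym ez)) (sym (rk-⊔-Dj d))))))))) ez))
    where
      h : ∀ r → At z r × ¬ NC (u ⊔ r) ((u ⊔ r) ⊔ x) → (At z r × (r ⊑ u ⊔ b₁)) ⊎ (At z r × (r ⊑ (u ⊔ x) ⊔ a₁))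
      h r (w , c) with decide (Dj (u ⊔ r) b₁)
      ... | inj₂ nd = inj₁ (w , join-hit (proj₁ w) d₁ nd)
      ... | inj₁ dj = inj₂ (w , join-hit (proj₁ w) d₁′ λ dj′ → c (_ , f₁ , dj ,
              Dj-mono (⊔-lub (⊔-lub (⊑-trans ⊔ˡ ⊔ˡ) ⊔ʳ) (⊑-trans ⊔ʳ ⊔ˡ)) ⊑-refl dj′))

  Escape : X → X → X → Set
  Escape u w y = Σ (X × X) λ φ → Missed u w φ × ¬ (proj₁ φ ⊑ y)

  private
    q² : ∀ {N c} → N * (q * q) ≤ c → N * q ^ 2 ≤ c
    q² {N} h = ≤-trans (≤-reflexive (cong (N *_) (cong (q *_) (*-identityʳ q)))) h

    q¹ : ∀ {N c} → N * q ^ 1 ≤ c → N * q ≤ c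
    q¹ {N} h = ≤-trans (≤-reflexive (cong (N *_) (sym (*-identityʳ q)))) h

  -- The stuck children are a fraction O(1/q) and are bounded trivially; the remaining ones gain
  -- once more by `fresh₁`. Together u gains q^2.
  mixed₁ : ∀ {u x z} m → rk x ≡ 1 → rk u + suc m ≡ n → rk z ≡ suc n → Dj u z → Escape u (u ⊔ x) (u ⊔ z) →
    count (C₁ z u x) * (q * q) ≤ (4 * κ + 2 * (4 * κ)) * q ^ (suc m * suc n)
  mixed₁ {u} {x} {z} m ex e ez dz ((a₁ , b₁) , (f₁ , d₁ , d₁′) , n₁) = ≤-trans
      (mixed {S = λ r → ¬ NC (u ⊔ r) ((u ⊔ r) ⊔ x)} z n′ 4 κ (4 * κ) (q ^ (m * suc n)) ez
        (≤-trans (stuck₁ ex ez dz f₁ d₁ d₁′ n₁) (≤-trans (+-mono-≤ (br-≤2 n′) (br-≤2 n′)) (≤-reflexive (l (q ^ n′)))))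
        (λ r w _ → N₁-trivial m ex (child-m (child-rk dz w) e)) fresh)
      (≤-reflexive (cong ((4 * κ + 2 * (4 * κ)) *_) (e₁ m)))
    where
      l : ∀ x → 2 * x + 2 * x ≡ 4 * x
      l = solve-∀
      fresh : ∀ r → At z r → ¬ ¬ NC (u ⊔ r) ((u ⊔ r) ⊔ x) → N₁ (u ⊔ r) x * q ≤ 4 * κ * q ^ (m * suc n)
      fresh r w c with decide (x ⊑ u ⊔ r)
      ... | inj₁ k rewrite N₁-absorbed k = z≤n
      ... | inj₂ k = q¹ {N₁ (u ⊔ r) x} (fresh₁ m ex k (child-m (child-rk dz w) e) (stable c))

  last₁ : ∀ {u x} m → rk x ≡ 1 → ¬ (x ⊑ u) → rk u + suc m ≡ n → NC u (u ⊔ x) →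
    (∀ y → rk y ≤ rk u + suc n → Escape u (u ⊔ x) y) → Bound₁ 2 (24 * κ) (suc m) u x
  last₁ {u} {x} m ex nx e ((a , b) , f , d , d′) esc = q² {N₁ u x} (begin
      N₁ u x * (q * q)
        ≤⟨ *-monoˡ-≤ (q * q) (split₁ ex f d′) ⟩
      (count (C₁ b u x) + count (C₁ (x ⊔ a) u x)) * (q * q)
        ≡⟨ *-distribʳ-+ (q * q) (count (C₁ b u x)) _ ⟩
      count (C₁ b u x) * (q * q) + count (C₁ (x ⊔ a) u x) * (q * q)
        ≤⟨ +-mono-≤ (mixed₁ m ex e (F-B f) d (esc _ (join b (F-B f))))
             (mixed₁ m ex e (rk-xa {u} ex f d′) (Dj-xa ex nx f d′) (esc _ (join (x ⊔ a) (rk-xa {u} ex f d′)))) ⟩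
      (4 * κ + 2 * (4 * κ)) * Y + (4 * κ + 2 * (4 * κ)) * Y
        ≡⟨ l κ Y ⟩
      24 * κ * Y ∎)
    where
      open ≤-Reasoning
      Y = q ^ (suc m * suc n)
      l : ∀ c y → (4 * c + 2 * (4 * c)) * y + (4 * c + 2 * (4 * c)) * y ≡ 24 * c * y
      l = solve-∀
      join : ∀ z → rk z ≡ suc n → rk (u ⊔ z) ≤ rk u + suc n
      join z ez = ≤-trans (rk-⊔-≤ u z) (≤-reflexive (cong (rk u +_) ez))

  mixed₀ : ∀ {u a b} m → rk u + suc m ≡ n → F (a , b) → Dj u b → Escape u u (u ⊔ b) →
    count (C₀ b u) * (q * q) ≤ 10 * κ * q ^ (suc m * suc n + n)
  mixed₀ {u} {a} {b} m e f d ((a₁ , b₁) , (f₁ , d₁ , _) , n₁) = ≤-trans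
      (mixed {S = λ r → ¬ NC (u ⊔ r) (u ⊔ r)} b n′ 2 κ (4 * κ) (q ^ (m * suc n + n)) (F-B f)
        (≤-trans (stuck₀ f d f₁ d₁ n₁) (br-≤2 n′))
        (λ r w _ → N₀-trivial m (child-m (child-rk d w) e))
        (λ r w c → q¹ {N₀ (u ⊔ r)} (fresh₀ m (child-m (child-rk d w) e) (stable c))))
      (≤-reflexive (cong₂ _*_ (l κ) (e₀ m)))
    where l : ∀ c → 2 * c + 2 * (4 * c) ≡ 10 * c
          l = solve-∀

  mixedP : ∀ {u a b} m → rk u + m ≡ n → F (a , b) → Dj u a → Escape u u (u ⊔ a) →
    count (CP a u) * (q * q) ≤ 10 * κ * q ^ (m * suc n + n)
  mixedP {u} {a} {b} m e f d ((a₁ , b₁) , (f₁ , d₁ , _) , n₁) = ≤-trans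
      (mixed {S = λ r → ¬ NC u (u ⊔ r)} a k 2 κ (4 * κ) (q ^ (m * suc n)) (F-A f)
        (≤-trans (stuckP f d f₁ d₁ n₁) (br-≤2 k))
        (λ r w _ → N₁-trivial m (proj₁ w) e)
        (λ r w c → q¹ {N₁ u r} (fresh₁ m (proj₁ w) (Dj-atom⊑ (≤-reflexive (sym (proj₁ w))) d (proj₂ w)) e (stable c))))
      (≤-reflexive (cong₂ _*_ (l κ) (eP m)))
    where l : ∀ c → 2 * c + 2 * (4 * c) ≡ 10 * c
          l = solve-∀

  combine₀ : ∀ {u a b c c′ Y} → F (a , b) → Dj u b → count (C₀ b u) * (q * q) ≤ c * Y →
    count (CP a u) * (q * q) ≤ c′ * Y → N₀ u * q ^ 2 ≤ (c + c′) * Y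
  combine₀ {u} {a} {b} {c} {c′} {Y} f d h h′ = q² {N₀ u} (≤-trans (*-monoˡ-≤ (q * q) (split₀ f d))
    (≤-trans (≤-reflexive (*-distribʳ-+ (q * q) (count (C₀ b u)) _))
      (≤-trans (+-mono-≤ h h′) (≤-reflexive (sym (*-distribʳ-+ Y c c′))))))

  cst : ℕ → ℕ
  cst = cst-of k

  c₂ c₃ : ℕ
  c₂ = c₂-of k
  c₃ = c₃-of k

  Avoiding : X → X × X → Set
  Avoiding w φ = F φ × Dj w (proj₁ φ)

  -- Essential cover: almost all a's meet w. Only `a` is asked for, because flags with `a` missing w
  -- and `b` meeting a subspace of w of small rank are few anyway.
  EC : X → Set
  EC w = Few c₂ (count (Avoiding w))

  -- The way in which the choice of an escaping flag can fail: almost all flags whose `a` misses w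
  -- have `b` inside the hyperplane h.
  Pair : X × X → Set
  Pair (w , h) = Few c₃ (count (λ φ → F φ × Dj w (proj₁ φ) × ¬ (proj₂ φ ⊑ h)))

  NoPair : ℕ → Set
  NoPair j = ∀ w h → rk w ≡ j → rk h ≡ n + n → ¬ Pair (w , h)

  -- A point of `u ⊓ b` is not in `a`, since `a` misses w, which contains u. So it serves as known
  -- point of `b`, with nothing known about `a`.
  via-B : ∀ {u w} → u ⊑ w → ∀ c → (∀ r → At u r → N₁ 𝟘 r ≤ c) → count (λ φ → F φ × ¬ Dj u (proj₂ φ) × Dj w (proj₁ φ)) ≤ br q (rk u) * c
  via-B {u} {w} uw c h = cover-≤ {D = At u} {Q = In₁ 𝟘}
    (λ { (a , b) (f , nd , dj) → let (r , er , ru , rb) = common-atom u b nd in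
      r , (er , ru) , f , 𝟘-min , rb , λ ra → meet-¬Dj (≤-reflexive (sym er)) (⊑-trans ru uw) ra dj })
    (≤-reflexive (count-At u)) h

  via-B-few : ∀ {u w} → u ⊑ w → rk u ≤ n′ → Few (2 * κ) (count (λ φ → F φ × ¬ Dj u (proj₂ φ) × Dj w (proj₁ φ)))
  via-B-few {u} uw h = few-points {κ} (≤-trans (via-B uw (κ * q ^ (n * n)) (λ r w → N₁-ekr (proj₁ w)))
    (*-monoˡ-≤ (κ * q ^ (n * n)) (br-mono q h)))

  missed-or : ∀ {u w} φ → Avoiding w φ → Missed u w φ ⊎ (F φ × ¬ Dj u (proj₂ φ) × Dj w (proj₁ φ))
  missed-or {u} φ (f , dj) with decide (Dj u (proj₂ φ))
  ... | inj₁ d = inj₁ (f , d , dj)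
  ... | inj₂ d = inj₂ (f , d , dj)

  -- More flags miss the state than fit into any set bounded by κ q^(n²+n-2); in particular their
  -- a's do not all lie in one subspace of rank below 2n.
  Big : X → X → Set
  Big u w = ¬ Few κ (count (Missed u w))

  big-NC : ∀ {u w} → Big u w → NC u w
  big-NC {u} {w} b with search (Missed u w)
  ... | inj₁ x = x
  ... | inj₂ h = ⊥-elim (b (few (≤-trans (≤-reflexive (cong (_* q ^ (2 + n)) (count-none h))) z≤n)))

  big-escape : ∀ {u w y} → Big u w → rk y < n + n → Escape u w y
  big-escape {u} {w} {y} b h with search (λ φ → Missed u w φ × ¬ (proj₁ φ ⊑ y))
  ... | inj₁ x = x
  ... | inj₂ no-esc = ⊥-elim (b (few-mono
        (count-mono {Q = λ φ → F φ × (proj₁ φ ⊑ y)} λ φ m → proj₁ m , stable λ k → no-esc φ (m , k)) (few-nn {κ} (small-few h))))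

  -- If all missed a's lay in y, a flag with `a` missing w and b ≰ y would have `b` meeting u, or a
  -- ≤ y but b ≰ y. Both kinds are few, by `via-B-few` and `hyperplane-few`, so (w , y) would be a
  -- `Pair`.
  pair-escape : ∀ {u w y} → u ⊑ w → rk u ≤ n′ → rk y ≡ n + n → NoPair (rk w) → Escape u w y
  pair-escape {u} {w} {y} uw hu ey np with search (λ φ → Missed u w φ × ¬ (proj₁ φ ⊑ y))
  ... | inj₁ x = x
  ... | inj₂ no-esc = ⊥-elim (np w y refl ey (few-∪
        {P = λ φ → F φ × ¬ Dj u (proj₂ φ) × Dj w (proj₁ φ)} {Q = λ φ → F φ × (proj₁ φ ⊑ y) × ¬ (proj₂ φ ⊑ y)}
        (λ φ v → case missed-or {u} {w} φ (proj₁ v , proj₁ (proj₂ v)) of λ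
          { (inj₁ m) → inj₂ (proj₁ v , stable (λ k → no-esc φ (m , k)) , proj₂ (proj₂ v)) ; (inj₂ x) → inj₁ x })
        (via-B-few uw hu) (few-nn {κ} (hyperplane-few ey))))

  -- There are about q^j points in w, so a gain of exactly `rk w` factors at each of them reaches
  -- the exponent n² + n - 2.
  start : ∀ {w j c} → rk w ≡ suc j → (∀ r → rk r ≡ 1 → Bound₀ (suc j) c n′ r) →
    Few (2 * c) (count (λ φ → F φ × ¬ Dj w (proj₁ φ)))
  start {w} {j} {c} ew h = few (*-cancelʳ-≤ _ _ (q ^ j) {{m^n≢0 q j}} (begin
      C * q ^ (2 + n) * q ^ j
        ≡⟨ l C q (q ^ n) (q ^ j) ⟩
      C * (q * q ^ j) * q ^ suc n
        ≤⟨ *-monoˡ-≤ (q ^ suc n) (branch {D = At w} {Q = In₀}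
             (λ { (a , b) (f , nd) → let (r , er , rw , ra) = common-atom w a nd in r , (er , rw) , f , ra })
             (q ^ suc j) (c * q ^ (n′ * suc n + n)) (λ r v → h r (proj₁ v))) ⟩
      count (At w) * (c * q ^ (n′ * suc n + n)) * q ^ suc n
        ≤⟨ *-monoˡ-≤ (q ^ suc n) (*-monoˡ-≤ (c * q ^ (n′ * suc n + n))
             (≤-trans (≤-reflexive (trans (count-At w) (cong (br q) ew))) (br-≤2 j))) ⟩
      2 * q ^ j * (c * q ^ (n′ * suc n + n)) * q ^ suc n
        ≡⟨ l′ (q ^ j) c (q ^ (n′ * suc n + n)) (q ^ suc n) ⟩
      2 * c * (q ^ suc n * q ^ (n′ * suc n + n)) * q ^ j
        ≡⟨ cong (λ t → 2 * c * t * q ^ j) (e₀ n′) ⟩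
      2 * c * q ^ (n * suc n + n) * q ^ j ∎))
    where
      open ≤-Reasoning
      C = count (λ φ → F φ × ¬ Dj w (proj₁ φ))
      l : ∀ c q a b → c * (q * (q * a)) * b ≡ c * (q * b) * (q * a)
      l = solve-∀
      l′ : ∀ a c y z → 2 * a * (c * y) * z ≡ 2 * c * (z * y) * a
      l′ = solve-∀

  -- K is to be thought of as the least rank of an essential cover, capped at n + 1. Below K every
  -- state is `Big` as long as `rk u ≤ n′`.
  module Minimal (K : ℕ) (K≤ : K ≤ suc n) (noEC : ∀ w → rk w < K → ¬ EC w) where

    big : ∀ {u w} → rk u ≤ n′ → u ⊑ w → rk w < K → Big u w
    big {u} {w} hu uw hw f = noEC w hw (few-weaken (m≤m+n (κ + 2 * κ) _)
      (few-∪ {P = Missed u w} {Q = λ φ → F φ × ¬ Dj u (proj₂ φ) × Dj w (proj₁ φ)} (missed-or {u} {w}) f (via-B-few uw hu)))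

    ux-rk : ∀ {u x} → rk x ≡ 1 → ¬ (x ⊑ u) → suc (rk u) < K → rk (u ⊔ x) < K
    ux-rk ex nx h = ≤-trans (≤-reflexive (cong suc (rk-⊔-atom ex nx))) h

    low : ∀ {i R} → suc i + suc R ≤ K → (i ≤ n′) × (suc i < K)
    low {i} {R} h = ≤-pred (≤-pred (≤-trans h′ K≤)) , h′
      where h′ : suc (suc i) ≤ K
            h′ = ≤-trans (≤-trans (s≤s (m≤m+n (suc i) R)) (≤-reflexive (sym (+-suc (suc i) R)))) h

    no-m : ∀ {i} {A : Set} → i + 0 ≡ n → i ≤ n′ → A
    no-m e h = ⊥-elim (1+n≰n (≤-trans (≤-reflexive (trans (sym e) (+-identityʳ _))) h))

    -- The subspace tested against `a` is `u ⊔ x`, one rank above u; this accounts for the shift in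
    -- the number of available steps.
    C₁-bound : ∀ R m u x → rk x ≡ 1 → ¬ (x ⊑ u) → rk u + m ≡ n → suc (rk u) + R ≤ K → Bound₁ R (cst R) m u x
    C₁-bound zero m u x ex nx e h = weaken₁ {0} {m = m} (κ≤cst k) (trivial₁ {m = m} ex e)
    C₁-bound (suc R) zero u x ex nx e h = no-m e (proj₁ (low h))
    C₁-bound (suc R) (suc m) u x ex nx e h = weaken₁ {suc R} {m = suc m} (cst-step k R)
      (step₁ m R (cst R) ex nx (big-NC (big (proj₁ (low h)) ⊔ˡ (ux-rk ex nx (proj₂ (low h)))))
        λ v ev nv → C₁-bound R m v x ex nv (child-m ev e)
          (≤-trans (≤-reflexive (trans (cong (λ t → suc t + R) ev) (sym (+-suc (suc (rk u)) R)))) h))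

    -- One gain more than `C₁-bound`, won by `last₁` at the last state below K. The joins occurring
    -- there reach hyperplane rank only if `rk u` is n′ and K is n + 1; then w has rank n, and
    -- `NoPair n` provides the escape.
    C₁′-bound : (K ≡ suc n → NoPair n) → ∀ R m u x → rk x ≡ 1 → ¬ (x ⊑ u) → rk u + m ≡ n →
      rk u + (2 + R) ≡ K → Bound₁ (2 + R) (cst (2 + R)) m u x
    C₁′-bound np R m u x ex nx e h = go R m e h
      where
        h₂ : suc (suc (rk u)) ≤ K
        h₂ = ≤-trans (≤-trans (s≤s (s≤s (m≤m+n (rk u) R))) (≤-reflexive (l (rk u) R))) (≤-reflexive h)
          where l : ∀ u R → suc (suc (u + R)) ≡ u + (2 + R)
                l = solve-∀
        u≤ : rk u ≤ n′
        u≤ = ≤-pred (≤-pred (≤-trans h₂ K≤))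
        nc : NC u (u ⊔ x)
        nc = big-NC (big u≤ ⊔ˡ (ux-rk ex nx h₂))
        go : ∀ R m → rk u + m ≡ n → rk u + (2 + R) ≡ K → Bound₁ (2 + R) (cst (2 + R)) m u x
        go R zero e h = no-m e u≤
        go zero (suc m) e h = weaken₁ {2} {m = suc m} (κ≤cst₂ k {24} (m≤m+n 24 40)) (last₁ m ex nx e nc esc)
          where
            eK : suc (suc (rk u)) ≡ K
            eK = trans (l (rk u)) h
              where l : ∀ x → suc (suc x) ≡ x + 2
                    l = solve-∀
            esc : ∀ y → rk y ≤ rk u + suc n → Escape u (u ⊔ x) y
            esc y hy with decide (rk y ≡ n + n)
            ... | inj₂ ne = big-escape (big u≤ ⊔ˡ (ux-rk ex nx h₂)) (≤∧≢⇒< (≤-trans hy (≤-trans (+-monoˡ-≤ (suc n) u≤) (≤-reflexive (+-suc n′ n)))) ne)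
            ... | inj₁ ey = pair-escape ⊔ˡ u≤ ey (subst NoPair (sym (trans (rk-⊔-atom ex nx) (cong suc eu)))
                    (np (trans (sym eK) (cong (2 +_) eu))))
              where
                eu : rk u ≡ n′
                eu = ≤-antisym u≤ (+-cancelʳ-≤ (suc n) _ _ (≤-trans (≤-reflexive (+-suc n′ n)) (≤-trans (≤-reflexive (sym ey)) hy)))
        go (suc R) (suc m) e h = weaken₁ {3 + R} {m = suc m} (cst-step k (2 + R))
          (step₁ m (2 + R) (cst (2 + R)) ex nx nc λ v ev nv → C₁′-bound np R m v x ex nv (child-m ev e)
            (trans (cong (_+ (2 + R)) ev) (trans (sym (+-suc (rk u) (2 + R))) h)))

    C₀-bound : ∀ R m u → rk u + m ≡ n → rk u + R ≤ K → rk u + R ≤ n → Bound₀ R (cst R) m u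
    C₀-bound zero m u e h h′ = weaken₀ {0} {m = m} {u = u} (κ≤cst k) (trivial₀ {m = m} e)
    C₀-bound (suc R) m u e h h′ = go m e
      where
        h₁ : suc (rk u + R) ≤ K
        h₁ = ≤-trans (≤-reflexive (sym (+-suc (rk u) R))) h
        u≤ : rk u ≤ n′
        u≤ = ≤-pred (≤-trans (s≤s (m≤m+n (rk u) R)) (≤-trans (≤-reflexive (sym (+-suc (rk u) R))) h′))
        go : ∀ m → rk u + m ≡ n → Bound₀ (suc R) (cst (suc R)) m u
        go zero e = no-m e u≤
        go (suc m) e = weaken₀ {suc R} {m = suc m} (cst-step k R)
          (step₀ m R (cst R) (big-NC (big u≤ ⊑-refl (≤-trans (s≤s (m≤m+n (rk u) R)) h₁)))
            (λ v ev → C₀-bound R m v (child-m ev e)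
              (≤-trans (≤-reflexive (trans (cong (_+ R) ev) (sym (+-suc (rk u) R)))) h)
              (≤-trans (≤-reflexive (trans (cong (_+ R) ev) (sym (+-suc (rk u) R)))) h′))
            λ r er nr → C₁-bound R (suc m) u r er nr e h₁)

    -- Induction from the states with two steps left, at total T = rank + remaining steps.
    module _ (T : ℕ) (T≤ : T ≤ 2 + n) (T≤K : T ≤ 2 + K)
             (base : ∀ u m → rk u + m ≡ n → rk u + 2 ≡ T → Bound₀ 2 (cst 2) m u)
             (side : ∀ R u m x → rk x ≡ 1 → ¬ (x ⊑ u) → rk u + m ≡ n → rk u + (3 + R) ≡ T →
               Bound₁ (2 + R) (cst (2 + R)) m u x) where

      climb : ∀ R m u → rk u + m ≡ n → rk u + (2 + R) ≡ T → Bound₀ (2 + R) (cst (2 + R)) m u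
      climb zero m u e h = base u m e h
      climb (suc R) m u e h = go m e
        where
          h₃ : suc (suc (suc (rk u))) ≤ T
          h₃ = ≤-trans (≤-trans (s≤s (s≤s (s≤s (m≤m+n (rk u) R)))) (≤-reflexive (l (rk u) R))) (≤-reflexive h)
            where l : ∀ u R → suc (suc (suc (u + R))) ≡ u + (2 + suc R)
                  l = solve-∀
          u≤ : rk u ≤ n′
          u≤ = ≤-pred (≤-pred (≤-pred (≤-trans h₃ T≤)))
          go : ∀ m → rk u + m ≡ n → Bound₀ (3 + R) (cst (3 + R)) m u
          go zero e = no-m e u≤
          go (suc m) e = weaken₀ {3 + R} {m = suc m} (cst-step k (2 + R))
            (step₀ m (2 + R) (cst (2 + R)) (big-NC (big u≤ ⊑-refl (≤-pred (≤-pred (≤-trans h₃ T≤K)))))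
              (λ v ev → climb R m v (child-m ev e) (trans (cong (_+ (2 + R)) ev) (trans (sym (+-suc (rk u) (2 + R))) h)))
              λ r er nr → side R u (suc m) r er nr e h)

    private
      plus2 : ∀ {x y} → x + 2 ≡ suc (suc y) → x ≡ y
      plus2 {x} e = suc-injective (suc-injective (trans (l x) e))
        where l : ∀ x → suc (suc x) ≡ x + 2
              l = solve-∀

    -- At rank n′ the join `u ⊔ b` is a hyperplane, from which `NoPair n′` lets a flag escape. The
    -- total n + 1 is what `start` demands of a pair at rank n.
    base-b : K ≡ suc n → NoPair n′ → ∀ u m → rk u + m ≡ n → rk u + 2 ≡ suc n → Bound₀ 2 (cst 2) m u
    base-b eK np u m e h = go m e
      where
        eu : rk u ≡ n′
        eu = plus2 h
        bg : Big u u
        bg = big (≤-reflexive eu) ⊑-refl (≤-trans (≤-reflexive (cong suc eu)) (≤-trans (n≤1+n n) (≤-reflexive (sym eK))))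
        go : ∀ m → rk u + m ≡ n → Bound₀ 2 (cst 2) m u
        from-NC : ∀ m → rk u + suc m ≡ n → NC u u → Bound₀ 2 (cst 2) (suc m) u
        go zero e = no-m e (≤-reflexive eu)
        go (suc m) e = from-NC m e (big-NC bg)
        from-NC m e ((a , b) , f , d , d′) = weaken₀ {2} {m = suc m} {u = u} (κ+cst≤cst₂ k)
            (combine₀ {u} {c = 10 * κ} {c′ = 2 * cst 1} {Y = q ^ (suc m * suc n + n)} f d
              (mixed₀ m e f d (pair-escape ⊑-refl (≤-reflexive eu)
                (trans (rk-⊔-Dj d) (trans (cong₂ _+_ eu (F-B f)) (+-suc n′ n))) (subst NoPair (sym eu) np)))
              (≤-trans (≤-reflexive (cong (count (CP a u) *_) (cong (q *_) (sym (*-identityʳ q)))))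
                (≤-trans (plain a n′ (q ^ 1) (cst 1) (q ^ (suc m * suc n)) (F-A f)
                  λ r w → C₁-bound 1 (suc m) u r (proj₁ w) (Dj-atom⊑ (≤-reflexive (sym (proj₁ w))) d′ (proj₂ w)) e
                    (≤-trans (≤-reflexive (trans (+-comm (suc (rk u)) 1) (cong (2 +_) eu))) (≤-reflexive (sym eK))))
                  (≤-reflexive (cong (2 * cst 1 *_) (eP (suc m)))))))

    -- The double gain at rank K - 1 gives each point the K gains demanded by `start` for a cover of
    -- rank K. The join `u ⊔ a` is too small to be a hyperplane, and `u ⊔ b` is one only for K = n.
    base-c : K ≤ n → (K ≡ n → NoPair n′) → ∀ u m → rk u + m ≡ n → rk u + 2 ≡ suc K → Bound₀ 2 (cst 2) m u
    base-c K≤n np u m e h = go m e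
      where
        eK : suc (rk u) ≡ K
        eK = suc-injective (trans (l (rk u)) h)
          where l : ∀ x → suc (suc x) ≡ x + 2
                l = solve-∀
        u≤ : rk u ≤ n′
        u≤ = ≤-pred (≤-trans (≤-reflexive eK) K≤n)
        bg : Big u u
        bg = big u≤ ⊑-refl (≤-reflexive eK)
        go : ∀ m → rk u + m ≡ n → Bound₀ 2 (cst 2) m u
        from-NC : ∀ m → rk u + suc m ≡ n → NC u u → Bound₀ 2 (cst 2) (suc m) u
        go zero e = no-m e u≤
        go (suc m) e = from-NC m e (big-NC bg)
        from-NC m e ((a , b) , f , d , d′) = weaken₀ {2} {m = suc m} {u = u} (≤-trans (≤-reflexive (sym (*-distribʳ-+ κ 10 10))) (κ≤cst₂ k {20} (m≤m+n 20 44)))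
            (combine₀ {u} {c = 10 * κ} {c′ = 10 * κ} {Y = q ^ (suc m * suc n + n)} f d (mixed₀ m e f d esc) (mixedP (suc m) e f d′
              (big-escape bg (s≤s (≤-trans (rk-⊔-≤ u a) (+-mono-≤ u≤ (≤-reflexive (F-A f))))))))
          where
            esc : Escape u u (u ⊔ b)
            esc with decide (rk (u ⊔ b) ≡ n + n)
            ... | inj₂ ne = big-escape bg (≤∧≢⇒< (≤-trans (rk-⊔-≤ u b) (≤-trans (+-mono-≤ u≤ (≤-reflexive (F-B f))) (≤-reflexive (+-suc n′ n)))) ne)
            ... | inj₁ ey = pair-escape ⊑-refl u≤ ey (subst NoPair (sym eu) (np (trans (sym eK) (cong suc eu))))
              where eu : rk u ≡ n′
                    eu = +-cancelʳ-≡ (suc n) _ _ (trans (cong (rk u +_) (sym (F-B f))) (trans (sym (rk-⊔-Dj d)) (trans ey (sym (+-suc n′ n)))))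

    -- The estimate `via-B-few` ends at rank n′. At rank n, flags with a point of u in `b` are
    -- bounded by the n + 1 gains of `C₁′-bound`, started from `𝟘` with that point known.
    big-top : K ≡ suc n → NoPair n → ∀ u → rk u ≡ n → Big u u
    big-top eK np u eu f = noEC u (≤-trans (≤-reflexive (cong suc eu)) (≤-reflexive (sym eK)))
        (few-weaken (+-monoˡ-≤ (2 * cst (suc n)) (m≤m+n κ (2 * κ)))
          (few-∪ {P = Missed u u} {Q = λ φ → F φ × ¬ Dj u (proj₂ φ) × Dj u (proj₁ φ)} (missed-or {u} {u}) f (few bound)))
      where
        open ≤-Reasoning
        C = count (λ φ → F φ × ¬ Dj u (proj₂ φ) × Dj u (proj₁ φ))
        c = cst (suc n)
        l : ∀ C q a → C * (q * (q * a)) ≡ C * (q * a) * q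
        l = solve-∀
        l′ : ∀ a c y q → 2 * a * (c * y) * q ≡ 2 * c * (q * a * y)
        l′ = solve-∀
        bound : C * q ^ (2 + n) ≤ 2 * c * q ^ (n * suc n + n)
        bound = begin
          C * (q * (q * q ^ n))   ≡⟨ l C q (q ^ n) ⟩
          C * q ^ suc n * q
            ≤⟨ *-monoˡ-≤ q (branch {D = At u} {Q = In₁ 𝟘}
                 (λ { (a , b) (f , nd , dj) → let (r , er , ru , rb) = common-atom u b nd in
                   r , (er , ru) , f , 𝟘-min , rb , λ ra → meet-¬Dj (≤-reflexive (sym er)) ru ra dj })
                 (q ^ suc n) (c * q ^ (n * suc n))
                 λ r w → C₁′-bound (λ _ → np) n′ n 𝟘 r (proj₁ w)
                   (λ h → 1+n≰n (≤-trans (≤-trans (≤-reflexive (sym (proj₁ w))) (rk-mono h)) (≤-reflexive rk-𝟘)))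
                   (cong (_+ n) rk-𝟘) (trans (cong (_+ suc n) rk-𝟘) (sym eK))) ⟩
          count (At u) * (c * q ^ (n * suc n)) * q
            ≤⟨ *-monoˡ-≤ q (*-monoˡ-≤ (c * q ^ (n * suc n)) (≤-trans (≤-reflexive (trans (count-At u) (cong (br q) eu))) (br-≤2 n′))) ⟩
          2 * q ^ n′ * (c * q ^ (n * suc n)) * q   ≡⟨ l′ (q ^ n′) c (q ^ (n * suc n)) q ⟩
          2 * c * (q ^ n * q ^ (n * suc n))        ≡⟨ cong (2 * c *_) (eP n) ⟩
          2 * c * q ^ (n * suc n + n) ∎

    -- At rank n no point can be added to `a`, so only the branch that learns a point of `b` is
    -- left, and it gains q^2. Starting at `𝟘`, the total of n + 2 gains bounds all of `F`.
    base-d : K ≡ suc n → NoPair n → ∀ u m → rk u + m ≡ n → rk u + 2 ≡ 2 + n → Bound₀ 2 (cst 2) m u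
    base-d eK np u m e h = go m e
      where
        eu : rk u ≡ n
        eu = plus2 h
        bg : Big u u
        bg = big-top eK np u eu
        go : ∀ m → rk u + m ≡ n → Bound₀ 2 (cst 2) m u
        from-NC : rk u + 0 ≡ n → NC u u → Bound₀ 2 (cst 2) 0 u
        go (suc m) e = ⊥-elim (1+n≰n (≤-trans (≤-trans (s≤s (m≤m+n n m)) (≤-reflexive (sym (+-suc n m))))
          (≤-reflexive (trans (cong (_+ suc m) (sym eu)) e))))
        go zero e = from-NC e (big-NC bg)
        from-NC e ((a , b) , f , d , d′) = weaken₀ {2} {m = 0} {u = u} (κ≤cst₂ k {10} (m≤m+n 10 54))
            (combine₀ {u} {c = 0} {c′ = 10 * κ} {Y = q ^ (0 * suc n + n)} f d (≤-reflexive (cong (_* (q * q)) (count-none {P = C₀ b u} λ ψ w →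
                let (r , w₁ , w₂ , w₃) = w in 1+n≰n (≤-trans (≤-reflexive (sym (trans (child-rk d w₁) (cong suc eu))))
                  (≤-trans (rk-mono w₃) (≤-reflexive (F-A w₂)))))))
              (mixedP 0 e f d′ esc))
          where
            Y = u ⊔ a
            eY : rk Y ≡ n + n
            eY = trans (rk-⊔-Dj d′) (cong₂ _+_ eu (F-A f))
            -- If a₁ and b₁ both lay in the hyperplane u ⊔ a, then b₁ would meet u.
            esc : Escape u u Y
            esc with search (λ φ → Missed u u φ × ¬ (proj₁ φ ⊑ Y))
            ... | inj₁ x = x
            ... | inj₂ none = ⊥-elim (bg (few-mono (count-mono {Q = λ φ → F φ × (proj₁ φ ⊑ Y) × ¬ (proj₂ φ ⊑ Y)}
                  λ φ m → proj₁ m , stable (λ k → none φ (m , k)) , λ k →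
                    1+n≰n (subst₂ _≤_ (trans (cong₂ _+_ eu (F-B (proj₁ m))) (+-suc n n)) eY (Dj-bound ⊔ˡ k (proj₁ (proj₂ m)))))
                (few-nn {κ} (hyperplane-few eY))))

  c₅ c₆ : ℕ
  c₅ = c₅-of k
  c₆ = c₆-of k

  Conclusion : Set
  Conclusion = (Σ X λ x → (rk x ≡ 1) × EC x)
    ⊎ (Σ X λ h → (rk h ≡ n + n) × Few c₅ (count (λ φ → F φ × ¬ (proj₂ φ ⊑ h))))
    ⊎ Few c₆ (count F)

  from-pair : ∀ {w h c} → Pair (w , h) → c ≤ 2 * cst n → Few c (count (λ φ → F φ × ¬ Dj w (proj₁ φ))) →
    Few c₅ (count (λ φ → F φ × ¬ (proj₂ φ ⊑ h)))
  from-pair {w} {h} pr hc f = few-weaken (+-monoʳ-≤ c₃ hc) (few-∪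
    {P = λ φ → F φ × Dj w (proj₁ φ) × ¬ (proj₂ φ ⊑ h)} {Q = λ φ → F φ × ¬ Dj w (proj₁ φ)}
    (λ φ v → case decide (Dj w (proj₁ φ)) of λ
      { (inj₁ d) → inj₁ (proj₁ v , d , proj₂ v) ; (inj₂ d) → inj₂ (proj₁ v , d) }) pr f)

  from-EC : ∀ {w c} → EC w → c ≤ 2 * cst (2 + n) → Few c (count (λ φ → F φ × ¬ Dj w (proj₁ φ))) → Few c₆ (count F)
  from-EC {w} ec hc f = few-weaken (+-monoʳ-≤ c₂ hc) (few-∪ {P = Avoiding w} {Q = λ φ → F φ × ¬ Dj w (proj₁ φ)}
    (λ φ v → case decide (Dj w (proj₁ φ)) of λ { (inj₁ d) → inj₁ (v , d) ; (inj₂ d) → inj₂ (v , d) }) ec f)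

  pair-at : ∀ j → (Σ (X × X) λ v → (rk (proj₁ v) ≡ j) × (rk (proj₂ v) ≡ n + n) × Pair v) ⊎ NoPair j
  pair-at j with search (λ v → (rk (proj₁ v) ≡ j) × (rk (proj₂ v) ≡ n + n) × Pair v)
  ... | inj₁ x = inj₁ x
  ... | inj₂ h = inj₂ λ w y ew ey pr → h (w , y) (ew , ey , pr)

  -- A least essential cover of rank 1 is the point sought. If its rank is between 2 and n, the
  -- gains suffice to make `F` few, except that in rank n a pair at rank n′ may intervene and supply
  -- the hyperplane.
  small-K : ∀ K → suc K ≤ n → (∀ w → rk w < suc K → ¬ EC w) → ∀ w → rk w ≡ suc K → EC w → Conclusion
  small-K zero hK noEC w ew ec = inj₁ (w , ew , ec)
  small-K (suc K) hK noEC w ew ec = go (decide (2 + K ≡ n))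
    where
      open Minimal (2 + K) (≤-trans hK (n≤1+n n)) noEC
      finish : (2 + K ≡ n → NoPair n′) → Conclusion
      finish np = inj₂ (inj₂ (from-EC ec (*-monoʳ-≤ 2 (cst-mono k (≤-trans hK (m≤n+m n 2))))
        (start {c = cst (2 + K)} ew λ r er → climb (3 + K) (≤-trans (s≤s hK) (n≤1+n (suc n))) (n≤1+n (3 + K)) (base-c hK np)
          (λ R u m x ex nx e h → C₁′-bound (λ eK → ⊥-elim (1+n≰n (≤-trans (≤-reflexive (sym eK)) hK))) R m u x ex nx e
            (suc-injective (trans (sym (+-suc (rk u) (2 + R))) h)))
          K n′ r (cong (_+ n′) er) (cong (_+ (2 + K)) er))))
      go : (2 + K ≡ n) ⊎ ¬ (2 + K ≡ n) → Conclusion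
      go (inj₂ ne) = finish λ eK → ⊥-elim (ne eK)
      go (inj₁ eK) with pair-at n′
      ... | inj₂ np = finish λ _ → np
      ... | inj₁ ((v , h) , ev , eh , pr) = inj₂ (inj₁ (h , eh , from-pair pr (*-monoʳ-≤ 2 (cst-mono k (n≤1+n n′)))
            (start {c = cst n′} ev λ r er → C₀-bound n′ n′ r (cong (_+ n′) er)
              (≤-reflexive (trans (cong (_+ n′) er) (sym eK))) (≤-reflexive (cong (_+ n′) er)))))

  -- Pairs are tested at rank n′ before rank n, because `base-b`, which exploits a pair at rank n,
  -- relies on there being none at rank n′.
  full-K : (∀ w → rk w < suc n → ¬ EC w) → Conclusion
  full-K noEC with pair-at n′
  ... | inj₁ ((v , h) , ev , eh , pr) = inj₂ (inj₁ (h , eh , from-pair pr (*-monoʳ-≤ 2 (cst-mono k (n≤1+n n′)))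
        (start {c = cst n′} ev λ r er → C₀-bound n′ n′ r (cong (_+ n′) er)
          (≤-trans (≤-reflexive (cong (_+ n′) er)) (n≤1+n n)) (≤-reflexive (cong (_+ n′) er)))))
    where open Minimal (suc n) ≤-refl noEC
  ... | inj₂ np′ with pair-at n
  ... | inj₁ ((v , h) , ev , eh , pr) = inj₂ (inj₁ (h , eh , from-pair pr ≤-refl
        (start {c = cst n} ev λ r er → climb (suc n) (n≤1+n (suc n)) (m≤n+m (suc n) 2) (base-b refl np′)
          (λ R u m x ex nx e hh → C₁-bound (2 + R) m u x ex nx e (≤-reflexive (trans (sym (+-suc (rk u) (2 + R))) hh)))
          k n′ r (cong (_+ n′) er) (cong (_+ (2 + k)) er))))
    where open Minimal (suc n) ≤-refl noEC
  ... | inj₂ np = inj₂ (inj₂ (few-weaken (≤-trans (m≤n*m (cst (2 + n)) 2) (m≤n+m _ c₂)) (few-mono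
        (count-mono {Q = In₀ 𝟘} λ φ f → f , 𝟘-min)
        (few (climb (2 + n) ≤-refl (n≤1+n (2 + n)) (base-d refl np)
          (λ R u m x ex nx e hh → C₁′-bound (λ _ → np) R m u x ex nx e (suc-injective (trans (sym (+-suc (rk u) (2 + R))) hh)))
          n n 𝟘 (cong (_+ n) rk-𝟘) (cong (_+ (2 + n)) rk-𝟘))))))
    where open Minimal (suc n) ≤-refl noEC

  conclusion : Conclusion
  conclusion = go (suc n) 0 (+-identityʳ _) (λ w ())
    where
      go : ∀ g K → g + K ≡ suc n → (∀ w → rk w < K → ¬ EC w) → Conclusion
      go zero K e noEC = full-K (subst (λ t → ∀ w → rk w < t → ¬ EC w) e noEC)
      go (suc g) K e noEC with search (λ w → (rk w ≡ K) × EC w)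
      ... | inj₂ h = go g (suc K) (trans (+-suc g K) e) λ w lt ec → case m≤n⇒m<n∨m≡n (≤-pred lt) of λ
              { (inj₁ l) → noEC w l ec ; (inj₂ ew) → h w (ew , ec) }
      ... | inj₁ (w , ew , ec) = found K e noEC ew
        where
          found : ∀ K → suc g + K ≡ suc n → (∀ w → rk w < K → ¬ EC w) → rk w ≡ K → Conclusion
          -- All a's avoid a subspace of rank 0, so `EC` says directly that `F` is few.
          found zero e _ ew = inj₂ (inj₂ (few-weaken (m≤m+n c₂ _) (few-mono (count-mono {Q = Avoiding w}
            λ φ f → f , n≤0⇒n≡0 (≤-trans (rk-mono ⊓ˡ) (≤-reflexive ew))) ec)))
          found (suc K) e noEC ew = small-K K (≤-trans (m≤n+m (suc K) g) (≤-reflexive (suc-injective e))) noEC w ew ec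

-- Gaussian coefficients and the numerical comparisons.

module _ (p : ℕ) where
  private
    q = suc p

  q^∸1 : ∀ j → q ^ j ∸ 1 ≡ br q j * p
  q^∸1 j = trans (cong (_∸ 1) (sym (br-pred p j))) (m+n∸n≡m (br q j * p) 1)

  bfac : ℕ → ℕ
  bfac zero = 1
  bfac (suc j) = br q (suc j) * bfac j

  bfac-pos : ∀ j → 1 ≤ bfac j
  bfac-pos zero = ≤-refl
  bfac-pos (suc j) = *-mono-≤ (≤-trans (m^n>0 q j) (br-≥ q j)) (bfac-pos j)

  denominator : ∀ a → prodRange (λ i → q ^ i ∸ 1) a ≡ p ^ a * bfac a
  denominator zero = refl
  denominator (suc a) = trans (cong₂ _*_ (denominator a) (q^∸1 (suc a))) (l (p ^ a) (bfac a) (br q (suc a)) p)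
    where l : ∀ x y b p → x * y * (b * p) ≡ p * x * (b * y)
          l = solve-∀

  numerator : ∀ s a → prodRange (λ i → q ^ (s + i) ∸ 1) a * bfac s ≡ p ^ a * bfac (a + s)
  numerator s zero = refl
  numerator s (suc a) = begin
      prodRange f a * (q ^ (s + suc a) ∸ 1) * bfac s
        ≡⟨ cong (λ t → prodRange f a * t * bfac s) (trans (cong (λ e → q ^ e ∸ 1) (trans (+-suc s a) (cong suc (+-comm s a)))) (q^∸1 (suc (a + s)))) ⟩
      prodRange f a * (br q (suc (a + s)) * p) * bfac s
        ≡⟨ l (prodRange f a) (br q (suc (a + s))) p (bfac s) ⟩
      p * br q (suc (a + s)) * (prodRange f a * bfac s)
        ≡⟨ cong (p * br q (suc (a + s)) *_) (numerator s a) ⟩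
      p * br q (suc (a + s)) * (p ^ a * bfac (a + s))
        ≡⟨ l′ p (br q (suc (a + s))) (p ^ a) (bfac (a + s)) ⟩
      p * p ^ a * (br q (suc (a + s)) * bfac (a + s)) ∎
    where
      open ≡-Reasoning
      f = λ i → q ^ (s + i) ∸ 1
      l : ∀ a b p c → a * (b * p) * c ≡ p * b * (a * c)
      l = solve-∀
      l′ : ∀ p b x y → p * b * (x * y) ≡ p * x * (b * y)
      l′ = solve-∀

  divExact-* : ∀ x d → 1 ≤ d → divExact (x * d) d ≡ x
  divExact-* x (suc d) _ = Data.Nat.DivMod.m*n/n≡m x (suc d)

  prodRange-cong : ∀ {f g} a → (∀ i → f i ≡ g i) → prodRange f a ≡ prodRange g a
  prodRange-cong zero h = refl
  prodRange-cong (suc a) h = cong₂ _*_ (prodRange-cong a h) (h (suc a))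

  -- Numerator and denominator of the definition are p^a times quotients and products of
  -- q-factorials, so the factorial identity of the binomial coefficient determines the exact
  -- quotient.
  gauss-unique : 1 ≤ p → ∀ a s x → x * (bfac a * bfac s) ≡ bfac (a + s) → gauss q (a + s) a ≡ x
  gauss-unique 1≤p a s x h with a Data.Nat.≤? (a + s)
  ... | no n = ⊥-elim (n (m≤m+n a s))
  ... | yes _ = trans
      (cong₂ divExact (trans (prodRange-cong a (λ i → cong (λ t → q ^ (t + i) ∸ 1) (m+n∸m≡n a s))) num) (denominator a))
      (divExact-* x (p ^ a * bfac a) (*-mono-≤ (m^n>0 p {{>-nonZero 1≤p}} a) (bfac-pos a)))
    where
      l : ∀ x y b c → y * (x * (b * c)) ≡ x * (y * b) * c
      l = solve-∀
      num : prodRange (λ i → q ^ (s + i) ∸ 1) a ≡ x * (p ^ a * bfac a)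
      num = *-cancelʳ-≡ _ _ (bfac s) {{>-nonZero (bfac-pos s)}}
        (trans (numerator s a) (trans (cong (p ^ a *_) (sym h)) (l x (p ^ a) (bfac a) (bfac s))))

module _ {p d : ℕ} (G : Geom p d) where
  open GeomProps G

  fac≡bfac : ∀ k → fac k ≡ bfac p k
  fac≡bfac zero = refl
  fac≡bfac (suc k) = cong (br q (suc k) *_) (fac≡bfac k)

  lv-gauss : ∀ {x z} k s → x ⊑ z → rk x + (k + s) ≡ rk z → lv x z k ≡ gauss q (k + s) k
  lv-gauss {x} {z} k s h e = sym (gauss-unique p 1≤p k s _
    (trans (cong (lv x z k *_) (sym (cong₂ _*_ (fac≡bfac k) (fac≡bfac s)))) (trans (lv-fac k s h e) (fac≡bfac (k + s)))))

  lv-gauss-sym : ∀ {x z} k s → x ⊑ z → rk x + (k + s) ≡ rk z → lv x z k ≡ gauss q (s + k) s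
  lv-gauss-sym {x} {z} k s h e = sym (gauss-unique p 1≤p s k _
    (trans (cong (lv x z k *_) (trans (*-comm (bfac p s) (bfac p k)) (sym (cong₂ _*_ (fac≡bfac k) (fac≡bfac s)))))
      (trans (lv-fac k s h e) (trans (fac≡bfac (k + s)) (cong (bfac p) (+-comm k s))))))

gauss-1 : ∀ p → 1 ≤ p → ∀ s → gauss (suc p) (suc s) 1 ≡ br (suc p) (suc s)
gauss-1 p h s = gauss-unique p h 1 s (br (suc p) (suc s)) (cong (br (suc p) (suc s) *_) (l (bfac p s)))
  where l : ∀ x → 1 * 1 * x ≡ x
        l = solve-∀

bernoulli : ∀ p M → suc p ^ suc M ≤ p ^ suc M + suc M * suc p ^ M
bernoulli p zero = ≤-reflexive (l p)
  where l : ∀ p → suc p * 1 ≡ p * 1 + 1 * 1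
        l = solve-∀
bernoulli p (suc M) = begin
    suc p * suc p ^ suc M                                    ≡⟨⟩
    suc p ^ suc M + p * suc p ^ suc M                        ≤⟨ +-monoʳ-≤ (suc p ^ suc M) (*-monoʳ-≤ p (bernoulli p M)) ⟩
    suc p ^ suc M + p * (p ^ suc M + suc M * suc p ^ M)      ≡⟨ l (suc p ^ suc M) p (p ^ suc M) (suc M) (suc p ^ M) ⟩
    p * p ^ suc M + (suc p ^ suc M + suc M * (p * suc p ^ M)) ≤⟨ +-monoʳ-≤ (p * p ^ suc M) (+-monoʳ-≤ (suc p ^ suc M)
                                                               (*-monoʳ-≤ (suc M) (*-monoˡ-≤ (suc p ^ M) (n≤1+n p)))) ⟩
    p * p ^ suc M + (suc p ^ suc M + suc M * suc p ^ suc M) ∎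
  where
    open ≤-Reasoning
    l : ∀ a p b m c → a + p * (b + m * c) ≡ p * b + (a + m * (p * c))
    l = solve-∀

-- By `bernoulli`, q^M exceeds p^M by at most M q^(M-1), a third of q^M. The ratio 3/2 is the room
-- between the constant 2 of `hilton-milner` and the constant 3 in f(n,q).
power-ratio : ∀ p M → 3 * M ≤ suc p → 2 * suc p ^ M ≤ 3 * p ^ M
power-ratio p zero h = s≤s (s≤s z≤n)
power-ratio p (suc M) h = +-cancelʳ-≤ (suc p ^ suc M) _ _ (begin
    2 * Q + Q                                 ≡⟨ l Q ⟩
    3 * Q                                     ≤⟨ *-monoʳ-≤ 3 (bernoulli p M) ⟩
    3 * (p ^ suc M + suc M * suc p ^ M)       ≡⟨ l′ (p ^ suc M) (suc M) (suc p ^ M) ⟩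
    3 * p ^ suc M + 3 * suc M * suc p ^ M     ≤⟨ +-monoʳ-≤ (3 * p ^ suc M) (*-monoˡ-≤ (suc p ^ M) h) ⟩
    3 * p ^ suc M + Q                         ∎)
  where
    open ≤-Reasoning
    Q = suc p ^ suc M
    l : ∀ x → 2 * x + x ≡ 3 * x
    l = solve-∀
    l′ : ∀ a m b → 3 * (a + m * b) ≡ 3 * a + 3 * m * b
    l′ = solve-∀

-- n² + n - 2 for n = k + 2.
flag-expo : ℕ → ℕ
flag-expo k = k * k + 5 * k + 4

module _ {p d : ℕ} (G : Geom p d) where
  open GeomProps G

  private
    element : ∀ j → j ≤ d → Σ X λ z → (𝟘 ⊑ z) × (z ⊑ 𝟙) × (rk z ≡ j)
    element j h = sub-of-rank j (d ∸ j) 𝟘-min (≤-trans (≤-reflexive rk-𝟘) z≤n) (trans rk-𝟙 (sym (m+[n∸m]≡n h)))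

  gauss-≥ : ∀ k s → k + s ≤ d → p ^ k * q ^ (k * s) ≤ gauss q (k + s) k * q ^ k
  gauss-≥ k s h with element (k + s) h
  ... | z , _ , _ , e = ≤-trans (lv-≥ {𝟘} {z} k s 𝟘-min e′)
      (≤-reflexive (cong (_* q ^ k) (lv-gauss G {𝟘} {z} k s 𝟘-min e′)))
    where e′ = trans (cong (_+ (k + s)) rk-𝟘) (sym e)

  gauss-≥2 : ∀ k s → k + s ≤ d → q ^ (k * s) ≤ 2 ^ k * gauss q (k + s) k
  gauss-≥2 k s h = *-cancelˡ-≤ (p ^ k) {{m^n≢0 p k {{>-nonZero 1≤p}}}} (begin
      p ^ k * q ^ (k * s)                          ≤⟨ gauss-≥ k s h ⟩
      gauss q (k + s) k * q ^ k                    ≤⟨ *-monoʳ-≤ (gauss q (k + s) k) (q^≤2p^ k) ⟩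
      gauss q (k + s) k * (2 ^ k * p ^ k)          ≡⟨ l (gauss q (k + s) k) (2 ^ k) (p ^ k) ⟩
      p ^ k * (2 ^ k * gauss q (k + s) k)          ∎)
    where open ≤-Reasoning
          l : ∀ a b c → a * (b * c) ≡ c * (b * a)
          l = solve-∀

  gauss-≤2 : ∀ k s → k + s ≤ d → gauss q (k + s) k ≤ 2 ^ k * q ^ (k * s)
  gauss-≤2 k s h with element (k + s) h
  ... | z , _ , _ , e = ≤-trans (≤-reflexive (sym (lv-gauss G {𝟘} {z} k s 𝟘-min e′))) (lv-≤2 {𝟘} {z} k s 𝟘-min e′)
    where e′ = trans (cong (_+ (k + s)) rk-𝟘) (sym e)

  -- The asymptotic Hilton–Milner bound lies below 3 [n,1] [2n-2,n-2], where n = k + 2.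
  hm-below : ∀ k N → k + suc (suc k) ≤ d → 3 * (suc (suc k) + k) ≤ q →
    N * p ^ suc (suc k) ≤ 2 * q ^ (suc k * suc (suc k) + suc k) →
    N ≤ 3 * gauss q (suc (suc k)) 1 * gauss q (k + suc (suc k)) k
  hm-below k N hd hq h = *-cancelʳ-≤ N _ (p ^ n * q ^ k) {{m*n≢0 (p ^ n) (q ^ k) {{m^n≢0 p n {{>-nonZero 1≤p}}}} {{m^n≢0 q k}}}} (begin
      N * (p ^ n * q ^ k)                          ≡⟨ sym (*-assoc N (p ^ n) (q ^ k)) ⟩
      N * p ^ n * q ^ k                            ≤⟨ *-monoˡ-≤ (q ^ k) h ⟩
      2 * q ^ (suc k * n + suc k) * q ^ k          ≡⟨ trans (*-assoc 2 (q ^ (suc k * n + suc k)) (q ^ k)) (cong (2 *_) (trans (sym (^-distribˡ-+-* q (suc k * n + suc k) k))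
                                                        (trans (cong (q ^_) (e₁ k)) (^-distribˡ-+-* q (n + k) (suc k + k * n))))) ⟩
      2 * (q ^ (n + k) * q ^ (suc k + k * n))      ≡⟨ sym (*-assoc 2 (q ^ (n + k)) _) ⟩
      2 * q ^ (n + k) * q ^ (suc k + k * n)        ≤⟨ *-monoˡ-≤ (q ^ (suc k + k * n)) (power-ratio p (n + k) hq) ⟩
      3 * p ^ (n + k) * q ^ (suc k + k * n)        ≡⟨ cong₂ (λ x y → 3 * x * y) (^-distribˡ-+-* p n k) (^-distribˡ-+-* q (suc k) (k * n)) ⟩
      3 * (p ^ n * p ^ k) * (q ^ suc k * q ^ (k * n)) ≡⟨ l (p ^ n) (p ^ k) (q ^ suc k) (q ^ (k * n)) ⟩
      3 * q ^ suc k * (p ^ k * q ^ (k * n)) * p ^ n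
        ≤⟨ *-monoˡ-≤ (p ^ n) (*-mono-≤ (*-monoʳ-≤ 3 (≤-trans (br-≥ q (suc k)) (≤-reflexive (sym (gauss-1 p 1≤p (suc k)))))) (gauss-≥ k n hd)) ⟩
      3 * gauss q n 1 * (gauss q (k + n) k * q ^ k) * p ^ n ≡⟨ l′ (gauss q n 1) (gauss q (k + n) k) (q ^ k) (p ^ n) ⟩
      3 * gauss q n 1 * gauss q (k + n) k * (p ^ n * q ^ k) ∎)
    where
      open ≤-Reasoning
      n = suc (suc k)
      l : ∀ a b c d → 3 * (a * b) * (c * d) ≡ 3 * c * (b * d) * a
      l = solve-∀
      l′ : ∀ a b c d → 3 * a * (b * c) * d ≡ 3 * a * b * (d * c)
      l′ = solve-∀
      e₁ : ∀ k → suc k * suc (suc k) + suc k + k ≡ suc (suc k) + k + (suc k + k * suc (suc k))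
      e₁ = solve-∀

  private
    fnq-bound : ∀ k → 1 ≤ k → k + suc (suc k) ≤ d → fnq (suc (suc k)) q * q ≤ 6 * 2 ^ k * q ^ (suc k * suc (suc k))
    fnq-bound (suc zero) _ _ = begin
        (q ^ 5 + 2 * q ^ 4 + 3 * q ^ 3 + 2 * q ^ 2 + q + 1) * q
          ≤⟨ *-monoˡ-≤ q (+-mono-≤ (+-mono-≤ (+-mono-≤ (+-mono-≤ (+-mono-≤ (le 5 ≤-refl) (*-monoʳ-≤ 2 (le 4 (n≤1+n 4))))
               (*-monoʳ-≤ 3 (le 3 (m≤n+m 3 2)))) (*-monoʳ-≤ 2 (le 2 (m≤n+m 2 3))))
               (≤-trans (≤-reflexive (sym (*-identityʳ q))) (le 1 (m≤n+m 1 4)))) (le 0 z≤n)) ⟩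
        (Q + 2 * Q + 3 * Q + 2 * Q + Q + Q) * q   ≡⟨ l Q q ⟩
        10 * (q * Q)                              ≤⟨ *-monoˡ-≤ (q * Q) (m≤m+n 10 2) ⟩
        12 * (q * Q) ∎
      where
        open ≤-Reasoning
        Q = q ^ 5
        le : ∀ i → i ≤ 5 → q ^ i ≤ Q
        le i h = ^-monoʳ-≤ q h
        l : ∀ x q → (x + 2 * x + 3 * x + 2 * x + x + x) * q ≡ 10 * (q * x)
        l = solve-∀
    fnq-bound k@(suc (suc j)) _ hd = begin
        3 * gauss q n 1 * gauss q (2 * n ∸ 2) k * q
          ≡⟨ cong₂ (λ x t → 3 * x * gauss q t k * q) (gauss-1 p 1≤p (suc k)) (sym (l₁ j)) ⟩
        3 * br q n * gauss q (k + n) k * q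
          ≤⟨ *-monoˡ-≤ q (*-mono-≤ (*-monoʳ-≤ 3 (br-≤2 (suc k))) (gauss-≤2 k n hd)) ⟩
        3 * (2 * q ^ suc k) * (2 ^ k * q ^ (k * n)) * q
          ≡⟨ l₂ (q ^ suc k) (2 ^ k) (q ^ (k * n)) q ⟩
        6 * 2 ^ k * (q * q ^ suc k * q ^ (k * n))
          ≡⟨ cong (6 * 2 ^ k *_) (sym (^-distribˡ-+-* q n (k * n))) ⟩
        6 * 2 ^ k * q ^ (suc k * n) ∎
      where
        open ≤-Reasoning
        n = suc (suc k)
        l₁ : ∀ j → suc (suc j) + suc (suc (suc (suc j))) ≡ suc (suc j) + suc (suc (suc (suc (j + 0))))
        l₁ = solve-∀
        l₂ : ∀ a b c q → 3 * (2 * a) * (b * c) * q ≡ 6 * b * (q * a * c)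
        l₂ = solve-∀

  -- f(n,q) is of order q^(n²-n-1), one power below the coefficient in the size of (a). This keeps
  -- (a) and (b) apart.
  fnq<gauss : ∀ k → 1 ≤ k → suc k + suc (suc k) ≤ d → 6 * 2 ^ k * 2 ^ suc k < q →
    fnq (suc (suc k)) q < gauss q (suc k + suc (suc k)) (suc k)
  fnq<gauss k hk hd hq = *-cancelʳ-< q _ _ (begin-strict
      fnq n q * q                                ≤⟨ fnq-bound k hk (≤-trans (n≤1+n _) hd) ⟩
      6 * 2 ^ k * q ^ (suc k * n)                ≤⟨ *-monoʳ-≤ (6 * 2 ^ k) (gauss-≥2 (suc k) n hd) ⟩
      6 * 2 ^ k * (2 ^ suc k * g)                ≡⟨ sym (*-assoc (6 * 2 ^ k) (2 ^ suc k) g) ⟩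
      6 * 2 ^ k * 2 ^ suc k * g                  <⟨ *-monoˡ-< g {{>-nonZero pos}} hq ⟩
      q * g                                      ≡⟨ *-comm q g ⟩
      g * q                                      ∎)
    where
      open ≤-Reasoning
      n = suc (suc k)
      g = gauss q (suc k + n) (suc k)
      pos : 1 ≤ g
      pos = n≢0⇒n>0 λ e → 1+n≰n (≤-trans (m^n>0 q (suc k * n)) (≤-trans (gauss-≥2 (suc k) n hd)
        (≤-reflexive (trans (cong (2 ^ suc k *_) e) (*-zeroʳ (2 ^ suc k))))))

  -- The flags with a given point in `a` are of order q^(n²+n-1), one power above the bound in (c).
  -- This keeps (c) apart from (a) and (b).
  pencil-large : ∀ k C → suc k + suc (suc (suc k)) ≤ d → 2 ^ suc k * C < q →
    C * q ^ flag-expo k < gauss q (suc k + suc (suc (suc k))) (suc k) * br q (suc (suc (suc k)))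
  pencil-large k C hd hq = *-cancelˡ-< (2 ^ suc k) _ _ (begin-strict
      2 ^ suc k * (C * q ^ flag-expo k)                       ≡⟨ sym (*-assoc (2 ^ suc k) C (q ^ flag-expo k)) ⟩
      2 ^ suc k * C * q ^ flag-expo k                         <⟨ *-monoˡ-< (q ^ flag-expo k) {{m^n≢0 q (flag-expo k)}} hq ⟩
      q * q ^ flag-expo k                                     ≡⟨ trans (cong (q ^_) (l k)) (^-distribˡ-+-* q (suc k * suc n) n) ⟩
      q ^ (suc k * suc n) * q ^ n                        ≤⟨ *-mono-≤ (gauss-≥2 (suc k) (suc n) hd) (br-≥ q n) ⟩
      2 ^ suc k * gauss q (suc k + suc n) (suc k) * br q (suc n) ≡⟨ *-assoc (2 ^ suc k) _ _ ⟩
      2 ^ suc k * (gauss q (suc k + suc n) (suc k) * br q (suc n)) ∎)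
    where
      open ≤-Reasoning
      n = suc (suc k)
      l : ∀ k → suc (k * k + 5 * k + 4) ≡ suc k * suc (suc (suc k)) + suc (suc k)
      l = solve-∀

-- Maximal families almost all of whose members pass through one point.

nontrivial-bound : ∀ {p} k (U : Geom p (suc (suc k) + suc (suc k))) (S : Geom.X U → Set) {{S? : ∀ {y} → Dec (S y)}} →
  (∀ {y} → S y → Geom.rk U y ≡ suc (suc k)) → (∀ {y z} → S y → S z → ¬ GeomProps.Dj U y z) →
  (∀ y → Geom.rk U y ≡ 1 → Σ (Geom.X U) λ s → S s × ¬ Geom._⊑_ U y s) →
  (∀ y → Geom.rk U y ≡ suc (suc k) + suc k → Σ (Geom.X U) λ s → S s × ¬ Geom._⊑_ U s y) →
  1 ≤ k → 72 ≤ suc p → 3 * (suc (suc k) + k) ≤ suc p → count {{Geom.finite U}} S ≤ fnq (suc (suc k)) (suc p)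
nontrivial-bound {p} (suc zero) U S S-rk S-int no-point no-hyper _ q≥ _
  with NontrivialPlanes.planes-bound U S S-rk S-int no-point no-hyper
... | inj₁ h = h
-- As q ≥ 72, the bound 72 q^4 is below the leading term q^5 of `hm`.
... | inj₂ h = ≤-trans h (≤-trans (*-monoˡ-≤ (suc p * suc p * suc p * suc p) q≥) (≤-trans (≤-reflexive (l (suc p)))
      (≤-trans (m≤m+n (suc p ^ 5) _) (≤-reflexive (l′ (suc p ^ 5) (2 * suc p ^ 4) (3 * suc p ^ 3) (2 * suc p ^ 2) (suc p) 1)))))
  where l : ∀ q → q * (q * q * q * q) ≡ q * (q * (q * (q * (q * 1))))
        l = solve-∀
        l′ : ∀ a b c d e f → a + (b + c + d + e + f) ≡ a + b + c + d + e + f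
        l′ = solve-∀
nontrivial-bound {p} (suc (suc j)) U S S-rk S-int no-point no-hyper _ _ q≥ = ≤-trans
    (hm-below U k (count S) (+-monoˡ-≤ n (m≤n+m k 2)) q≥ (hilton-milner
      (let (a , ea , _) = atom-below 𝟙 (≤-trans (s≤s z≤n) (≤-reflexive (sym rk-𝟙))) ; (s , fs , _) = no-point a ea in s , fs)
      (λ a ea → let (s , fs , h) = no-point a ea in s , fs , Dj-sym (atom-Dj ea h))
      no-hyper))
    (≤-reflexive (cong (λ t → 3 * gauss q n 1 * gauss q t k) (l j)))
  where
    k = suc (suc j)
    n = suc (suc k)
    open GeomProps U
    open Intersecting U S S-rk S-int
    open HiltonMilner
    l : ∀ j → suc (suc j) + suc (suc (suc (suc j))) ≡ suc (suc j) + suc (suc (suc (suc (j + 0))))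
    l = solve-∀

module MaximalFamily {p k : ℕ} (G : Geom p (suc (suc (suc k) + suc (suc k))))
  (F : Geom.X G × Geom.X G → Set) {{F? : ∀ {φ} → Dec (F φ)}}
  (F-A : ∀ {φ} → F φ → Geom.rk G (proj₁ φ) ≡ suc (suc k))
  (F-B : ∀ {φ} → F φ → Geom.rk G (proj₂ φ) ≡ suc (suc (suc k)))
  (F-⊑ : ∀ {φ} → F φ → Geom._⊑_ G (proj₁ φ) (proj₂ φ))
  (F-int : ∀ {φ ψ} → F φ → F ψ → GeomProps.Dj G (proj₁ φ) (proj₂ ψ) → GeomProps.Dj G (proj₁ ψ) (proj₂ φ) → Empty)
  where

  open FlagFamily G F F-A F-B F-⊑ F-int
  open FlagBranch G F F-A F-B F-⊑ F-int
  open GeomProps G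

  IsFlag : X × X → Set
  IsFlag (a , b) = (rk a ≡ n) × (rk b ≡ suc n) × (a ⊑ b)

  F-flag : ∀ {φ} → F φ → IsFlag φ
  F-flag f = F-A f , F-B f , F-⊑ f

  T₀ G₀ f₀ : ℕ
  T₀ = gauss q (n′ + suc n) n′ * br q (suc n)
  G₀ = gauss q (n′ + n) n′
  f₀ = fnq n q

  -- If x is outside some `b`, it is outside that `a` too, so the member misses the state x. Then
  -- the flags with x in `a` gain a factor q and become few, and with them all of `F`.
  all-through : ∀ {x c} → rk x ≡ 1 → Few c (count (Avoiding x)) → ¬ Few (c + 4 * κ) (count F) → ∀ {φ} → F φ → x ⊑ proj₂ φ
  all-through {x} ex ec big {a , b} f = stable λ nx → big (few-∪ {P = Avoiding x} {Q = In₀ x}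
      (λ { (a , b) g → case decide (x ⊑ a) of λ { (inj₁ h) → inj₂ (g , h) ; (inj₂ h) → inj₁ (g , Dj-sym (atom-Dj ex h)) } })
      ec (few (bound (_ , f , Dj-sym (atom-Dj ex nx) , Dj-sym (atom-Dj ex (λ h → nx (⊑-trans h (F-⊑ f))))))))
    where
      open ≤-Reasoning
      l : ∀ a q b → a * (q * (q * b)) ≡ a * (q * 1) * (q * b)
      l = solve-∀
      bound : NC x x → N₀ x * q ^ (2 + n) ≤ 4 * κ * q ^ (n * suc n + n)
      bound nc = begin
        N₀ x * (q * (q * q ^ n))             ≡⟨ l (N₀ x) q (q ^ n) ⟩
        N₀ x * q ^ 1 * q ^ suc n             ≤⟨ *-monoˡ-≤ (q ^ suc n) (fresh₀ n′ (cong (_+ n′) ex) nc) ⟩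
        4 * κ * q ^ (n′ * suc n + n) * q ^ suc n ≡⟨ *-assoc (4 * κ) _ _ ⟩
        4 * κ * (q ^ (n′ * suc n + n) * q ^ suc n) ≡⟨ cong (4 * κ *_) (trans (*-comm _ (q ^ suc n)) (e₀ n′)) ⟩
        4 * κ * q ^ (n * suc n + n) ∎

  Pencil : X → X × X → Set
  Pencil x φ = IsFlag φ × (x ⊑ proj₁ φ)

  count-Pencil : ∀ {x} → rk x ≡ 1 → count (Pencil x) ≡ T₀
  count-Pencil {x} ex = trans (sym (*-identityʳ _)) (trans
      (sym (double-count {P = Lv x 𝟙 n′} {Q = Pencil x} {R = λ a φ → Pencil x φ × (proj₁ φ ≡ a)} (br q (suc n)) 1
        (λ { a (.a , b) (((ea , eb , ab) , xa) , refl) → (xa , 𝟙-max , trans ea (cong (_+ n′) (sym ex))) , (ea , eb , ab) , xa })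
        above (λ { (a , b) w → trans (count-cong {Q = λ a′ → a′ ≡ a} (λ _ v → sym (proj₂ v)) (λ { _ refl → w , refl })) (count-≡ a) })))
      (cong (_* br q (suc n)) (lv-gauss G n′ (suc n) 𝟙-max (trans (cong (_+ (n′ + suc n)) ex) (trans (+-suc n n) (sym rk-𝟙))))))
    where
      above : ∀ a → Lv x 𝟙 n′ a → count (λ φ → Pencil x φ × (proj₁ φ ≡ a)) ≡ br q (suc n)
      above a (xa , _ , ea) = trans
        (count-bij {Q = λ b → (a ⊑ b) × (b ⊑ 𝟙) × (rk b ≡ suc (rk a))} proj₂ (a ,_)
          (λ { (_ , b) (((ea , eb , ab) , _) , refl) → ab , 𝟙-max , trans eb (cong suc (sym ea)) })
          (λ b w → ((ea′ , trans (proj₂ (proj₂ w)) (cong suc ea′) , proj₁ w) , xa) , refl)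
          (λ { (_ , b) (_ , refl) → refl }) (λ b _ → refl))
        (ups (suc n) 𝟙-max (trans (cong (_+ suc n) ea′) (trans (+-suc n n) (sym rk-𝟙))))
        where ea′ = trans ea (cong (_+ n′) ex)

  T₀≤ : ∀ {x} → rk x ≡ 1 → (∀ φ → Pencil x φ → F φ) → T₀ ≤ count F
  T₀≤ ex h = ≤-trans (≤-reflexive (sym (count-Pencil ex))) (count-mono h)

  module Through (F-max : ∀ φ → IsFlag φ → (∀ ψ → F ψ → Dj (proj₁ φ) (proj₂ ψ) → Dj (proj₁ ψ) (proj₂ φ) → Empty) → F φ)
                 (x : X) (ex : rk x ≡ 1) (thr : ∀ {φ} → F φ → x ⊑ proj₂ φ) where

    open Quotient x ex

    pencil : ∀ φ → Pencil x φ → F φ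
    pencil (a , b) (fl , xa) = F-max (a , b) fl λ { (a′ , b′) f dj _ → meet-¬Dj (≤-reflexive (sym ex)) xa (thr f) dj }

    hyperplane-meets : ∀ {a b y b′} → IsFlag (a , b) → y ⊑ b → y ⊑ b′ → 2 ≤ rk y → ¬ Dj a b′
    hyperplane-meets {a} {b} {y} (ea , eb , ab) yb yb′ h dj = 1+n≰n (begin
        2 + n                   ≡⟨ +-comm 2 n ⟩
        n + 2                   ≤⟨ +-monoʳ-≤ n h ⟩
        n + rk y                ≡⟨ cong (_+ rk y) (sym ea) ⟩
        rk a + rk y             ≤⟨ rk-⊓-≥ ab yb ⟩
        rk b + rk (a ⊓ y)       ≡⟨ cong₂ _+_ eb (Dj-mono ⊑-refl yb′ dj) ⟩
        suc n + 0               ≡⟨ +-identityʳ (suc n) ⟩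
        suc n                   ∎)
      where open ≤-Reasoning

    extend : ∀ {a b} → IsFlag (a , b) → x ⊑ b → (∀ {a₁ b₁} → F (a₁ , b₁) → ¬ (x ⊑ a₁) → 2 ≤ rk (b ⊓ b₁)) → F (a , b)
    extend {a} {b} fl xb h = F-max (a , b) fl λ { (a₁ , b₁) f₁ dj dj₁ → case decide (x ⊑ a₁) of λ
      { (inj₁ xa) → meet-¬Dj (≤-reflexive (sym ex)) xa xb dj₁
      ; (inj₂ na) → hyperplane-meets fl ⊓ˡ ⊓ʳ (h f₁ na) dj } }

    -- By `S-int` any two b's of this kind share more than x, hence a subspace of rank at least 2,
    -- which every hyperplane `a` of `b` meets. So maximality lets membership off x depend on `b`
    -- alone.
    saturated : ∀ {a y} → S y → IsFlag (a , proj₁ y) → F (a , proj₁ y)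
    saturated {a} {b , xb} s fl = extend fl xb λ {a₁} {b₁} f₁ na → meet s f₁ na
      where
        meet : ∀ {a₁ b₁} → S (b , xb) → F (a₁ , b₁) → ¬ (x ⊑ a₁) → 2 ≤ rk (b ⊓ b₁)
        meet {a₁} {b₁} s f₁ na = ≰⇒> λ le → S-int s (inS {y = b₁ , thr f₁} a₁ f₁ na) (m≤n⇒m∸n≡0 (≤-trans le (≤-reflexive (sym ex))))

    count-off : ∀ {b} → x ⊑ b → rk b ≡ suc n → count (λ a → ((𝟘 ⊑ a) × (a ⊑ b) × (suc (rk a) ≡ rk b)) × ¬ (x ⊑ a)) ≡ q ^ n
    count-off {b} xb eb = +-cancelʳ-≡ (br q n) _ _ (trans
      (cong (count (λ a → ((𝟘 ⊑ a) × (a ⊑ b) × (suc (rk a) ≡ rk b)) × ¬ (x ⊑ a)) +_)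
        (sym (dns n xb (trans (cong (_+ n) ex) (sym eb)))))
      (trans (sym (count-⊎ {R = λ a → (𝟘 ⊑ a) × (a ⊑ b) × (suc (rk a) ≡ rk b)}
          (λ a w → case decide (x ⊑ a) of λ { (inj₁ h) → inj₂ (h , proj₂ w) ; (inj₂ h) → inj₁ (w , h) })
          (λ a w → proj₁ w) (λ a w → 𝟘-min , proj₂ w) (λ a w v → proj₂ w (proj₁ v))))
        (trans (dns (suc n) 𝟘-min (trans (cong (_+ suc n) rk-𝟘) (sym eb))) (+-comm (br q n) (q ^ n)))))

    off-flag : ∀ {b} → x ⊑ b → rk b ≡ suc n → Σ X λ a → IsFlag (a , b) × ¬ (x ⊑ a)
    off-flag {b} xb eb with count-find (≤-trans (m^n>0 q n) (≤-reflexive (sym (count-off xb eb))))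
    ... | a , (_ , ab , ea) , na = a , (suc-injective (trans ea eb) , eb , ab) , na

    -- The whole pencil at x, and for every b in `S` its q^n hyperplanes off x. What remains is the
    -- size of an intersecting family in the quotient by x.
    count-split : count F ≡ T₀ + count S * q ^ n
    count-split = trans (count-⊎ {P = Pencil x} {Q = λ φ → F φ × ¬ (x ⊑ proj₁ φ)}
        (λ { (a , b) f → case decide (x ⊑ a) of λ { (inj₁ h) → inj₁ (F-flag f , h) ; (inj₂ h) → inj₂ (f , h) } })
        pencil (λ φ w → proj₁ w) (λ φ w v → proj₂ v (proj₂ w)))
      (cong₂ _+_ (count-Pencil ex) (trans (sym (*-identityʳ _)) (sym
        (double-count {P = S} {Q = λ φ → F φ × ¬ (x ⊑ proj₁ φ)} {R = λ y φ → (F φ × ¬ (x ⊑ proj₁ φ)) × (proj₂ φ ≡ proj₁ y)} (q ^ n) 1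
          (λ { (b , xb) (a , .b) ((f , na) , refl) → inS a f na , f , na }) per-b per-φ))))
      where
        per-b : ∀ y → S y → count (λ φ → (F φ × ¬ (x ⊑ proj₁ φ)) × (proj₂ φ ≡ proj₁ y)) ≡ q ^ n
        per-b (b , xb) s@(inS a₀ f₀ _) = trans
          (count-bij {Q = λ a → ((𝟘 ⊑ a) × (a ⊑ b) × (suc (rk a) ≡ rk b)) × ¬ (x ⊑ a)} proj₁ (_, b)
            (λ { (a , _) ((f , na) , refl) → (𝟘-min , F-⊑ f , trans (cong suc (F-A f)) (sym (F-B f))) , na })
            (λ { a ((_ , ab , ea) , na) → (saturated s (suc-injective (trans ea (F-B f₀)) , F-B f₀ , ab) , na) , refl })
            (λ { (a , _) (_ , refl) → refl }) (λ a _ → refl))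
          (count-off xb (F-B f₀))
        per-φ : ∀ φ → F φ × ¬ (x ⊑ proj₁ φ) → count (λ y → (F φ × ¬ (x ⊑ proj₁ φ)) × (proj₂ φ ≡ proj₁ y)) ≡ 1
        per-φ (a , b) (f , na) = trans
          (count-cong {Q = λ y → y ≡ (b , thr f)} {{Q? = λ {y} → y ≟ _}}
            (λ { (_ , xb) (_ , refl) → cong (b ,_) (⊑-irr xb (thr f)) })
            (λ { y refl → (f , na) , refl }))
          (count-≡ {{finite-U}} (b , thr f))

    record Structure : Set where
      field
        size : count F ≡ T₀ + G₀ * q ^ n
        shape : (Σ X λ L → (rk L ≡ 2) × (x ⊑ L) × (∀ φ → IsFlag φ →
                  (F φ → (x ⊑ proj₁ φ) ⊎ (L ⊑ proj₂ φ)) × ((x ⊑ proj₁ φ) ⊎ (L ⊑ proj₂ φ) → F φ)))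
              ⊎ (Σ X λ H → (rk H ≡ n + n) × (x ⊑ H) × (∀ φ → IsFlag φ →
                  (F φ → (x ⊑ proj₁ φ) ⊎ ((x ⊑ proj₂ φ) × (proj₂ φ ⊑ H))) ×
                  ((x ⊑ proj₁ φ) ⊎ ((x ⊑ proj₂ φ) × (proj₂ φ ⊑ H)) → F φ)))

    private
      sizeS : ∀ {N} → count S ≡ N → N ≡ G₀ → count F ≡ T₀ + G₀ * q ^ n
      sizeS e e′ = trans count-split (cong (λ t → T₀ + t * q ^ n) (trans e e′))

    -- Any two b's through L share its rank 2, so maximality puts all of them into `S`.
    on-line : ∀ L → rk L ≡ 2 → x ⊑ L → (∀ y → S y → L ⊑ proj₁ y) → Structure
    on-line L eL xL h = record
      { size = sizeS (count-Σ finite (x ⊑_) (λ y → ⊑-dec) ⊑-irr {Q = Lv L 𝟙 n′}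
            (λ { b xb s@(inS a f na) → h (b , xb) s , 𝟙-max , trans (F-B f) (cong (_+ n′) (sym eL)) })
            (λ b w → let (Lb , _ , eb) = w
                         xb = ⊑-trans xL Lb
                         (a , fl , na) = off-flag xb (trans eb (cong (_+ n′) eL)) in
              xb , inS a (into (a , b) fl (inj₂ Lb)) na))
          (lv-gauss G n′ n 𝟙-max (trans (cong (_+ (n′ + n)) eL) (sym rk-𝟙)))
      ; shape = inj₁ (L , eL , xL , λ φ fl → (λ f → case decide (x ⊑ proj₁ φ) of λ
            { (inj₁ k) → inj₁ k ; (inj₂ k) → inj₂ (h (proj₂ φ , thr f) (inS (proj₁ φ) f k)) }) , into φ fl) }
      where
        into : ∀ φ → IsFlag φ → (x ⊑ proj₁ φ) ⊎ (L ⊑ proj₂ φ) → F φ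
        into φ fl (inj₁ k) = pencil φ (fl , k)
        into φ fl (inj₂ k) = extend fl (⊑-trans xL k) λ {a₁} {b₁} f₁ na →
          ≤-trans (≤-reflexive (sym eL)) (rk-mono (⊓-glb k (h (b₁ , thr f₁) (inS a₁ f₁ na))))

    -- Two subspaces of rank n + 1 inside H, of rank 2n, meet in rank at least 2, so again
    -- maximality completes `S`.
    in-hyperplane : ∀ H → rk H ≡ n + n → x ⊑ H → (∀ y → S y → proj₁ y ⊑ H) → Structure
    in-hyperplane H eH xH h = record
      { size = sizeS (count-Σ finite (x ⊑_) (λ y → ⊑-dec) ⊑-irr {Q = Lv x H n}
            (λ { b xb s@(inS a f na) → xb , h (b , xb) s , trans (F-B f) (cong (_+ n) (sym ex)) })
            (λ b w → let (xb , bH , eb) = w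
                         (a , fl , na) = off-flag xb (trans eb (cong (_+ n) ex)) in
              xb , inS a (into (a , b) fl (inj₂ (xb , bH))) na))
          (lv-gauss-sym G n n′ xH (trans (cong (_+ (n + n′)) ex) (trans (sym (+-suc n n′)) (sym eH))))
      ; shape = inj₂ (H , eH , xH , λ φ fl → (λ f → case decide (x ⊑ proj₁ φ) of λ
            { (inj₁ k) → inj₁ k ; (inj₂ k) → inj₂ (thr f , h (proj₂ φ , thr f) (inS (proj₁ φ) f k)) }) , into φ fl) }
      where
        into : ∀ φ → IsFlag φ → (x ⊑ proj₁ φ) ⊎ ((x ⊑ proj₂ φ) × (proj₂ φ ⊑ H)) → F φ
        into φ fl (inj₁ k) = pencil φ (fl , k)
        into φ fl (inj₂ (xb , bH)) = extend fl xb λ {a₁} {b₁} f₁ na →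
          +-cancelˡ-≤ (n + n) _ _ (≤-trans (≤-reflexive (trans (l n) (cong₂ _+_ (sym (proj₁ (proj₂ fl))) (sym (F-B f₁)))))
            (≤-trans (rk-⊓-≥ bH (h (b₁ , thr f₁) (inS a₁ f₁ na))) (≤-reflexive (cong (_+ rk (proj₂ φ ⊓ b₁)) eH))))
          where l : ∀ n → n + n + 2 ≡ suc n + suc n
                l = solve-∀

    Nontrivial : Set
    Nontrivial = (∀ y → Geom.rk U y ≡ 1 → Σ (Geom.X U) λ s → S s × ¬ (proj₁ y ⊑ proj₁ s)) ×
                 (∀ y → Geom.rk U y ≡ n + n′ → Σ (Geom.X U) λ s → S s × ¬ (proj₁ s ⊑ proj₁ y))

    private
      unshift : ∀ {y r} → x ⊑ y → rk y ∸ rk x ≡ r → rk y ≡ suc r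
      unshift {y} {r} h e = trans (sym (m+[n∸m]≡n (rk-mono h))) (cong₂ _+_ ex e)

    trichotomy : Structure ⊎ Nontrivial
    trichotomy with search (λ y → (Geom.rk U y ≡ 1) × ¬ (Σ (Geom.X U) λ s → S s × ¬ (proj₁ y ⊑ proj₁ s))) {{dec-× {{dec-ℕ≡}} {{dec-¬ {{dec-∃}}}}}}
                  | search (λ y → (Geom.rk U y ≡ n + n′) × ¬ (Σ (Geom.X U) λ s → S s × ¬ (proj₁ s ⊑ proj₁ y))) {{dec-× {{dec-ℕ≡}} {{dec-¬ {{dec-∃}}}}}}
    ... | inj₁ ((L , xL) , eL , h) | _ = inj₁ (on-line L (unshift xL eL) xL λ y s → stable λ k → h (y , s , k))
    ... | inj₂ _ | inj₁ ((H , xH) , eH , h) = inj₁ (in-hyperplane H (trans (unshift xH eH) (sym (+-suc n n′))) xH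
            λ y s → stable λ k → h (y , s , k))
    ... | inj₂ h | inj₂ h′ = inj₂ ((λ y e → stable {{dec-∃}} λ k → h y (e , k)) , (λ y e → stable {{dec-∃}} λ k → h′ y (e , k)))

    nontrivial-size : 1 ≤ k → 72 ≤ q → 3 * (n + k) ≤ q → Nontrivial → count F ≤ T₀ + f₀ * q ^ n
    nontrivial-size hk h h′ (np , nh) = ≤-trans (≤-reflexive count-split) (+-monoʳ-≤ T₀ (*-monoˡ-≤ (q ^ n)
      (nontrivial-bound k U S (λ {y} → S-rk {y}) (λ {y} {z} → S-int {y} {z}) np nh hk h h′)))

-- Lower cover numbers, and the lattice of subspaces of the vector space.

dec-→ : {A B : Set} → Dec A → Dec B → Dec (A → B)
dec-→ (no ¬a) _ = yes λ a → ⊥-elim (¬a a)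
dec-→ (yes a) (yes b) = yes λ _ → b
dec-→ (yes a) (no ¬b) = no λ f → ¬b (f a)

count-× : {Y Z : Set} {{_ : Finite Y}} {{_ : Finite Z}} {A : Y → Set} {B : Z → Set}
  {{A? : ∀ {y} → Dec (A y)}} {{B? : ∀ {z} → Dec (B z)}} →
  count (λ (w : Y × Z) → A (proj₁ w) × B (proj₂ w)) ≡ count A * count B
count-× {Y} {Z} {A} {B} = trans (sym (*-identityʳ _)) (sym (double-count {P = A}
    {Q = λ (w : Y × Z) → A (proj₁ w) × B (proj₂ w)} {R = λ y w → (A (proj₁ w) × B (proj₂ w)) × (proj₁ w ≡ y)}
    {{λ {y} {w} → dec-× {{dec-×}} {{proj₁ w ≟ y}}}} (count B) 1
    (λ { y w ((a , b) , refl) → a , a , b })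
    (λ y a → count-bij {P = λ w → (A (proj₁ w) × B (proj₂ w)) × (proj₁ w ≡ y)} {{λ {w} → dec-× {{dec-×}} {{proj₁ w ≟ y}}}} {Q = B} proj₂ (y ,_)
      (λ { w ((_ , b) , _) → b }) (λ z b → (a , b) , refl) (λ { w (_ , refl) → refl }) (λ z _ → refl))
    (λ w ab → trans (count-cong {P = λ y → (A (proj₁ w) × B (proj₂ w)) × (proj₁ w ≡ y)} {Q = λ y → y ≡ proj₁ w}
        {{λ {y} → dec-× {{dec-×}} {{proj₁ w ≟ y}}}} {{λ {y} → y ≟ proj₁ w}}
        (λ { y (_ , e) → sym e }) (λ { y refl → ab , refl })) (count-≡ (proj₁ w)))))

module _ {X : Set} {{_ : Finite X}} (q′ : ℕ) (_⊑_ : X → X → Set) {{⊑? : ∀ {x y} → Dec (x ⊑ y)}}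
  (⊑-refl : ∀ {x} → x ⊑ x) (⊑-trans : ∀ {x y z} → x ⊑ y → y ⊑ z → x ⊑ z)
  (⊑-antisym : ∀ {x y} → x ⊑ y → y ⊑ x → x ≡ y)
  (rk : X → ℕ) (rk-eq : ∀ {x y} → x ⊑ y → rk y ≤ rk x → y ⊑ x)
  (ups : ∀ {x z} r → x ⊑ z → rk x + r ≡ rk z →
    count (λ y → (x ⊑ y) × (y ⊑ z) × (rk y ≡ suc (rk x))) ≡ br q′ r) where

  private
    Lv′ : X → X → ℕ → X → Set
    Lv′ x z k y = (x ⊑ y) × (y ⊑ z) × (rk y ≡ rk x + k)

    bf : ℕ → ℕ
    bf zero = 1
    bf (suc k) = br q′ (suc k) * bf k

    Down : ℕ → Set
    Down r = ∀ {x z} → x ⊑ z → rk x + r ≡ rk z →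
      count (λ y → (x ⊑ y) × (y ⊑ z) × (suc (rk y) ≡ rk z)) ≡ br q′ r

    bf-pos : 1 ≤ q′ → ∀ k → 1 ≤ bf k
    bf-pos h zero = ≤-refl
    bf-pos h (suc k) = *-mono-≤ (≤-trans (m^n>0 q′ {{>-nonZero h}} k) (br-≥ q′ k)) (bf-pos h k)

    rec : ∀ {x z} r → (∀ j → j ≤ r → Down j) → ∀ k s → k + s ≡ r → x ⊑ z → rk x + suc r ≡ rk z → suc k ≤ r →
      count (Lv′ x z k) * br q′ (suc s) ≡ count (Lv′ x z (suc k)) * br q′ (suc k)
    rec {x} {z} r down k s e h er hk = double-count {R = λ y w → Lv′ x z k y × Lv′ x z (suc k) w × (y ⊑ w)}
        _ _ (λ y w t → proj₁ t , proj₁ (proj₂ t)) f g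
      where
        f : ∀ y → Lv′ x z k y → count (λ w → Lv′ x z k y × Lv′ x z (suc k) w × (y ⊑ w)) ≡ br q′ (suc s)
        f y (xy , yz , ry) = trans
          (count-cong
            (λ w t → let (_ , (xw , wz , rw) , yw) = t in
              yw , wz , trans rw (trans (+-suc (rk x) k) (cong suc (sym ry))))
            (λ w t → let (yw , wz , rw) = t in
              (xy , yz , ry) , (⊑-trans xy yw , wz , trans rw (trans (cong suc ry) (sym (+-suc (rk x) k)))) , yw))
          (ups (suc s) yz (trans (cong (_+ suc s) ry) (trans (+-assoc (rk x) k (suc s))
            (trans (cong (rk x +_) (trans (+-suc k s) (cong suc e))) er))))
        g : ∀ w → Lv′ x z (suc k) w → count (λ y → Lv′ x z k y × Lv′ x z (suc k) w × (y ⊑ w)) ≡ br q′ (suc k)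
        g w (xw , wz , rw) = trans
          (count-cong
            (λ y t → let ((xy , yz , ry) , _ , yw) = t in
              xy , yw , trans (cong suc ry) (trans (sym (+-suc (rk x) k)) (sym rw)))
            (λ y t → let (xy , yw , ry) = t in
              (xy , ⊑-trans yw wz , suc-injective (trans ry (trans rw (+-suc (rk x) k)))) , (xw , wz , rw) , yw))
          (down (suc k) hk xw (sym rw))

    levels : ∀ {x z} r → (∀ j → j ≤ r → Down j) → x ⊑ z → rk x + suc r ≡ rk z →
      ∀ k s → k + s ≡ r → count (Lv′ x z k) * (bf k * bf (suc s)) ≡ bf (suc r)
    levels {x} {z} r down h er zero s refl = trans (cong (_* (1 * bf (suc s))) c₀) (l (bf (suc s)))
      where
        l : ∀ a → 1 * (1 * a) ≡ a
        l = solve-∀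
        c₀ : count (Lv′ x z 0) ≡ 1
        c₀ = trans (count-cong {Q = λ y → y ≡ x} {{Q? = λ {y} → y ≟ x}}
            (λ y w → sym (⊑-antisym (proj₁ w) (rk-eq (proj₁ w) (≤-reflexive (trans (proj₂ (proj₂ w)) (+-identityʳ _))))))
            (λ { y refl → ⊑-refl , h , sym (+-identityʳ _) }))
          (count-≡ x)
    levels {x} {z} r down h er (suc k) s e = trans (l₁ (count (Lv′ x z (suc k))) (br q′ (suc k)) (bf k) (bf (suc s)))
        (trans (cong (λ t → t * (bf k * bf (suc s)))
            (sym (rec r down k (suc s) (trans (+-suc k s) e) h er (≤-trans (m≤m+n (suc k) s) (≤-reflexive e)))))
          (trans (l₂ (count (Lv′ x z k)) (br q′ (suc (suc s))) (bf k) (bf (suc s)))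
            (levels r down h er k (suc s) (trans (+-suc k s) e))))
      where
        l₁ : ∀ a b c e → a * (b * c * e) ≡ a * b * (c * e)
        l₁ = solve-∀
        l₂ : ∀ a b c e → a * b * (c * e) ≡ a * (c * (b * e))
        l₂ = solve-∀

    down : 1 ≤ q′ → ∀ n j → j ≤ n → Down j
    down hq n zero _ {x} {z} h e = count-none λ y w → 1+n≰n (≤-trans (≤-reflexive (trans (proj₂ (proj₂ w)) (trans (sym e) (+-identityʳ _))))
      (rk-down (proj₁ w) (proj₁ (proj₂ w)) e))
      where
        rk-down : ∀ {x y z} → x ⊑ y → y ⊑ z → rk x + 0 ≡ rk z → rk x ≤ rk y
        rk-down {x} {y} {z} xy yz e = ≮⇒≥ λ lt → 1+n≰n (≤-trans lt (≤-reflexive (cong rk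
          (⊑-antisym xy (rk-eq xy (≤-trans (n≤1+n _) lt))))))
    down hq (suc n) (suc r) (s≤s le) {x} {z} h e = *-cancelʳ-≡ _ _ (bf r) {{>-nonZero (bf-pos hq r)}} (trans
        (cong (_* bf r) (count-cong {Q = Lv′ x z r}
          (λ y w → proj₁ w , proj₁ (proj₂ w) , suc-injective (trans (proj₂ (proj₂ w)) (trans (sym e) (+-suc (rk x) r))))
          (λ y w → proj₁ w , proj₁ (proj₂ w) , trans (cong suc (proj₂ (proj₂ w))) (trans (sym (+-suc (rk x) r)) e))))
        (trans (cong (count (Lv′ x z r) *_) (sym (l (bf r))))
          (levels r (λ j hj → down hq n j (≤-trans hj le)) h e r 0 (+-identityʳ r))))
      where l : ∀ a → a * (1 * 1) ≡ a
            l = solve-∀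

  -- Dual numbers are obtained by counting instead of a duality of vector spaces. Level by level
  -- from x, the level sizes follow from `ups` and from the lower cover numbers of shorter
  -- intervals; the top proper level is the set of lower covers of z.
  dns-from-ups : 1 ≤ q′ → ∀ {x z} r → x ⊑ z → rk x + r ≡ rk z →
    count (λ y → (x ⊑ y) × (y ⊑ z) × (suc (rk y) ≡ rk z)) ≡ br q′ r
  dns-from-ups hq r = down hq r r ≤-refl

-- Subsets of A^d as nested Boolean tables, so that extensional equality is propositional.
module Tables (m : ℕ) where

  private
    instance
      finite-A : Finite (Fin m)
      finite-A = Finite-Fin m

  Table : ℕ → Set
  Table zero = Bool
  Table (suc d) = Vec (Table d) m

  mem : ∀ {d} → Table d → Vec (Fin m) d → Bool
  mem t [] = t
  mem t (x ∷ v) = mem (Data.Vec.lookup t x) v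

  table : ∀ {d} → (Vec (Fin m) d → Bool) → Table d
  table {zero} f = f []
  table {suc d} f = Data.Vec.tabulate λ x → table λ v → f (x ∷ v)

  mem-table : ∀ {d} (f : Vec (Fin m) d → Bool) v → mem (table f) v ≡ f v
  mem-table f [] = refl
  mem-table f (x ∷ v) = trans (cong (λ t → mem t v) (Data.Vec.Properties.lookup∘tabulate _ x)) (mem-table (λ v → f (x ∷ v)) v)

  table-ext : ∀ {d} (s t : Table d) → (∀ v → mem s v ≡ mem t v) → s ≡ t
  table-ext {zero} s t h = h []
  table-ext {suc d} s t h = trans (sym (Data.Vec.Properties.tabulate∘lookup s))
    (trans (Data.Vec.Properties.tabulate-cong λ x → table-ext _ _ λ v → h (x ∷ v)) (Data.Vec.Properties.tabulate∘lookup t))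

  Finite-Table : ∀ d → Finite (Table d)
  Finite-Table zero = Finite-Bool
  Finite-Table (suc d) = Finite-Vec {{Finite-Table d}}

count-Vec : ∀ m k → ∑ {{Finite-Vec {Fin m} {k} {{Finite-Fin m}}}} (λ _ → 1) ≡ m ^ k
count-Vec m zero = refl
count-Vec m (suc k) = trans (sumL-map (λ { (y , v) → y ∷ v }) (pairs els vs) (λ _ → 1))
    (trans (sumL-pairs els vs (λ _ → 1)) (trans (sumL-cong els (λ _ → trans (count-Vec m k) (sym (*-identityˡ (m ^ k)))))
      (trans (sumL-* els (λ _ → 1) (m ^ k)) (cong (_* m ^ k) (fin m)))))
  where
    els = Finite.elems (Finite-Fin m)
    vs = Finite.elems (Finite-Vec {Fin m} {k} {{Finite-Fin m}})
    fin : ∀ m → sumL (Finite.elems (Finite-Fin m)) (λ _ → 1) ≡ m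
    fin zero = refl
    fin (suc m) = cong suc (trans (sumL-map suc (Finite.elems (Finite-Fin m)) (λ _ → 1)) (fin m))

module Linear {p : ℕ} (K : FiniteField (suc p)) (n : ℕ) where
  open FiniteField K
  open IsCommutativeRing isCommRing
    using (zeroˡ; zeroʳ; distribˡ; distribʳ)
    renaming (-‿inverseˡ to +-inverseˡ; -‿inverseʳ to +-inverseʳ; +-assoc to F+-assoc; +-comm to F+-comm; +-identityˡ to F+-identityˡ; +-identityʳ to F+-identityʳ;
              *-assoc to F*-assoc; *-comm to F*-comm; *-identityˡ to F*-identityˡ)
  open Geometry K n
  open Tables (suc p)

  private
    q = suc p

  instance
    finite-F : Finite (Fin q)
    finite-F = Finite-Fin q

    finite-T : Finite (Table d)
    finite-T = Finite-Table d

    dec-V≡ : {u v : V} → Dec (u ≡ v)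
    dec-V≡ {u} {v} = u ≟ v

    dec-Bool≡ : {a b : Bool} → Dec (a ≡ b)
    dec-Bool≡ {a} {b} = a Data.Bool.≟ b

  1≤p : 1 ≤ p
  1≤p = pos p K
    where
      one : (x y : Fin 1) → x ≡ y
      one zero zero = refl
      pos : ∀ p → FiniteField (suc p) → 1 ≤ p
      pos zero K = ⊥-elim (FiniteField.0≢1 K (one _ _))
      pos (suc p) K = s≤s z≤n

  +V-assoc : ∀ u v w → (u +V v) +V w ≡ u +V (v +V w)
  +V-assoc = Data.Vec.Properties.zipWith-assoc F+-assoc

  +V-comm : ∀ u v → u +V v ≡ v +V u
  +V-comm = Data.Vec.Properties.zipWith-comm F+-comm

  +V-idˡ : ∀ v → zeroV +V v ≡ v
  +V-idˡ = Data.Vec.Properties.zipWith-identityˡ F+-identityˡ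

  +V-idʳ : ∀ v → v +V zeroV ≡ v
  +V-idʳ = Data.Vec.Properties.zipWith-identityʳ F+-identityʳ

  neg : V → V
  neg = Data.Vec.map -F_

  +V-invʳ : ∀ v → v +V neg v ≡ zeroV
  +V-invʳ = Data.Vec.Properties.zipWith-inverseʳ +-inverseʳ

  +V-invˡ : ∀ v → neg v +V v ≡ zeroV
  +V-invˡ v = trans (+V-comm (neg v) v) (+V-invʳ v)

  private
    map-zip : ∀ {k} (f : Fin q → Fin q) → (∀ a b → f (a +F b) ≡ f a +F f b) → (u v : Vec (Fin q) k) →
      Data.Vec.map f (Data.Vec.zipWith _+F_ u v) ≡ Data.Vec.zipWith _+F_ (Data.Vec.map f u) (Data.Vec.map f v)
    map-zip f h [] [] = refl
    map-zip f h (a ∷ u) (b ∷ v) = cong₂ _∷_ (h a b) (map-zip f h u v)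

    map-add : ∀ {k} a b (v : Vec (Fin q) k) →
      Data.Vec.map ((a +F b) *F_) v ≡ Data.Vec.zipWith _+F_ (Data.Vec.map (a *F_) v) (Data.Vec.map (b *F_) v)
    map-add a b [] = refl
    map-add a b (x ∷ v) = cong₂ _∷_ (distribʳ x a b) (map-add a b v)

    map-zero : ∀ {k} (v : Vec (Fin q) k) → Data.Vec.map (0F *F_) v ≡ Data.Vec.replicate k 0F
    map-zero [] = refl
    map-zero (x ∷ v) = cong₂ _∷_ (zeroˡ x) (map-zero v)

  ·V-distribˡ : ∀ c u v → c ·V (u +V v) ≡ (c ·V u) +V (c ·V v)
  ·V-distribˡ c u v = map-zip (c *F_) (distribˡ c) u v

  ·V-distribʳ : ∀ a b v → (a +F b) ·V v ≡ (a ·V v) +V (b ·V v)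
  ·V-distribʳ a b v = map-add a b v

  ·V-zeroˡ : ∀ v → 0F ·V v ≡ zeroV
  ·V-zeroˡ v = map-zero v

  ·V-assoc : ∀ a b v → (a *F b) ·V v ≡ a ·V (b ·V v)
  ·V-assoc a b v = trans (Data.Vec.Properties.map-cong (λ x → F*-assoc a b x) v) (Data.Vec.Properties.map-∘ (a *F_) (b *F_) v)

  ·V-idˡ : ∀ v → 1F ·V v ≡ v
  ·V-idˡ v = trans (Data.Vec.Properties.map-cong F*-identityˡ v) (Data.Vec.Properties.map-id v)

  ·V-zeroʳ : ∀ c → c ·V zeroV ≡ zeroV
  ·V-zeroʳ c = trans (cong (c ·V_) (sym (·V-zeroˡ zeroV))) (trans (sym (·V-assoc c 0F zeroV))
    (trans (cong (_·V zeroV) (zeroʳ c)) (·V-zeroˡ zeroV)))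

  +V-cancelʳ : ∀ u v w → u +V w ≡ v +V w → u ≡ v
  +V-cancelʳ u v w e = trans (sym (+V-idʳ u)) (trans (cong (u +V_) (sym (+V-invʳ w))) (trans (sym (+V-assoc u w (neg w)))
    (trans (cong (_+V neg w) e) (trans (+V-assoc v w (neg w)) (trans (cong (v +V_) (+V-invʳ w)) (+V-idʳ v))))))

  neg-unique : ∀ u v → u +V v ≡ zeroV → u ≡ neg v
  neg-unique u v e = +V-cancelʳ u (neg v) v (trans e (sym (+V-invˡ v)))

  neg-· : ∀ v → neg v ≡ (-F 1F) ·V v
  neg-· v = sym (neg-unique ((-F 1F) ·V v) v (trans (cong (((-F 1F) ·V v) +V_) (sym (·V-idˡ v)))
    (trans (sym (·V-distribʳ (-F 1F) 1F v)) (trans (cong (_·V v) (+-inverseˡ 1F)) (·V-zeroˡ v)))))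

  interchange : ∀ a b c e → (a +V b) +V (c +V e) ≡ (a +V c) +V (b +V e)
  interchange a b c e = trans (+V-assoc a b (c +V e)) (trans (cong (a +V_) (trans (sym (+V-assoc b c e))
    (trans (cong (_+V e) (+V-comm b c)) (+V-assoc c b e)))) (sym (+V-assoc a c (b +V e))))

  lc-+ : ∀ {k} (c c′ : Vec (Fin q) k) (bs : Vec V k) →
    lincomb (Data.Vec.zipWith _+F_ c c′) bs ≡ lincomb c bs +V lincomb c′ bs
  lc-+ [] [] [] = sym (+V-idˡ zeroV)
  lc-+ (a ∷ c) (a′ ∷ c′) (b ∷ bs) = trans (cong₂ _+V_ (·V-distribʳ a a′ b) (lc-+ c c′ bs))
    (interchange (a ·V b) (a′ ·V b) (lincomb c bs) (lincomb c′ bs))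

  lc-· : ∀ {k} a (c : Vec (Fin q) k) (bs : Vec V k) → lincomb (Data.Vec.map (a *F_) c) bs ≡ a ·V lincomb c bs
  lc-· a [] [] = sym (·V-zeroʳ a)
  lc-· a (x ∷ c) (b ∷ bs) = trans (cong₂ _+V_ (·V-assoc a x b) (lc-· a c bs)) (sym (·V-distribˡ a (x ·V b) (lincomb c bs)))

  lc-0 : ∀ {k} (bs : Vec V k) → lincomb (Data.Vec.replicate k 0F) bs ≡ zeroV
  lc-0 [] = refl
  lc-0 (b ∷ bs) = trans (cong₂ _+V_ (·V-zeroˡ b) (lc-0 bs)) (+V-idˡ zeroV)

  _∈ᵗ_ : V → Table d → Set
  v ∈ᵗ t = mem t v ≡ true

  Closed : Table d → Set
  Closed t = (zeroV ∈ᵗ t) × (∀ (w : V × V) → (proj₁ w ∈ᵗ t) × (proj₂ w ∈ᵗ t) → (proj₁ w +V proj₂ w) ∈ᵗ t) ×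
             (∀ (w : Fin q × V) → proj₂ w ∈ᵗ t → (proj₁ w ·V proj₂ w) ∈ᵗ t)

  closed? : ∀ t → Dec (Closed t)
  closed? t = dec-× {{dec-Bool≡}} {{dec-× {{dec-∀ {{P? = dec-→ dec-× dec-Bool≡}}}} {{dec-∀ {{P? = dec-→ dec-Bool≡ dec-Bool≡}}}}}}

  opaque
    -- `True` of a decision has at most one proof, so a subspace is determined by its table.
    IsSubspace : Table d → Set
    IsSubspace t = True (closed? t)

    is-subspace? : ∀ t → Dec (IsSubspace t)
    is-subspace? t = T? _

    is-subspace-irr : ∀ {t} (a b : IsSubspace t) → a ≡ b
    is-subspace-irr = T-irrelevant

    to-closed : ∀ {t} → IsSubspace t → Closed t
    to-closed = toWitness

    from-closed : ∀ {t} → Closed t → IsSubspace t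
    from-closed = fromWitness

  Subspace : Set
  Subspace = Σ (Table d) IsSubspace

  -- Opaque, because its normal form is the list of all subspaces.
  opaque
    subspaces : Finite Subspace
    subspaces = Finite-Σ finite-T IsSubspace is-subspace? is-subspace-irr

  instance
    finite-Subspace : Finite Subspace
    finite-Subspace = subspaces

  record _∈_ₓ (v : V) (x : Subspace) : Set where
    constructor mk∈
    field un∈ : mem (proj₁ x) v ≡ true
  open _∈_ₓ

  infix 4 _∈_ₓ

  instance
    dec-∈ : ∀ {v x} → Dec (v ∈ x ₓ)
    dec-∈ {v} {x} with mem (proj₁ x) v in e
    ... | true = yes (mk∈ e)
    ... | false = no λ h → case trans (sym e) (un∈ h) of λ ()

  module _ {x : Subspace} where
    ∈-zero : zeroV ∈ x ₓ
    ∈-zero = mk∈ (proj₁ (to-closed (proj₂ x)))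

    ∈-+ : ∀ {u v} → u ∈ x ₓ → v ∈ x ₓ → (u +V v) ∈ x ₓ
    ∈-+ {u} {v} h k = mk∈ (proj₁ (proj₂ (to-closed (proj₂ x))) (u , v) (un∈ h , un∈ k))

    ∈-· : ∀ {c v} → v ∈ x ₓ → (c ·V v) ∈ x ₓ
    ∈-· {c} {v} h = mk∈ (proj₂ (proj₂ (to-closed (proj₂ x))) (c , v) (un∈ h))

    ∈-neg : ∀ {v} → v ∈ x ₓ → neg v ∈ x ₓ
    ∈-neg {v} h = subst (λ t → t ∈ x ₓ) (sym (neg-· v)) (∈-· h)

  sub-ext : {x y : Subspace} → (∀ v → v ∈ x ₓ → v ∈ y ₓ) → (∀ v → v ∈ y ₓ → v ∈ x ₓ) → x ≡ y
  sub-ext {s , a} {t , b} h k = help (table-ext s t λ v → eq v)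
    where
      eq : ∀ v → mem s v ≡ mem t v
      eq v with mem s v in e₁ | mem t v in e₂
      ... | true | true = refl
      ... | false | false = refl
      ... | true | false = trans (sym (un∈ (h v (mk∈ e₁)))) e₂
      ... | false | true = trans (sym e₁) (un∈ (k v (mk∈ e₂)))
      help : s ≡ t → (s , a) ≡ (t , b)
      help refl = cong (s ,_) (is-subspace-irr a b)

  module Comprehension (P : V → Set) (P? : ∀ v → Dec (P v)) (P0 : P zeroV)
    (P+ : ∀ {u v} → P u → P v → P (u +V v)) (P· : ∀ {c v} → P v → P (c ·V v)) where
    private
      t : Table d
      t = table λ v → does (P? v)
      into : ∀ {v} → P v → v ∈ᵗ t
      into {v} h = trans (mem-table _ v) (g (P? v) h)
        where g : ∀ {A : Set} (a : Dec A) → A → does a ≡ true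
              g (yes _) _ = refl
              g (no n) a = ⊥-elim (n a)
      out : ∀ {v} → v ∈ᵗ t → P v
      out {v} e = g (P? v) (trans (sym (mem-table _ v)) e)
        where g : ∀ {A : Set} (a : Dec A) → does a ≡ true → A
              g (yes a) _ = a
    set : Subspace
    set = t , from-closed (into P0 , (λ { (u , v) (h , k) → into {u +V v} (P+ (out {u} h) (out {v} k)) }) ,
      (λ { (c , v) h → into {c ·V v} (P· (out {v} h)) }))

    ∈-set : ∀ {v} → P v → v ∈ set ₓ
    ∈-set h = mk∈ (into h)

    set-∈ : ∀ {v} → v ∈ set ₓ → P v
    set-∈ h = out (un∈ h)

  opaque
    subset? : ∀ x y → Dec (∀ v → v ∈ x ₓ → v ∈ y ₓ)
    subset? x y = dec-∀ {{P? = dec-→ dec-∈ dec-∈}}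

    _⊆ᵇ_ : Subspace → Subspace → Set
    x ⊆ᵇ y = True (subset? x y)

    ⊆ᵇ-dec : ∀ {x y} → Dec (x ⊆ᵇ y)
    ⊆ᵇ-dec = T? _

    ⊆ᵇ-irr : ∀ {x y} (a b : x ⊆ᵇ y) → a ≡ b
    ⊆ᵇ-irr = T-irrelevant

    from-⊆ : ∀ {x y} → x ⊆ᵇ y → ∀ {v} → v ∈ x ₓ → v ∈ y ₓ
    from-⊆ h = toWitness h _

    to-⊆ : ∀ {x y} → (∀ v → v ∈ x ₓ → v ∈ y ₓ) → x ⊆ᵇ y
    to-⊆ = fromWitness

  instance
    dec-⊆ : ∀ {x y} → Dec (x ⊆ᵇ y)
    dec-⊆ = ⊆ᵇ-dec

  module Meet (x y : Subspace) = Comprehension (λ v → (v ∈ x ₓ) × (v ∈ y ₓ)) (λ v → dec-×) (∈-zero , ∈-zero)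
    (λ h k → ∈-+ (proj₁ h) (proj₁ k) , ∈-+ (proj₂ h) (proj₂ k)) (λ h → ∈-· (proj₁ h) , ∈-· (proj₂ h))

  SumOf : Subspace → Subspace → V → Set
  SumOf x y v = Σ (V × V) λ w → (proj₁ w ∈ x ₓ) × (proj₂ w ∈ y ₓ) × (proj₁ w +V proj₂ w ≡ v)

  sum-zero : ∀ {x y} → SumOf x y zeroV
  sum-zero = (zeroV , zeroV) , ∈-zero , ∈-zero , +V-idˡ zeroV

  sum-+ : ∀ {x y u v} → SumOf x y u → SumOf x y v → SumOf x y (u +V v)
  sum-+ ((a , b) , ha , hb , refl) ((a′ , b′) , ha′ , hb′ , refl) =
    (a +V a′ , b +V b′) , ∈-+ ha ha′ , ∈-+ hb hb′ , interchange a a′ b b′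

  sum-· : ∀ {x y c v} → SumOf x y v → SumOf x y (c ·V v)
  sum-· {c = c} ((a , b) , ha , hb , refl) = (c ·V a , c ·V b) , ∈-· ha , ∈-· hb , sym (·V-distribˡ c a b)

  module Join (x y : Subspace) = Comprehension (SumOf x y) (λ v → dec-∃) sum-zero sum-+ sum-·

  span-+ : ∀ {k} {bs : Vec V k} {u v} → InSpan u bs → InSpan v bs → InSpan (u +V v) bs
  span-+ {bs = bs} (c , refl) (c′ , refl) = Data.Vec.zipWith _+F_ c c′ , lc-+ c c′ bs

  span-· : ∀ {k} {bs : Vec V k} {a v} → InSpan v bs → InSpan (a ·V v) bs
  span-· {bs = bs} {a} (c , refl) = Data.Vec.map (a *F_) c , lc-· a c bs

  module Span {k : ℕ} (bs : Vec V k) = Comprehension (λ v → InSpan v bs) (λ v → dec-∃)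
    (Data.Vec.replicate k 0F , lc-0 bs) span-+ span-·

  card : Subspace → ℕ
  card x = count (λ v → v ∈ x ₓ)

  indep-inj : ∀ {k} {bs : Vec V k} → LinIndep bs → ∀ c c′ → lincomb c bs ≡ lincomb c′ bs → c ≡ c′
  indep-inj {k} {bs} ind c c′ e = from-diff c c′ (ind _ (trans (lc-+ c (Data.Vec.map ((-F 1F) *F_) c′) bs)
      (trans (cong₂ _+V_ e (lc-· (-F 1F) c′ bs)) (trans (cong (lincomb c′ bs +V_) (sym (neg-· (lincomb c′ bs)))) (+V-invʳ (lincomb c′ bs))))))
    where
      from-diff : ∀ {k} (c c′ : Vec (Fin q) k) → Data.Vec.zipWith _+F_ c (Data.Vec.map ((-F 1F) *F_) c′) ≡ Data.Vec.replicate k 0F → c ≡ c′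
      from-diff [] [] _ = refl
      from-diff (a ∷ c) (b ∷ c′) e = cong₂ _∷_ (scal a b (cong Data.Vec.head e)) (from-diff c c′ (cong Data.Vec.tail e))
        where
          scal : ∀ a b → a +F ((-F 1F) *F b) ≡ 0F → a ≡ b
          scal a b h = trans (sym (F+-identityʳ a)) (trans (cong (a +F_) (sym z)) (trans (sym (F+-assoc a _ b))
              (trans (cong (_+F b) h) (F+-identityˡ b))))
            where z : ((-F 1F) *F b) +F b ≡ 0F
                  z = trans (cong (((-F 1F) *F b) +F_) (sym (F*-identityˡ b))) (trans (sym (distribʳ b (-F 1F) 1F))
                        (trans (cong (_*F b) (+-inverseˡ 1F)) (zeroˡ b)))

  card-span : ∀ {k} {bs : Vec V k} → LinIndep bs → card (Span.set bs) ≡ q ^ k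
  card-span {k} {bs} ind = trans (sym (count-bij {P = λ (c : Vec (Fin q) k) → c ≡ c} {{λ {c} → yes refl}}
      (λ c → lincomb c bs) coord (λ c _ → Span.∈-set bs (c , refl)) (λ v _ → refl)
      (λ c _ → indep-inj ind _ _ (coord-ok _ (c , refl))) (λ v h → coord-ok v (Span.set-∈ bs h))))
    (trans (count-all {P = λ (c : Vec (Fin q) k) → c ≡ c} {{λ {c} → yes refl}} (λ c → refl)) (count-Vec q k))
    where
      instance
        in? : ∀ {v} → Dec (InSpan v bs)
        in? = dec-∃
      coord : V → Vec (Fin q) k
      coord v with decide (InSpan v bs)
      ... | inj₁ (c , _) = c
      ... | inj₂ _ = Data.Vec.replicate k 0F
      coord-ok : ∀ v → InSpan v bs → lincomb (coord v) bs ≡ v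
      coord-ok v h with decide (InSpan v bs)
      ... | inj₁ (c , e) = e
      ... | inj₂ n = ⊥-elim (n h)

  extend-indep : ∀ {k v} {bs : Vec V k} → LinIndep bs → ¬ InSpan v bs → LinIndep (v ∷ bs)
  extend-indep {k} {v} {bs} ind nv (c ∷ cs) e with decide (c ≡ 0F) {{c ≟ 0F}}
  ... | inj₁ refl = cong (0F ∷_) (ind cs (trans (sym (+V-idˡ _)) (trans (cong (_+V lincomb cs bs) (sym (·V-zeroˡ v))) e)))
  ... | inj₂ nz = ⊥-elim (nv (Data.Vec.map ((-F c⁻¹) *F_) cs , trans (lc-· (-F c⁻¹) cs bs) (sym v-eq)))
    where
      c⁻¹ = proj₁ (inverse c nz)
      L = lincomb cs bs
      inv : (c⁻¹ *F c) ≡ 1F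
      inv = trans (F*-comm c⁻¹ c) (proj₂ (inverse c nz))
      minus : (-F c⁻¹) ·V L ≡ neg (c⁻¹ ·V L)
      minus = neg-unique _ _ (trans (sym (·V-distribʳ (-F c⁻¹) c⁻¹ L)) (trans (cong (_·V L) (+-inverseˡ c⁻¹)) (·V-zeroˡ L)))
      v-eq : v ≡ (-F c⁻¹) ·V L
      v-eq = trans (neg-unique v (c⁻¹ ·V L) (trans (cong (_+V (c⁻¹ ·V L)) (trans (sym (·V-idˡ v))
          (trans (cong (_·V v) (sym inv)) (·V-assoc c⁻¹ c v))))
        (trans (sym (·V-distribˡ c⁻¹ (c ·V v) L)) (trans (cong (c⁻¹ ·V_) e) (·V-zeroʳ c⁻¹))))) (sym minus)

  ^-inj-≤ : ∀ {a b} → q ^ a ≤ q ^ b → a ≤ b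
  ^-inj-≤ {a} {b} h = ≮⇒≥ λ lt → 1+n≰n (≤-trans (^-monoʳ-< q (s≤s 1≤p) lt) h)

  ^-inj : ∀ {a b} → q ^ a ≡ q ^ b → a ≡ b
  ^-inj e = ≤-antisym (^-inj-≤ (≤-reflexive e)) (^-inj-≤ (≤-reflexive (sym e)))

  span-⊆ : ∀ {k} (bs : Vec V k) {x : Subspace} → (∀ i → Data.Vec.lookup bs i ∈ x ₓ) → ∀ {v} → InSpan v bs → v ∈ x ₓ
  span-⊆ [] h ([] , refl) = ∈-zero
  span-⊆ (b ∷ bs) h (c ∷ cs , refl) = ∈-+ (∈-· (h zero)) (span-⊆ bs (λ i → h (suc i)) (cs , refl))

  record Basis (x : Subspace) : Set where
    field
      size : ℕ
      vecs : Vec V size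
      free : LinIndep vecs
      inside : ∀ i → Data.Vec.lookup vecs i ∈ x ₓ
      spans : ∀ {v} → v ∈ x ₓ → InSpan v vecs

  find-basis : (x : Subspace) → Basis x
  find-basis x = go (suc d) 0 [] (λ { [] _ → refl }) (λ ()) (≤-reflexive (sym (+-identityʳ (suc d))))
    where
      go : ∀ g k (bs : Vec V k) → LinIndep bs → (∀ i → Data.Vec.lookup bs i ∈ x ₓ) → suc d ≤ g + k → Basis x
      go g k bs ind h hg with search (λ v → (v ∈ x ₓ) × ¬ InSpan v bs) {{dec-× {{dec-∈}} {{dec-¬ {{dec-∃}}}}}}
      ... | inj₂ none = record { size = k ; vecs = bs ; free = ind ; inside = h
                               ; spans = λ {v} hv → stable {{dec-∃}} λ n → none v (hv , n) }
      -- Independent vectors span q^k of the q^d vectors, so their number cannot reach d + 1.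
      go zero k bs ind h hg | inj₁ _ = ⊥-elim (1+n≰n (≤-trans hg (^-inj-≤ (≤-trans (≤-reflexive (sym (card-span ind)))
        (≤-trans (count-mono {Q = λ (v : V) → v ≡ v} {{Q? = yes refl}} λ _ _ → refl)
          (≤-reflexive (trans (count-all {P = λ (v : V) → v ≡ v} {{yes refl}} λ _ → refl) (count-Vec q d))))))))
      go (suc g) k bs ind h hg | inj₁ (v , hv , nv) = go g (suc k) (v ∷ bs) (extend-indep ind nv)
        (λ { zero → hv ; (suc i) → h i }) (≤-trans hg (≤-reflexive (sym (+-suc g k))))

  opaque
    rank : Subspace → ℕ
    rank x = Basis.size (find-basis x)

    basis-of : (x : Subspace) → Σ (Vec V (rank x)) λ bs → LinIndep bs × (∀ {v} → InSpan v bs → v ∈ x ₓ) × (∀ {v} → v ∈ x ₓ → InSpan v bs)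
    basis-of x = vecs , free , span-⊆ vecs inside , spans
      where open Basis (find-basis x)

  card-rank : ∀ x → card x ≡ q ^ rank x
  card-rank x with basis-of x
  ... | bs , ind , out , into = trans (count-cong (λ v h → Span.∈-set bs (into h)) (λ v h → out (Span.set-∈ bs h))) (card-span ind)

  card-mono : ∀ {x y} → x ⊆ᵇ y → card x ≤ card y
  card-mono h = count-mono λ v → from-⊆ h

  rank-mono : ∀ {x y} → x ⊆ᵇ y → rank x ≤ rank y
  rank-mono {x} {y} h = ^-inj-≤ (subst₂ _≤_ (card-rank x) (card-rank y) (card-mono h))

  card-diff : ∀ {x y} → x ⊆ᵇ y → card y ≡ count (λ v → (v ∈ y ₓ) × ¬ (v ∈ x ₓ)) + card x
  card-diff {x} {y} h = count-⊎ (λ v k → case decide (v ∈ x ₓ) of λ { (inj₁ a) → inj₂ a ; (inj₂ a) → inj₁ (k , a) })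
    (λ v → proj₁) (λ v → from-⊆ h) (λ v → proj₂)

  rank-eq : ∀ {x y} → x ⊆ᵇ y → rank y ≤ rank x → y ⊆ᵇ x
  rank-eq {x} {y} h k = to-⊆ λ v vy → stable λ nv → 1+n≰n (≤-trans
    (≤-trans (+-monoˡ-≤ (card x) (count-pos {P = λ v → (v ∈ y ₓ) × ¬ (v ∈ x ₓ)} v (vy , nv))) (≤-reflexive (sym (card-diff h))))
    (subst₂ _≤_ (sym (card-rank y)) (sym (card-rank x)) (^-monoʳ-≤ q k)))

  _∩_ _∪_ : Subspace → Subspace → Subspace
  x ∩ y = Meet.set x y
  x ∪ y = Join.set x y

  ∪ˡ : ∀ {x y} → x ⊆ᵇ (x ∪ y)
  ∪ˡ {x} {y} = to-⊆ λ v h → Join.∈-set x y ((v , zeroV) , h , ∈-zero , +V-idʳ v)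

  ∪ʳ : ∀ {x y} → y ⊆ᵇ (x ∪ y)
  ∪ʳ {x} {y} = to-⊆ λ v h → Join.∈-set x y ((zeroV , v) , ∈-zero , h , +V-idˡ v)

  ∪-lub : ∀ {x y z} → x ⊆ᵇ z → y ⊆ᵇ z → (x ∪ y) ⊆ᵇ z
  ∪-lub {x} {y} {z} h k = to-⊆ λ v w → f (Join.set-∈ x y w)
    where f : ∀ {v} → SumOf x y v → v ∈ z ₓ
          f ((a , b) , ha , hb , refl) = ∈-+ (from-⊆ h ha) (from-⊆ k hb)

  private
    +V-sub : ∀ u v w → (u +V w) +V (v +V neg w) ≡ u +V v
    +V-sub u v w = trans (interchange u w v (neg w)) (trans (cong ((u +V v) +V_) (+V-invʳ w)) (+V-idʳ (u +V v)))

    +V-undo : ∀ u w → (u +V neg w) +V w ≡ u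
    +V-undo u w = trans (+V-assoc u (neg w) w) (trans (cong (u +V_) (+V-invˡ w)) (+V-idʳ u))

    move : ∀ a b a₀ b₀ → a +V b ≡ a₀ +V b₀ → a +V neg a₀ ≡ b₀ +V neg b
    move a b a₀ b₀ e = +V-cancelʳ _ _ (a₀ +V b) (trans (trans (cong ((a +V neg a₀) +V_) (+V-comm a₀ b))
        (trans (interchange a (neg a₀) b a₀) (trans (cong ((a +V b) +V_) (+V-invˡ a₀)) (+V-idʳ (a +V b)))))
      (trans e (sym (trans (interchange b₀ (neg b) a₀ b) (trans (cong ((b₀ +V a₀) +V_) (+V-invˡ b))
        (trans (+V-idʳ (b₀ +V a₀)) (+V-comm b₀ a₀)))))))

  -- Both sides count the pairs in x × y, fibred over their sums.
  card-mod : ∀ x y → card (x ∪ y) * card (x ∩ y) ≡ card x * card y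
  card-mod x y = trans (sym (double-count {P = λ w → (proj₁ w ∈ x ₓ) × (proj₂ w ∈ y ₓ)} {Q = λ v → v ∈ x ∪ y ₓ}
      {R = λ w v → ((proj₁ w ∈ x ₓ) × (proj₂ w ∈ y ₓ)) × (proj₁ w +V proj₂ w ≡ v)} 1 (card (x ∩ y))
      (λ { (a , b) v ((ha , hb) , e) → (ha , hb) , Join.∈-set x y ((a , b) , ha , hb , e) })
      (λ w h → trans (count-cong {Q = λ v → v ≡ proj₁ w +V proj₂ w} (λ v r → sym (proj₂ r)) (λ v e → h , sym e)) (count-≡ (proj₁ w +V proj₂ w)))
      (λ v h → fibre v (Join.set-∈ x y h))))
    (trans (*-identityʳ _) count-×)
    where
      fibre : ∀ v → SumOf x y v → count (λ w → ((proj₁ w ∈ x ₓ) × (proj₂ w ∈ y ₓ)) × (proj₁ w +V proj₂ w ≡ v)) ≡ card (x ∩ y)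
      fibre v ((a₀ , b₀) , ha₀ , hb₀ , e₀) = count-bij (λ w → proj₁ w +V neg a₀) (λ u → u +V a₀ , b₀ +V neg u)
        (λ { (a , b) ((ha , hb) , e) → Meet.∈-set x y (∈-+ ha (∈-neg ha₀) ,
          subst (λ t → t ∈ y ₓ) (sym (move a b a₀ b₀ (trans e (sym e₀)))) (∈-+ hb₀ (∈-neg hb))) })
        (λ u h → let (hx , hy) = Meet.set-∈ x y h in (∈-+ hx ha₀ , ∈-+ hb₀ (∈-neg hy)) ,
          trans (cong (_+V (b₀ +V neg u)) (+V-comm u a₀)) (trans (+V-sub a₀ b₀ u) e₀))
        (λ { (a , b) ((ha , hb) , e) → cong₂ _,_ (+V-undo a a₀)
          (+V-cancelʳ _ _ (a +V neg a₀) (trans (+V-undo b₀ (a +V neg a₀))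
            (sym (trans (cong (b +V_) (move a b a₀ b₀ (trans e (sym e₀)))) (trans (+V-comm b _) (+V-undo b₀ b)))))) })
        (λ u _ → trans (+V-assoc u a₀ (neg a₀)) (trans (cong (u +V_) (+V-invʳ a₀)) (+V-idʳ u)))

  -- The modular law is the exponent form of `card-mod`.
  rank-mod : ∀ x y → rank (x ∪ y) + rank (x ∩ y) ≡ rank x + rank y
  rank-mod x y = ^-inj (trans (^-distribˡ-+-* q (rank (x ∪ y)) (rank (x ∩ y))) (trans
    (sym (cong₂ _*_ (card-rank (x ∪ y)) (card-rank (x ∩ y)))) (trans (card-mod x y) (trans (cong₂ _*_ (card-rank x) (card-rank y))
      (sym (^-distribˡ-+-* q (rank x) (rank y)))))))

  rank-span : ∀ {k} {bs : Vec V k} → LinIndep bs → rank (Span.set bs) ≡ k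
  rank-span {k} {bs} ind = ^-inj (trans (sym (card-rank (Span.set bs))) (card-span ind))

  top bot : Subspace
  top = Comprehension.set (λ v → v ≡ v) (λ v → yes refl) refl (λ _ _ → refl) (λ _ → refl)
  bot = Span.set []

  rank-bot : rank bot ≡ 0
  rank-bot = rank-span {bs = []} λ { [] _ → refl }

  bot-zero : ∀ {v} → v ∈ bot ₓ → v ≡ zeroV
  bot-zero h = f (Span.set-∈ [] h)
    where f : ∀ {v} → InSpan v [] → v ≡ zeroV
          f ([] , e) = sym e

  ∈-top : ∀ {v} → v ∈ top ₓ
  ∈-top = Comprehension.∈-set (λ v → v ≡ v) (λ v → yes refl) refl (λ _ _ → refl) (λ _ → refl) refl

  rank-top : rank top ≡ d
  rank-top = ^-inj (trans (sym (card-rank top)) (trans (count-all λ v → ∈-top) (count-Vec q d)))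

  line : V → Subspace
  line v = Span.set (v ∷ [])

  ∈-line : ∀ v → v ∈ line v ₓ
  ∈-line v = Span.∈-set (v ∷ []) (1F ∷ [] , trans (+V-idʳ _) (·V-idˡ v))

  rank-add : ∀ {x v} → ¬ (v ∈ x ₓ) → rank (x ∪ line v) ≡ suc (rank x)
  rank-add {x} {v} nv = +-cancelʳ-≡ 0 _ _ (trans (cong (rank (x ∪ line v) +_) (sym meet0))
      (trans (rank-mod x (line v)) (trans (cong (rank x +_) rank-line) (trans (+-comm (rank x) 1) (sym (+-identityʳ _))))))
    where
      rank-line : rank (line v) ≡ 1
      rank-line = rank-span (extend-indep {bs = []} (λ { [] _ → refl }) λ { ([] , e) → nv (subst (λ t → t ∈ x ₓ) e ∈-zero) })
      meet0 : rank (x ∩ line v) ≡ 0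
      meet0 = n≤0⇒n≡0 (≤-trans (rank-mono (to-⊆ λ u h → let (hx , hl) = Meet.set-∈ x (line v) h in
          f hx (Span.set-∈ (v ∷ []) hl))) (≤-reflexive rank-bot))
        where
          f : ∀ {u} → u ∈ x ₓ → InSpan u (v ∷ []) → u ∈ bot ₓ
          f hx (c ∷ [] , refl) with decide (c ≡ 0F) {{c ≟ 0F}}
          ... | inj₁ refl = Span.∈-set [] ([] , sym (trans (+V-idʳ _) (·V-zeroˡ v)))
          ... | inj₂ nz = ⊥-elim (nv (subst (λ t → t ∈ x ₓ) (trans (cong (proj₁ (inverse c nz) ·V_) (+V-idʳ _))
                (trans (sym (·V-assoc (proj₁ (inverse c nz)) c v)) (trans (cong (_·V v) (trans (F*-comm _ c) (proj₂ (inverse c nz)))) (·V-idˡ v))))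
                (∈-· {c = proj₁ (inverse c nz)} hx)))

  -- Counts pairs of a cover y and a vector v of y outside x. Each y contributes q^(rank x) (q - 1)
  -- vectors, and each v of z outside x lies in exactly one y, its join with x.
  covers : ∀ {x z} r → x ⊆ᵇ z → rank x + r ≡ rank z →
    count (λ y → (x ⊆ᵇ y) × (y ⊆ᵇ z) × (rank y ≡ suc (rank x))) ≡ br q r
  covers {x} {z} r h e = *-cancelʳ-≡ _ _ (q ^ rank x * p) {{m*n≢0 (q ^ rank x) p {{m^n≢0 q (rank x)}} {{>-nonZero 1≤p}}}} (trans
      (double-count {P = λ y → (x ⊆ᵇ y) × (y ⊆ᵇ z) × (rank y ≡ suc (rank x))} {Q = λ v → (v ∈ z ₓ) × ¬ (v ∈ x ₓ)}
        {R = λ y v → ((x ⊆ᵇ y) × (y ⊆ᵇ z) × (rank y ≡ suc (rank x))) × (v ∈ y ₓ) × ¬ (v ∈ x ₓ)} (q ^ rank x * p) 1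
        (λ y v w → proj₁ w , from-⊆ (proj₁ (proj₂ (proj₁ w))) (proj₁ (proj₂ w)) , proj₂ (proj₂ w)) per-y per-v)
      (trans (*-identityʳ _) (+-cancelʳ-≡ (card x) _ _ (trans (sym (card-diff h)) (trans (card-rank z) (trans (cong (q ^_) (sym e))
        (trans (^-distribˡ-+-* q (rank x) r) (trans (cong (q ^ rank x *_) (sym (br-pred p r)))
          (trans (l (q ^ rank x) (br q r) p) (cong (br q r * (q ^ rank x * p) +_) (sym (card-rank x)))))))))))) 
    where
      l : ∀ a b p → a * (b * p + 1) ≡ b * (a * p) + a
      l = solve-∀
      per-y : ∀ y → (x ⊆ᵇ y) × (y ⊆ᵇ z) × (rank y ≡ suc (rank x)) →
        count (λ v → ((x ⊆ᵇ y) × (y ⊆ᵇ z) × (rank y ≡ suc (rank x))) × (v ∈ y ₓ) × ¬ (v ∈ x ₓ)) ≡ q ^ rank x * p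
      per-y y w@(xy , yz , ry) = trans (count-cong {Q = λ v → (v ∈ y ₓ) × ¬ (v ∈ x ₓ)} (λ v t → proj₂ t) (λ v t → w , t))
        (+-cancelʳ-≡ (card x) _ _ (trans (sym (card-diff xy)) (trans (card-rank y) (trans (cong (q ^_) ry)
          (trans (l′ (q ^ rank x) p) (cong (q ^ rank x * p +_) (sym (card-rank x))))))))
        where l′ : ∀ a p → suc p * a ≡ a * p + a
              l′ = solve-∀
      per-v : ∀ v → (v ∈ z ₓ) × ¬ (v ∈ x ₓ) →
        count (λ y → ((x ⊆ᵇ y) × (y ⊆ᵇ z) × (rank y ≡ suc (rank x))) × (v ∈ y ₓ) × ¬ (v ∈ x ₓ)) ≡ 1
      per-v v (vz , nv) = trans (count-cong {Q = λ y → y ≡ x ∪ line v} {{Q? = λ {y} → y ≟ _}}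
          (λ { y ((xy , yz , ry) , vy , _) → let le = ∪-lub xy (to-⊆ λ u hu → span-⊆ (v ∷ []) (λ { zero → vy }) (Span.set-∈ (v ∷ []) hu)) in
            sub-ext (λ u → from-⊆ (rank-eq le (≤-reflexive (trans ry (sym (rank-add nv)))))) (λ u → from-⊆ le) })
          (λ { y refl → (∪ˡ , ∪-lub h (to-⊆ λ u hu → span-⊆ (v ∷ []) (λ { zero → vz }) (Span.set-∈ (v ∷ []) hu)) , rank-add nv) ,
            from-⊆ ∪ʳ (∈-line v) , nv }))
        (count-≡ (x ∪ line v))

  geometry : ∀ d′ → d ≡ d′ → Geom p d′
  geometry d′ ed = record
    { X = Subspace ; _⊑_ = _⊆ᵇ_ ; ⊑-irr = ⊆ᵇ-irr ; ⊑-refl = to-⊆ λ v h → h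
    ; ⊑-trans = λ h k → to-⊆ λ v w → from-⊆ k (from-⊆ h w)
    ; ⊑-antisym = antisym
    ; _⊓_ = _∩_ ; _⊔_ = _∪_
    ; ⊓ˡ = λ {x} {y} → to-⊆ λ v h → proj₁ (Meet.set-∈ x y h)
    ; ⊓ʳ = λ {x} {y} → to-⊆ λ v h → proj₂ (Meet.set-∈ x y h)
    ; ⊓-glb = λ {x} {y} h k → to-⊆ λ v w → Meet.∈-set x y (from-⊆ h w , from-⊆ k w)
    ; ⊔ˡ = ∪ˡ ; ⊔ʳ = ∪ʳ ; ⊔-lub = ∪-lub
    ; 𝟘 = bot ; 𝟙 = top
    ; 𝟘-min = λ {x} → to-⊆ λ v h → subst (λ t → t ∈ x ₓ) (sym (bot-zero h)) ∈-zero
    ; 𝟙-max = to-⊆ λ v h → ∈-top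
    ; rk = rank ; rk-𝟘 = rank-bot ; rk-𝟙 = trans rank-top ed
    ; rk-mono = rank-mono ; rk-eq = rank-eq ; rk-mod = rank-mod ; 1≤p = 1≤p
    ; ups = covers
    ; dns = dns-from-ups q _⊆ᵇ_ (to-⊆ λ v h → h) (λ h k → to-⊆ λ v w → from-⊆ k (from-⊆ h w)) antisym rank rank-eq covers (s≤s z≤n)
    }
    where
      antisym : ∀ {x y} → x ⊆ᵇ y → y ⊆ᵇ x → x ≡ y
      antisym h k = sub-ext (λ v → from-⊆ h) (λ v → from-⊆ k)

  opaque
    ⟦_⟧ : ∀ {i} → Sub i → Subspace
    ⟦ S ⟧ = Span.set (basis S)

    rank-⟦⟧ : ∀ {i} (S : Sub i) → rank ⟦ S ⟧ ≡ suc i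
    rank-⟦⟧ S = rank-span (Sub.indep S)

    ⟦⟧-⊆ : ∀ {i j} (S : Sub i) (T : Sub j) → S ⊆S T → ⟦ S ⟧ ⊆ᵇ ⟦ T ⟧
    ⟦⟧-⊆ S T h = to-⊆ λ v w → Span.∈-set (basis T) (h v (Span.set-∈ (basis S) w))

    ⊆-⟦⟧ : ∀ {i j} (S : Sub i) (T : Sub j) → ⟦ S ⟧ ⊆ᵇ ⟦ T ⟧ → S ⊆S T
    ⊆-⟦⟧ S T h v w = Span.set-∈ (basis T) (from-⊆ h (Span.∈-set (basis S) w))

    disjoint-rank : ∀ {i j} (S : Sub i) (T : Sub j) → Disjoint S T → rank (⟦ S ⟧ ∩ ⟦ T ⟧) ≡ 0
    disjoint-rank S T h = n≤0⇒n≡0 (≤-trans (rank-mono (to-⊆ λ v w → let (a , b) = Meet.set-∈ ⟦ S ⟧ ⟦ T ⟧ w in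
      subst (λ t → t ∈ bot ₓ) (sym (h v (Span.set-∈ (basis S) a) (Span.set-∈ (basis T) b))) ∈-zero)) (≤-reflexive rank-bot))

    rank-disjoint : ∀ {i j} (S : Sub i) (T : Sub j) → rank (⟦ S ⟧ ∩ ⟦ T ⟧) ≡ 0 → Disjoint S T
    rank-disjoint S T e v a b = bot-zero (from-⊆ (rank-eq {bot} (to-⊆ λ u h → subst (λ t → t ∈ ⟦ S ⟧ ∩ ⟦ T ⟧ ₓ) (sym (bot-zero h)) ∈-zero)
      (≤-reflexive (trans e (sym rank-bot)))) (Meet.∈-set ⟦ S ⟧ ⟦ T ⟧ (Span.∈-set (basis S) a , Span.∈-set (basis T) b)))

    to-Sub : ∀ {i} (x : Subspace) → rank x ≡ suc i → Σ (Sub i) λ S → ⟦ S ⟧ ≡ x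
    to-Sub {i} x e = go (rank x) e (basis-of x)
      where
        go : ∀ r → r ≡ suc i → (Σ (Vec V r) λ bs → LinIndep bs × (∀ {v} → InSpan v bs → v ∈ x ₓ) × (∀ {v} → v ∈ x ₓ → InSpan v bs)) →
          Σ (Sub i) λ S → ⟦ S ⟧ ≡ x
        go .(suc i) refl (bs , ind , out , into) = sub bs ind ,
          sub-ext (λ v h → out (Span.set-∈ bs h)) (λ v h → Span.∈-set bs (into h))

-- The constants, and the outcomes at a point and at a hyperplane.

C-of : ℕ → ℕ
C-of k = c₂-of k + c₅-of k + c₆-of k + 4 * κ-of k

-- The summands serve in turn `planes-bound`, `power-ratio`, the separation of (a) from (b), and
-- that of (c) from both. In `C-of` the summand 4κ is the cost of `all-through`.
q₀-of : ℕ → ℕ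
q₀-of k = 72 + 3 * (suc (suc k) + k) + suc (6 * 2 ^ k * 2 ^ suc k) + suc (2 ^ suc k * C-of k)

module Sides {p k : ℕ} (G : Geom p (suc (suc (suc k) + suc (suc k))))
  (F : Geom.X G × Geom.X G → Set) {{F? : ∀ {φ} → Dec (F φ)}}
  (F-A : ∀ {φ} → F φ → Geom.rk G (proj₁ φ) ≡ suc (suc k))
  (F-B : ∀ {φ} → F φ → Geom.rk G (proj₂ φ) ≡ suc (suc (suc k)))
  (F-⊑ : ∀ {φ} → F φ → Geom._⊑_ G (proj₁ φ) (proj₂ φ))
  (F-int : ∀ {φ ψ} → F φ → F ψ → GeomProps.Dj G (proj₁ φ) (proj₂ ψ) → GeomProps.Dj G (proj₁ ψ) (proj₂ φ) → Empty)
  (F-max : ∀ φ → (Geom.rk G (proj₁ φ) ≡ suc (suc k)) × (Geom.rk G (proj₂ φ) ≡ suc (suc (suc k))) × Geom._⊑_ G (proj₁ φ) (proj₂ φ) →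
    (∀ ψ → F ψ → GeomProps.Dj G (proj₁ φ) (proj₂ ψ) → GeomProps.Dj G (proj₁ ψ) (proj₂ φ) → Empty) → F φ)
  (1≤k : 1 ≤ k) (q≥ : q₀-of k ≤ suc p) where

  open GeomProps G
  open FlagFamily G F F-A F-B F-⊑ F-int using (n; n′; κ)
  open FlagBranch G F F-A F-B F-⊑ F-int using (Few; few; Avoiding; c₂; c₅; c₆)
  open MaximalFamily G F F-A F-B F-⊑ F-int using (IsFlag; Pencil; T₀; G₀; f₀; T₀≤; all-through; module Through)

  ByLine ByHyper : X → X → Set
  ByLine x L = ∀ φ → IsFlag φ →
    (F φ → (x ⊑ proj₁ φ) ⊎ (L ⊑ proj₂ φ)) × ((x ⊑ proj₁ φ) ⊎ (L ⊑ proj₂ φ) → F φ)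
  ByHyper x H = ∀ φ → IsFlag φ →
    (F φ → (x ⊑ proj₁ φ) ⊎ ((x ⊑ proj₂ φ) × (proj₂ φ ⊑ H))) × ((x ⊑ proj₁ φ) ⊎ ((x ⊑ proj₂ φ) × (proj₂ φ ⊑ H)) → F φ)

  Shape : X → Set
  Shape x = (Σ X λ L → (rk L ≡ 2) × (x ⊑ L) × ByLine x L) ⊎ (Σ X λ H → (rk H ≡ n + n) × (x ⊑ H) × ByHyper x H)

  Outcome : X → Set
  Outcome x = (rk x ≡ 1) × (∀ φ → Pencil x φ → F φ) ×
    (((count F ≡ T₀ + G₀ * q ^ n) × Shape x) ⊎ count F ≤ T₀ + f₀ * q ^ n)

  bound : ℕ
  bound = C-of k * q ^ flag-expo k

  few-≤ : ∀ {c N} → c ≤ C-of k → Few c N → N ≤ bound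
  few-≤ {c} {N} h (few f) = *-cancelʳ-≤ N _ (q ^ (2 + n)) {{m^n≢0 q (2 + n)}} (≤-trans f (≤-trans (*-monoˡ-≤ (q ^ (n * suc n + n)) h)
      (≤-reflexive (trans (cong (C-of k *_) (trans (cong (q ^_) (l k)) (^-distribˡ-+-* q (flag-expo k) (2 + n)))) (sym (*-assoc (C-of k) _ _))))))
    where l : ∀ k → suc (suc k) * suc (suc (suc k)) + suc (suc k) ≡ k * k + 5 * k + 4 + (2 + suc (suc k))
          l = solve-∀

  private
    q-large : 2 ^ suc k * C-of k < q
    q-large = ≤-trans (m≤n+m (suc (2 ^ suc k * C-of k)) (72 + 3 * (n + k) + suc (6 * 2 ^ k * 2 ^ suc k))) q≥

    q-large′ : 6 * 2 ^ k * 2 ^ suc k < q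
    q-large′ = ≤-trans (≤-trans (m≤n+m (suc (6 * 2 ^ k * 2 ^ suc k)) (72 + 3 * (n + k))) (m≤m+n _ _)) q≥

    q-72 : 72 ≤ q
    q-72 = ≤-trans (≤-trans (m≤m+n 72 (3 * (n + k))) (≤-trans (m≤m+n _ _) (m≤m+n _ _))) q≥

    q-3 : 3 * (n + k) ≤ q
    q-3 = ≤-trans (≤-trans (m≤n+m (3 * (n + k)) 72) (≤-trans (m≤m+n _ _) (m≤m+n _ _))) q≥

    n′+1+n : n′ + suc n ≤ suc (n + n)
    n′+1+n = ≤-trans (≤-reflexive (+-suc n′ n)) (n≤1+n (n + n))

  T₀-large : bound < T₀
  T₀-large = pencil-large G k (C-of k) n′+1+n q-large

  f₀<G₀ : f₀ < G₀
  f₀<G₀ = fnq<gauss G k 1≤k (≤-trans (+-monoʳ-≤ n′ (n≤1+n n)) n′+1+n) q-large′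

  pencil-bound : ∀ {x} → rk x ≡ 1 → (∀ φ → Pencil x φ → F φ) → ¬ (count F ≤ bound)
  pencil-bound ex h le = 1+n≰n (≤-trans (≤-trans T₀-large (T₀≤ ex h)) le)

  sizes-differ : ¬ (T₀ + G₀ * q ^ n ≤ T₀ + f₀ * q ^ n)
  sizes-differ h = 1+n≰n (≤-trans (*-monoˡ-< (q ^ n) {{m^n≢0 q n}} f₀<G₀) (+-cancelˡ-≤ T₀ _ _ h))

  outcome : ¬ (count F ≤ bound) → ∀ {x c} → rk x ≡ 1 → Few c (count (Avoiding x)) → c + 4 * κ ≤ C-of k → Outcome x
  outcome big {x} ex ec hc = ex , pencil , (case trichotomy of λ
      { (inj₁ s) → inj₁ (Structure.size s , Structure.shape s)
      ; (inj₂ nt) → inj₂ (nontrivial-size 1≤k q-72 q-3 nt) })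
    where open Through F-max x ex (all-through ex ec (λ f → big (few-≤ hc f)))

  Avoid : X → X × X → Set
  Avoid = Avoiding

  c₂-ok : c₂ + 4 * κ ≤ C-of k
  c₂-ok = +-monoˡ-≤ (4 * κ) (≤-trans (m≤m+n c₂ c₅) (m≤m+n _ c₆))

  c₅-ok : c₅ + 4 * κ ≤ C-of k
  c₅-ok = +-monoˡ-≤ (4 * κ) (≤-trans (m≤n+m c₅ c₂) (m≤m+n _ c₆))

  c₆-ok : c₆ ≤ C-of k
  c₆-ok = ≤-trans (m≤n+m c₆ (c₂ + c₅)) (m≤m+n _ _)

module BothSides {p k : ℕ} (G : Geom p (suc (suc (suc k) + suc (suc k))))
  (F : Geom.X G × Geom.X G → Set) {{F? : ∀ {φ} → Dec (F φ)}}
  (F-A : ∀ {φ} → F φ → Geom.rk G (proj₁ φ) ≡ suc (suc k))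
  (F-B : ∀ {φ} → F φ → Geom.rk G (proj₂ φ) ≡ suc (suc (suc k)))
  (F-⊑ : ∀ {φ} → F φ → Geom._⊑_ G (proj₁ φ) (proj₂ φ))
  (F-int : ∀ {φ ψ} → F φ → F ψ → GeomProps.Dj G (proj₁ φ) (proj₂ ψ) → GeomProps.Dj G (proj₁ ψ) (proj₂ φ) → Empty)
  (F-max : ∀ φ → (Geom.rk G (proj₁ φ) ≡ suc (suc k)) × (Geom.rk G (proj₂ φ) ≡ suc (suc (suc k))) × Geom._⊑_ G (proj₁ φ) (proj₂ φ) →
    (∀ ψ → F ψ → GeomProps.Dj G (proj₁ φ) (proj₂ ψ) → GeomProps.Dj G (proj₁ ψ) (proj₂ φ) → Empty) → F φ)
  (1≤k : 1 ≤ k) (q≥ : q₀-of k ≤ suc p) where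

  open GeomProps G
  open FlagFamily G F F-A F-B F-⊑ F-int using (n)
  module FB = FlagBranch G F F-A F-B F-⊑ F-int

  dual? : ∀ {φ} → Dec (dual-family F φ)
  dual? {b , a} = F? {a , b}

  private
    N : ℕ
    N = suc (n + n)

    un-co : ∀ {x r} → N ∸ rk x ≡ r → rk x ≡ N ∸ r
    un-co {x} e = trans (sym (m∸[m∸n]≡n (rk≤d G x))) (cong (N ∸_) e)

    co-Dj : ∀ {x y} → rk x + rk y ≡ N → Dj x y → N ∸ rk (x ⊔ y) ≡ 0
    co-Dj {x} {y} e h = m≤n⇒m∸n≡0 (≤-reflexive (sym (trans (rk-⊔-Dj h) e)))

  flag-co : ∀ {a b} → (N ∸ rk b ≡ n) × (N ∸ rk a ≡ suc n) × (a ⊑ b) → (rk a ≡ n) × (rk b ≡ suc n) × (a ⊑ b)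
  flag-co (eb , ea , ab) = trans (un-co ea) (m+n∸m≡n n n) , trans (un-co eb) (m+n∸n≡m (suc n) n) , ab

  co-flag : ∀ {a b} → (rk a ≡ n) × (rk b ≡ suc n) × (a ⊑ b) → (N ∸ rk b ≡ n) × (N ∸ rk a ≡ suc n) × (a ⊑ b)
  co-flag (ea , eb , ab) = trans (cong (N ∸_) eb) (m+n∸m≡n n n) , trans (cong (N ∸_) ea) (m+n∸n≡m (suc n) n) , ab

  co-max : ∀ φ → (N ∸ rk (proj₁ φ) ≡ n) × (N ∸ rk (proj₂ φ) ≡ suc n) × (proj₂ φ ⊑ proj₁ φ) →
    (∀ ψ → dual-family F ψ → GeomProps.Dj (dual G) (proj₁ φ) (proj₂ ψ) → GeomProps.Dj (dual G) (proj₁ ψ) (proj₂ φ) → Empty) →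
    dual-family F φ
  co-max (b , a) fl h = F-max (a , b) (flag-co fl) λ { (a′ , b′) f dj dj′ →
    h (b′ , a′) f
      (co-Dj (trans (cong₂ _+_ (proj₁ (proj₂ (flag-co fl))) (F-A f)) refl) (Dj-sym dj′))
      (co-Dj (cong₂ _+_ (F-B f) (proj₁ (flag-co fl))) (Dj-sym dj)) }

  module S = Sides G F F-A F-B F-⊑ F-int F-max 1≤k q≥
  module S* = Sides (dual G) (dual-family F) {{λ {φ} → dual? {φ}}} (λ {φ} → FB.co-A {φ}) (λ {φ} → FB.co-B {φ}) (λ {φ} f → F-⊑ f)
    (λ {φ} {ψ} → FB.co-int {φ} {ψ}) co-max 1≤k q≥

  count-dual : {P : X × X → Set} {{P? : ∀ {φ} → Dec (P φ)}} → count (dual-family P) {{λ { {b , a} → P? {a , b} }}} ≡ count P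
  count-dual {P} {{P?}} = count-bij {{P? = λ { {b , a} → P? {a , b} }}} (λ { (b , a) → a , b }) (λ { (a , b) → b , a }) (λ { (b , a) h → h }) (λ { (a , b) h → h })
    (λ { (b , a) _ → refl }) (λ { (a , b) _ → refl })

  large-outcome : ¬ (count F ≤ S.bound) → (Σ X S.Outcome) ⊎ (Σ X S*.Outcome)
  large-outcome big with FB.conclusion
  ... | inj₁ (x , ex , ec) = inj₁ (x , S.outcome big ex ec S.c₂-ok)
  ... | inj₂ (inj₂ f) = ⊥-elim (big (S.few-≤ S.c₆-ok f))
  ... | inj₂ (inj₁ (h , eh , FB.few f)) = inj₂ (h , S*.outcome (λ le → big (≤-trans (≤-reflexive (sym (count-dual {F}))) le))
        {c = c₅-of k} eh′ (FlagBranch.few (≤-trans (*-monoˡ-≤ (q ^ (2 + n)) le) f)) S*.c₅-ok)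
    where
      eh′ : N ∸ rk h ≡ 1
      eh′ = trans (cong (N ∸_) eh) (m+n∸n≡m 1 (n + n))
      -- In the dual, avoiding h means that `b ⊔ h` is the whole space, which rules out b ≤ h.
      le = count-inj {P = S*.Avoid h} {Q = λ φ → F φ × ¬ (proj₂ φ ⊑ h)} (λ { (b , a) → a , b })
        (λ { (b , a) (f , dj) → f , λ bh → 1+n≰n
          (≤-trans (m∸n≡0⇒m≤n dj) (≤-trans (rk-mono (⊔-lub ⊑-refl bh)) (≤-reflexive eh))) })
        (λ { (b , a) (b′ , a′) _ _ refl → refl })

-- From lists of flags to the lattice, and the theorem.

module _ {Y Z : Set} {{_ : Finite Z}} (key : Y → Z) where

  HasKey : List Y → Z → Set
  HasKey ys z = Any (λ y → key y ≡ z) ys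

  has-key? : ∀ ys {z} → Dec (HasKey ys z)
  has-key? ys {z} = Any.any? (λ y → key y ≟ z) ys

  private
    at : ∀ {ys z} → HasKey ys z → Σ (Fin (length ys)) λ i → key (Data.List.lookup ys i) ≡ z
    at (here e) = zero , e
    at (there h) = let (i , e) = at h in suc i , e

  count-keys : ∀ ys → (∀ i j → key (Data.List.lookup ys i) ≡ key (Data.List.lookup ys j) → i ≡ j) →
    count (HasKey ys) {{λ {z} → has-key? ys {z}}} ≡ length ys
  count-keys [] h = count-none {{P? = λ {z} → has-key? [] {z}}} λ { z () }
  count-keys (y ∷ ys) h = trans
    (count-⊎ {P = λ z → z ≡ key y} {Q = HasKey ys} {{λ {z} → z ≟ key y}} {{λ {z} → has-key? ys {z}}} {{λ {z} → has-key? (y ∷ ys) {z}}}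
      (λ { z (here e) → inj₁ (sym e) ; z (there w) → inj₂ w }) (λ z e → here (sym e)) (λ z w → there w)
      (λ z e w → let (i , e′) = at w in case h zero (suc i) (trans (sym e) (sym e′)) of λ ()))
    (cong₂ _+_ (count-≡ (key y)) (count-keys ys λ i j e → Data.Fin.Properties.suc-injective (h (suc i) (suc j) e)))

module Concrete {p k : ℕ} (K : FiniteField (suc p)) (1≤k : 1 ≤ k) (q≥ : q₀-of k ≤ suc p)
  (L : List (Geometry.Flag K (suc (suc k)))) (max : Geometry.MaximalCoclique K (suc (suc k)) L) where

  n : ℕ
  n = suc (suc k)

  q : ℕ
  q = suc p

  open Geometry K n
  open Linear K n

  G : Geom p (suc (n + n))
  G = geometry (suc (n + n)) (l k)
    where l : ∀ k → 2 * suc (suc k) + 1 ≡ suc (suc (suc k) + suc (suc k))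
          l = solve-∀

  key : Flag → Subspace × Subspace
  key f = ⟦ fA f ⟧ , ⟦ fB f ⟧

  record InL (φ : Subspace × Subspace) : Set where
    constructor inL
    field any : HasKey key L φ

  instance
    InL? : ∀ {φ} → Dec (InL φ)
    InL? {φ} = Relation.Nullary.Decidable.map′ inL InL.any (has-key? key L {φ})

  ≈-⟦⟧ : ∀ {i} {S T : Sub i} → S ≈S T → ⟦ S ⟧ ≡ ⟦ T ⟧
  ≈-⟦⟧ {S = S} {T} (h , h′) = sub-ext (λ v → from-⊆ (⟦⟧-⊆ S T h)) (λ v → from-⊆ (⟦⟧-⊆ T S h′))

  ⟦⟧-≈ : ∀ {i} {S T : Sub i} → ⟦ S ⟧ ≡ ⟦ T ⟧ → S ≈S T
  ⟦⟧-≈ {S = S} {T} e = ⊆-⟦⟧ S T (to-⊆ λ v → subst (λ x → v ∈ x ₓ) e) , ⊆-⟦⟧ T S (to-⊆ λ v → subst (λ x → v ∈ x ₓ) (sym e))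

  FlagEq-key : ∀ f g → FlagEq f g → key f ≡ key g
  FlagEq-key f g (h , h′) = cong₂ _,_ (≈-⟦⟧ {S = fA f} {fA g} h) (≈-⟦⟧ {S = fB f} {fB g} h′)

  key-FlagEq : ∀ f g → key f ≡ key g → FlagEq f g
  key-FlagEq f g e = ⟦⟧-≈ {S = fA f} {fA g} (cong proj₁ e) , ⟦⟧-≈ {S = fB f} {fB g} (cong proj₂ e)

  ∈F-InL : ∀ f → f ∈F L → InL (key f)
  ∈F-InL f h = inL (Any.map (λ {g} e → sym (FlagEq-key f g e)) h)

  InL-∈F : ∀ f → InL (key f) → f ∈F L
  InL-∈F f (inL h) = Any.map (λ {g} e → key-FlagEq f g (sym e)) h

  member : ∀ {φ} → InL φ → Σ Flag λ f → (f ∈ L) × (key f ≡ φ)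
  member (inL h) = find h

  count-L : count InL ≡ length L
  count-L = trans (count-cong {{Q? = λ {z} → has-key? key L {z}}} (λ φ → InL.any) (λ φ → inL))
    (count-keys key L λ i j e → proj₁ (proj₁ max) i j (key-FlagEq (Data.List.lookup L i) (Data.List.lookup L j) e))

  F-A : ∀ {φ} → InL φ → rank (proj₁ φ) ≡ n
  F-A w with member w
  ... | f , _ , refl = rank-⟦⟧ (fA f)

  F-B : ∀ {φ} → InL φ → rank (proj₂ φ) ≡ suc n
  F-B w with member w
  ... | f , _ , refl = rank-⟦⟧ (fB f)

  F-⊑ : ∀ {φ} → InL φ → proj₁ φ ⊆ᵇ proj₂ φ
  F-⊑ w with member w
  ... | f , _ , refl = ⟦⟧-⊆ (fA f) (fB f) (A⊆B f)

  F-int : ∀ {φ ψ} → InL φ → InL ψ → rank (proj₁ φ ∩ proj₂ ψ) ≡ 0 → rank (proj₁ ψ ∩ proj₂ φ) ≡ 0 → Empty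
  F-int w w′ h h′ with member w | member w′
  ... | f , fL , refl | g , gL , refl = proj₂ (proj₁ max) f g fL gL (rank-disjoint (fA f) (fB g) h , rank-disjoint (fA g) (fB f) h′)

  realize : ∀ φ → (rank (proj₁ φ) ≡ n) × (rank (proj₂ φ) ≡ suc n) × (proj₁ φ ⊆ᵇ proj₂ φ) → Σ Flag λ f → key f ≡ φ
  realize (a , b) (ea , eb , ab) with to-Sub a ea | to-Sub b eb
  ... | S , refl | T , refl = flag S T (⊆-⟦⟧ S T ab) , refl

  F-max : ∀ φ → (rank (proj₁ φ) ≡ n) × (rank (proj₂ φ) ≡ suc n) × (proj₁ φ ⊆ᵇ proj₂ φ) →
    (∀ ψ → InL ψ → rank (proj₁ φ ∩ proj₂ ψ) ≡ 0 → rank (proj₁ ψ ∩ proj₂ φ) ≡ 0 → Empty) → InL φ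
  F-max φ fl h with realize φ fl
  ... | f , refl = ∈F-InL f (proj₂ max f λ g gL opp → h (key g) (inL (lose gL refl))
          (disjoint-rank (fA f) (fB g) (proj₁ opp)) (disjoint-rank (fA g) (fB f) (proj₂ opp)))

  open BothSides G InL (λ {φ} → F-A {φ}) (λ {φ} → F-B {φ}) (λ {φ} → F-⊑ {φ}) (λ {φ} {ψ} → F-int {φ} {ψ}) F-max 1≤k q≥
    using (module S; module S*; large-outcome; count-dual; flag-co; co-flag)

  private
    n′ = suc k

  T G₀ : ℕ
  T = gauss q (2 * n) (n ∸ 1) * gauss q (n + 1) 1
  G₀ = gauss q (2 * n ∸ 1) (n ∸ 1)

  T-eq : gauss q (n′ + suc n) n′ * br q (suc n) ≡ T
  T-eq = cong₂ _*_ (cong (λ t → gauss q t n′) (l k)) (trans (sym (gauss-1 p 1≤p n)) (cong (λ t → gauss q t 1) (+-comm 1 n)))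
    where l : ∀ k → suc k + suc (suc (suc k)) ≡ 2 * suc (suc k)
          l = solve-∀

  G₀-eq : gauss q (n′ + n) n′ ≡ G₀
  G₀-eq = cong (λ t → gauss q t n′) (l k)
    where l : ∀ k → suc k + suc (suc k) ≡ suc (k + suc (suc (k + 0)))
          l = solve-∀

  bound-eq : C-of k * q ^ flag-expo k ≡ C-of k * q ^ (n * n + n ∸ 2)
  bound-eq = cong (λ e → C-of k * q ^ e) (sym (trans (cong (_∸ 2) (l k)) (m+n∸n≡m (flag-expo k) 2)))
    where l : ∀ k → suc (suc k) * suc (suc k) + suc (suc k) ≡ k * k + 5 * k + 4 + 2
          l = solve-∀

  no-⊆ : ∀ {i j} (S : Sub i) (T : Sub j) → S ⊆S T → i ≤ j
  no-⊆ S T h = ≤-pred (subst₂ _≤_ (rank-⟦⟧ S) (rank-⟦⟧ T) (rank-mono (⟦⟧-⊆ S T h)))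

  flag-ok : ∀ f → (rank ⟦ fA f ⟧ ≡ n) × (rank ⟦ fB f ⟧ ≡ suc n) × (⟦ fA f ⟧ ⊆ᵇ ⟦ fB f ⟧)
  flag-ok f = rank-⟦⟧ (fA f) , rank-⟦⟧ (fB f) , ⟦⟧-⊆ (fA f) (fB f) (A⊆B f)

  private
    rank-hyper : suc (2 * n ∸ 1) ≡ n + n
    rank-hyper = cong (λ t → suc (suc (k + suc (suc t)))) (+-identityʳ k)

    rank-co2 : suc (2 * n ∸ 2) ≡ n + n ∸ 1
    rank-co2 = cong (λ t → suc (k + suc (suc t))) (+-identityʳ k)

    n<hyper : ¬ (2 * n ∸ 1 ≤ n)
    n<hyper h = 1+n≰n (≤-trans (+-monoʳ-≤ 3 (m≤m+n k k)) (≤-trans (≤-reflexive (l k)) h))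
      where l : ∀ k → 3 + (k + k) ≡ suc (k + suc (suc (k + 0)))
            l = solve-∀

    n<co2 : ¬ (2 * n ∸ 2 ≤ n ∸ 1)
    n<co2 h = 1+n≰n (≤-trans (≤-trans (+-monoʳ-≤ 2 (m≤m+n k k)) (≤-reflexive (l k))) h)
      where l : ∀ k → 2 + (k + k) ≡ k + suc (suc (k + 0))
            l = solve-∀

  ContainsPoint ContainsHyper : Set
  ContainsPoint = Σ Point λ P → ContainsAll L (λ φ → P ⊆S fA φ)
  ContainsHyper = Σ Hyperplane λ H → ContainsAll L (λ φ → fB φ ⊆S H)

  ¬small-point : ContainsPoint → ¬ (length L ≤ C-of k * q ^ flag-expo k)
  ¬small-point (P , h) le = S.pencil-bound (rank-⟦⟧ P)
    (λ φ w → case realize φ (proj₁ w) of λ { (f , refl) → ∈F-InL f (h f (⊆-⟦⟧ P (fA f) (proj₂ w))) })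
    (≤-trans (≤-reflexive count-L) le)

  ¬small-hyper : ContainsHyper → ¬ (length L ≤ C-of k * q ^ flag-expo k)
  ¬small-hyper (H , h) le = S*.pencil-bound {⟦ H ⟧} (trans (cong (suc (n + n) ∸_) (trans (rank-⟦⟧ H) rank-hyper)) (m+n∸n≡m 1 (n + n)))
    (λ { (b , a) w → case realize (a , b) (flag-co (proj₁ w)) of λ { (f , refl) → ∈F-InL f (h f (⊆-⟦⟧ (fB f) H (proj₂ w))) } })
    (≤-trans (≤-reflexive (trans (count-dual {InL}) count-L)) le)

  A-large : CatA L → ¬ (length L ≤ C-of k * q ^ flag-expo k)
  A-large (e , _) le = 1+n≰n (≤-trans (≤-trans S.T₀-large (≤-trans (≤-reflexive T-eq) (m≤m+n T _))) (≤-trans (≤-reflexive (sym e)) le))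

  A-not-B : length L ≡ T + G₀ * q ^ n → length L ≤ T + fnq n q * q ^ n → Empty
  A-not-B e h = S.sizes-differ (subst₂ _≤_ (trans e (sym (cong₂ (λ t g → t + g * q ^ n) T-eq G₀-eq)))
    (cong (_+ fnq n q * q ^ n) (sym T-eq)) h)

  size-eq : ∀ {c} → c ≡ length L → c ≡ gauss q (n′ + suc n) n′ * br q (suc n) + gauss q (n′ + n) n′ * q ^ n → length L ≡ T + G₀ * q ^ n
  size-eq e e′ = trans (sym e) (trans e′ (cong₂ (λ t g → t + g * q ^ n) T-eq G₀-eq))

  size-le : ∀ {c} → c ≡ length L → c ≤ gauss q (n′ + suc n) n′ * br q (suc n) + fnq n q * q ^ n → length L ≤ T + fnq n q * q ^ n
  size-le e h = ≤-trans (≤-reflexive (sym e)) (≤-trans h (≤-reflexive (cong (_+ fnq n q * q ^ n) T-eq)))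

  through-line : ∀ (P : Point) {ℓ} → (Σ Line λ X → ⟦ X ⟧ ≡ ℓ) → ⟦ P ⟧ ⊆ᵇ ℓ → S.ByLine ⟦ P ⟧ ℓ → StructA2 L
  through-line P (X , refl) xℓ char = P , inj₂ (X , ⊆-⟦⟧ P X xℓ , λ f →
    (λ h → case proj₁ (char (key f) (flag-ok f)) (∈F-InL f h) of λ
      { (inj₁ w) → inj₁ (⊆-⟦⟧ P (fA f) w)
      ; (inj₂ w) → inj₂ (inj₁ (⊆-⟦⟧ X (fB f) w) , λ v u → ⊆-⟦⟧ X (fB f) w v (⊆-⟦⟧ P X xℓ v u)) }) ,
    (λ { (inj₁ w) → InL-∈F f (proj₂ (char (key f) (flag-ok f)) (inj₁ (⟦⟧-⊆ P (fA f) w)))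
       ; (inj₂ (inj₁ w , _)) → InL-∈F f (proj₂ (char (key f) (flag-ok f)) (inj₂ (⟦⟧-⊆ X (fB f) w)))
       -- Incidence also allows B inside the line X, which the dimensions exclude.
       ; (inj₂ (inj₂ w , _)) → case no-⊆ (fB f) X w of λ { (s≤s ()) } }))

  in-hyperplane : ∀ (P : Point) {h} → (Σ Hyperplane λ X → ⟦ X ⟧ ≡ h) → ⟦ P ⟧ ⊆ᵇ h → S.ByHyper ⟦ P ⟧ h → StructA2 L
  in-hyperplane P (X , refl) xH char = P , inj₁ (X , ⊆-⟦⟧ P X xH , λ f →
    (λ h → case proj₁ (char (key f) (flag-ok f)) (∈F-InL f h) of λ
      { (inj₁ w) → inj₁ (⊆-⟦⟧ P (fA f) w)
      ; (inj₂ (w , w′)) → inj₂ (inj₂ (⊆-⟦⟧ (fB f) X w′) , ⊆-⟦⟧ P (fB f) w) }) ,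
    (λ { (inj₁ w) → InL-∈F f (proj₂ (char (key f) (flag-ok f)) (inj₁ (⟦⟧-⊆ P (fA f) w)))
       ; (inj₂ (inj₂ w , w′)) → InL-∈F f (proj₂ (char (key f) (flag-ok f)) (inj₂ (⟦⟧-⊆ P (fB f) w′ , ⟦⟧-⊆ (fB f) X w)))
       ; (inj₂ (inj₁ w , _)) → ⊥-elim (n<hyper (no-⊆ X (fB f) w)) }))

  from-point : ∀ {x} → (Σ Point λ P → ⟦ P ⟧ ≡ x) → S.Outcome x → CatA L ⊎ CatB L
  from-point (P , refl) (ex , pencil , inj₂ le) = inj₂ (size-le count-L le , inj₂ (P , λ f h →
    InL-∈F f (pencil (key f) (flag-ok f , ⟦⟧-⊆ P (fA f) h))))
  from-point (P , refl) (ex , pencil , inj₁ (e , inj₁ (ℓ , eℓ , xℓ , char))) =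
    inj₁ (size-eq count-L e , inj₂ (through-line P (to-Sub ℓ eℓ) xℓ char))
  from-point (P , refl) (ex , pencil , inj₁ (e , inj₂ (h , eh , xh , char))) =
    inj₁ (size-eq count-L e , inj₂ (in-hyperplane P (to-Sub h (trans eh (sym rank-hyper))) xh char))

  co-key : Flag → Subspace × Subspace
  co-key f = ⟦ fB f ⟧ , ⟦ fA f ⟧

  private
    un-co : ∀ {x r} → suc (n + n) ∸ rank x ≡ r → rank x ≡ suc (n + n) ∸ r
    un-co {x} e = trans (sym (m∸[m∸n]≡n (rk≤d G x))) (cong (suc (n + n) ∸_) e)

  over-co2 : ∀ (H : Hyperplane) {ℓ} → (Σ Space2n-2 λ X → ⟦ X ⟧ ≡ ℓ) → ℓ ⊆ᵇ ⟦ H ⟧ → S*.ByLine ⟦ H ⟧ ℓ → StructA1 L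
  over-co2 H (X , refl) xℓ char = H , inj₂ (X , ⊆-⟦⟧ X H xℓ , λ f →
    (λ h → case proj₁ (char (co-key f) (co-flag (flag-ok f))) (∈F-InL f h) of λ
      { (inj₁ w) → inj₁ (⊆-⟦⟧ (fB f) H w)
      ; (inj₂ w) → inj₂ ((λ v u → ⊆-⟦⟧ X H xℓ v (⊆-⟦⟧ (fA f) X w v u)) , inj₂ (⊆-⟦⟧ (fA f) X w)) }) ,
    (λ { (inj₁ w) → InL-∈F f (proj₂ (char (co-key f) (co-flag (flag-ok f))) (inj₁ (⟦⟧-⊆ (fB f) H w)))
       ; (inj₂ (_ , inj₂ w)) → InL-∈F f (proj₂ (char (co-key f) (co-flag (flag-ok f))) (inj₂ (⟦⟧-⊆ (fA f) X w)))
       ; (inj₂ (_ , inj₁ w)) → ⊥-elim (n<co2 (no-⊆ X (fA f) w)) }))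

  over-point : ∀ (H : Hyperplane) {x} → (Σ Point λ X → ⟦ X ⟧ ≡ x) → x ⊆ᵇ ⟦ H ⟧ → S*.ByHyper ⟦ H ⟧ x → StructA1 L
  over-point H (X , refl) xQ char = H , inj₁ (X , ⊆-⟦⟧ X H xQ , λ f →
    (λ h → case proj₁ (char (co-key f) (co-flag (flag-ok f))) (∈F-InL f h) of λ
      { (inj₁ w) → inj₁ (⊆-⟦⟧ (fB f) H w)
      ; (inj₂ (w , w′)) → inj₂ (⊆-⟦⟧ (fA f) H w , inj₁ (⊆-⟦⟧ X (fA f) w′)) }) ,
    (λ { (inj₁ w) → InL-∈F f (proj₂ (char (co-key f) (co-flag (flag-ok f))) (inj₁ (⟦⟧-⊆ (fB f) H w)))
       ; (inj₂ (w , inj₁ w′)) → InL-∈F f (proj₂ (char (co-key f) (co-flag (flag-ok f))) (inj₂ (⟦⟧-⊆ (fA f) H w , ⟦⟧-⊆ X (fA f) w′)))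
       ; (inj₂ (_ , inj₂ w)) → case no-⊆ (fA f) X w of λ () }))

  from-hyper : ∀ {x} → (Σ Hyperplane λ H → ⟦ H ⟧ ≡ x) → S*.Outcome x → CatA L ⊎ CatB L
  from-hyper (H , refl) (ex , pencil , inj₂ le) = inj₂ (size-le (trans (count-dual {InL}) count-L) le , inj₁ (H , λ f h →
    InL-∈F f (pencil (co-key f) (co-flag (flag-ok f) , ⟦⟧-⊆ (fB f) H h))))
  from-hyper (H , refl) (ex , pencil , inj₁ (e , inj₁ (ℓ , eℓ , xℓ , char))) =
    inj₁ (size-eq (trans (count-dual {InL}) count-L) e , inj₁ (over-co2 H (to-Sub ℓ (trans (un-co eℓ) (sym rank-co2))) xℓ char))
  from-hyper (H , refl) (ex , pencil , inj₁ (e , inj₂ (x , ex′ , xh , char))) =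
    inj₁ (size-eq (trans (count-dual {InL}) count-L) e , inj₁ (over-point H (to-Sub x (trans (un-co ex′) (m+n∸n≡m 1 (n + n)))) xh char))

  exactly-one : ExactlyOne (CatA L) (CatB L) (CatC (C-of k) L)
  -- Size alone decides (c): the size in (a) and the full pencil contained in a family of (b) both
  -- exceed its bound.
  exactly-one with decide (length L ≤ C-of k * q ^ flag-expo k)
  ... | inj₁ small = inj₂ (inj₂ ((λ a → A-large a small) ,
          (λ { (_ , inj₁ h) → ¬small-hyper h small ; (_ , inj₂ h) → ¬small-point h small }) ,
          ≤-trans small (≤-reflexive bound-eq)))
  ... | inj₂ large = conclude (case large-outcome (λ le → large (≤-trans (≤-reflexive (sym count-L)) le)) of λ
          { (inj₁ (x , o)) → from-point (to-Sub x (proj₁ o)) o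
          ; (inj₂ (x , o)) → from-hyper (to-Sub x (trans (un-co (proj₁ o)) (sym rank-hyper))) o })
    where
      ¬C : ¬ CatC (C-of k) L
      ¬C h = large (≤-trans h (≤-reflexive (sym bound-eq)))
      conclude : CatA L ⊎ CatB L → ExactlyOne (CatA L) (CatB L) (CatC (C-of k) L)
      conclude (inj₁ a) = inj₁ (a , (λ b → A-not-B (proj₁ a) (proj₁ b)) , ¬C)
      conclude (inj₂ b) = inj₂ (inj₁ ((λ a → A-not-B (proj₁ a) (proj₁ b)) , b , ¬C))

C-pos : ∀ k → 0 < C-of k
C-pos k = ≤-trans (≤-trans (≤-trans (m^n>0 2 (suc (suc (suc k)))) (≤-reflexive (sym (κ-def k)))) (m≤m+n (κ-of k) _)) (m≤n+m (4 * κ-of k) (c₂-of k + c₅-of k + c₆-of k))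

theorem1 : (n : ℕ) → 3 ≤ n →
    Σ ℕ λ q0 → Σ ℕ λ C → (0 < C) ×
    (∀ {q} (F : FiniteField q) → q0 ≤ q →
    (L : List (Geometry.Flag F n)) → Geometry.MaximalCoclique F n L →
    ExactlyOne (Geometry.CatA F n L) (Geometry.CatB F n L)
    (Geometry.CatC F n C L))
theorem1 (suc (suc k)) (s≤s (s≤s 1≤k)) = q₀-of k , C-of k , C-pos k , λ
  { {zero} F h L max → case FiniteField.0F F of λ ()
  ; {suc p} F h L max → Concrete.exactly-one F 1≤k h L max }
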